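{- Let $p$ be a prime number and let $\varepsilon>0$. There is a constant $C(\varepsilon)$ such that the following holds. Let $\Gamma\subseteq \mathbb{F}_p^*$ be a multiplicative subgroup with $C(\varepsilon)\le |\Gamma| \le p^{2/3-\varepsilon}$. Then for any sets $A,B\subseteq \mathbb{F}_p$ with $|A|>1$ and $|B|>1$ one has $\Gamma \neq A+B$.
   Context: $\mathbb{F}_p$ is the field with $p$ elements and $\mathbb{F}_p^*$ its multiplicative group. For $A,B\subseteq\mathbb{F}_p$, $A+B=\{a+b : a\in A,\ b\in B\}$. -}

module Defs where

open import Data.Nat using (ℕ; _+_; _*_; _<_; _≤_; _^_)
open import Data.Fin using (Fin; toℕ)
open import Data.Fin.Subset using (Subset; _∈_; _∉_)
open import Data.Product using (Σ; ∃; _×_)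
open import Relation.Binary.PropositionalEquality using (_≡_)
open import Relation.Nullary using (¬_)

-- Elements of 𝔽_p are represented by Fin p (residues 0,…,p-1).
-- ReducesTo p m r : "m ≡ r (mod p)" for a residue r (r < p), i.e. m mod p = r.
ReducesTo : ℕ → ℕ → ℕ → Set
ReducesTo p m r = ∃ λ k → m ≡ r + k * p

IsMulSubgroup : (p : ℕ) → Subset p → Set
IsMulSubgroup p Γ =
  (∀ x → x ∈ Γ → ¬ (toℕ x ≡ 0))
  × (Σ (Fin p) λ u → u ∈ Γ × toℕ u ≡ 1)
  × (∀ x y z → x ∈ Γ → y ∈ Γ → ReducesTo p (toℕ x * toℕ y) (toℕ z) → z ∈ Γ)
  × (∀ x → x ∈ Γ → Σ (Fin p) λ y → y ∈ Γ × ReducesTo p (toℕ x * toℕ y) 1)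

InSumset : {p : ℕ} → Subset p → Subset p → Fin p → Set
InSumset {p} A B x =
  Σ (Fin p) λ a → Σ (Fin p) λ b → a ∈ A × b ∈ B × ReducesTo p (toℕ a + toℕ b) (toℕ x)

EqualsSumset : {p : ℕ} → Subset p → Subset p → Subset p → Set
EqualsSumset {p} Γ A B = ∀ (x : Fin p) → (x ∈ Γ → InSumset A B x) × (InSumset A B x → x ∈ Γ)

{-# OPTIONS --safe #-}
module Submission where

-- Put α ∈ −A, β ∈ B, n = |A|, m = |B|, d = |Γ|, so that (β − α)^d = 1 in 𝔽_p, and let
-- q = Π (x − α), g = Π (x − β).  With the weights c_α of the divided difference at the α, the
-- polynomial Σ c_α (x − α)^(d+n−1) − 1 has degree d and vanishes to order n at each β
-- (Hanson–Petridis), so nm ≤ d, hence nm = d and the polynomial is a multiple of g^n.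
-- Its next two Taylor coefficients at β relate q and g to second and third order there; together
-- with the same relations at the α this forces the identity
--   n(n+1) q g″ − 2(d−1) q′ g′ + m(m+1) q″ g = 0,
-- since the left side has degree less than n + m and vanishes at all α and β; if n = m there is a
-- similar identity of third order.
-- Translate so that Σ α = 0 and compare coefficients.  If n ≠ m, the vanishing of the power sums
-- of Γ gives a second linear relation between the first nonzero coefficients of q and g below the
-- leading ones, and there are none: q = x^n.  If n = m, these coefficients sit at a weight k ≥ 3
-- which is a root of a quadratic polynomial that has no other root in range, so q and g are
-- polynomials in x^k times a power of x; comparing the lowest coefficients gives a contradiction.
-- All constants that have to be invertible modulo p are at most 14 d^(3/2) in size, which is where
-- the exponent 2/3 comes from.

open import Data.Nat using (ℕ)
open import Data.Nat.Primality using (Prime)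

-- The bound `nm ≤ d` alone contradicts nothing, as `d` may well factor; the contradiction must come
-- from the equality case, where `aux` is known so well that its further Taylor coefficients carry
-- information. At weight `w` the second-order identity and the power sums give two linear relations
-- between the coefficients `a` of `q` and `b` of `g`. Their determinant is, up to nonzero factors,
-- `(m − n)(w + 3)` for even `w` and `(w − 1)(m + n + 2)` for odd `w`. It is zero at `w = 1`, which
-- is why a translation is needed. For `n = m` it is zero at every even `w`: both relations then
-- read `a + b = 0`. Hence the third-order identity, taken antisymmetric in `q` and `g` so as to
-- control `a − b`. Only that case uses more than `2d < p`: excluding a second root of the quadratic
-- polynomial in the weight requires a number of size up to about `6n³`, with `n² = d`, to be
-- invertible. All computations are with integers and divisibility by `p`; multiplicities are read
-- off Taylor coefficients, so no factorial is ever inverted.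

module Polynomials where

  open import Data.Integer using (ℤ; +_; -_; _+_; _-_; _*_; _^_)
  import Data.Integer.Properties as ℤ
  open import Data.Integer.Tactic.RingSolver using (solve-∀)
  open import Data.List using (List; []; _∷_; length; replicate; map)
  open import Data.Nat as ℕ using (zero; suc; s≤s)
  import Data.Nat.Properties as ℕ
  open import Data.Nat.Combinatorics using (_C_; nCk+nC[k+1]≡[n+1]C[k+1]; k>n⇒nCk≡0)
  open import Function using (_∘_)
  open import Relation.Binary.PropositionalEquality
  open import Relation.Nullary using (Dec; yes; no)
  open ≡-Reasoning

  -- Antidiagonal sums and Taylor coefficients of integer polynomials

  +-congʳ : ∀ x {y z} → y ≡ z → x + y ≡ x + z
  +-congʳ x = cong (λ z → x + z)

  antidiag : (ℕ → ℕ → ℤ) → ℕ → ℤ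
  antidiag f zero    = f 0 0
  antidiag f (suc k) = f 0 (suc k) + antidiag (λ i j → f (suc i) j) k

  antidiag-cong : ∀ {f g} → (∀ i j → f i j ≡ g i j) → ∀ k → antidiag f k ≡ antidiag g k
  antidiag-cong eq zero    = eq 0 0
  antidiag-cong eq (suc k) = cong₂ _+_ (eq 0 (suc k)) (antidiag-cong (λ i j → eq (suc i) j) k)

  antidiag-linear : ∀ a f g k →
    antidiag (λ i j → a * f i j + g i j) k ≡ a * antidiag f k + antidiag g k
  antidiag-linear a f g zero    = refl
  antidiag-linear a f g (suc k)
    rewrite antidiag-linear a (λ i j → f (suc i) j) (λ i j → g (suc i) j) k =
    alg a (f 0 (suc k)) (g 0 (suc k)) (antidiag (λ i j → f (suc i) j) k)
      (antidiag (λ i j → g (suc i) j) k)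
    where
    alg : ∀ a x y u v → a * x + y + (a * u + v) ≡ a * (x + u) + (y + v)
    alg = solve-∀

  antidiag-zero : ∀ {f} k → (∀ i j → i ℕ.+ j ≡ k → f i j ≡ + 0) → antidiag f k ≡ + 0
  antidiag-zero zero    eq = eq 0 0 refl
  antidiag-zero (suc k) eq =
    cong₂ _+_ (eq 0 (suc k) refl) (antidiag-zero k λ i j h → eq (suc i) j (cong suc h))

  antidiag-shiftˡ : ∀ f → (∀ j → f 0 j ≡ + 0) → ∀ k →
    antidiag f (suc k) ≡ antidiag (λ i j → f (suc i) j) k
  antidiag-shiftˡ f f0 k rewrite f0 (suc k) = ℤ.+-identityˡ _

  antidiag-shiftʳ : ∀ f → (∀ i → f i 0 ≡ + 0) → ∀ k →
    antidiag f (suc k) ≡ antidiag (λ i j → f i (suc j)) k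
  antidiag-shiftʳ f f0 zero    rewrite f0 1 = ℤ.+-identityʳ _
  antidiag-shiftʳ f f0 (suc k) =
    +-congʳ (f 0 (suc (suc k))) (antidiag-shiftʳ (λ i j → f (suc i) j) (f0 ∘ suc) k)

  -- A polynomial is the list of its coefficients, constant term first; taylor b f l is the
  -- coefficient of s^l in f(b + s).
  Poly : Set
  Poly = List ℤ

  taylor : ℤ → Poly → ℕ → ℤ
  taylor b []      l       = + 0
  taylor b (c ∷ f) zero    = c + b * taylor b f 0
  taylor b (c ∷ f) (suc l) = b * taylor b f (suc l) + taylor b f l

  coeff : Poly → ℕ → ℤ
  coeff = taylor (+ 0)

  add : Poly → Poly → Poly
  add []      g       = g
  add (c ∷ f) []      = c ∷ f
  add (c ∷ f) (e ∷ g) = (c + e) ∷ add f g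

  scale : ℤ → Poly → Poly
  scale k = map (k *_)

  mul : Poly → Poly → Poly
  mul []      g = []
  mul (c ∷ f) g = add (scale c g) (+ 0 ∷ mul f g)

  der : Poly → Poly
  der []      = []
  der (c ∷ f) = add f (+ 0 ∷ der f)

  taylor-add : ∀ b f g l → taylor b (add f g) l ≡ taylor b f l + taylor b g l
  taylor-add b []      g       l       = sym (ℤ.+-identityˡ _)
  taylor-add b (c ∷ f) []      l       = sym (ℤ.+-identityʳ _)
  taylor-add b (c ∷ f) (e ∷ g) zero    rewrite taylor-add b f g 0 =
    alg b c e (taylor b f 0) (taylor b g 0)
    where
    alg : ∀ b c e x y → c + e + b * (x + y) ≡ c + b * x + (e + b * y)
    alg = solve-∀
  taylor-add b (c ∷ f) (e ∷ g) (suc l)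
    rewrite taylor-add b f g (suc l) | taylor-add b f g l =
    alg b (taylor b f (suc l)) (taylor b g (suc l)) (taylor b f l) (taylor b g l)
    where
    alg : ∀ b x y u v → b * (x + y) + (u + v) ≡ b * x + u + (b * y + v)
    alg = solve-∀

  taylor-scale : ∀ b k f l → taylor b (scale k f) l ≡ k * taylor b f l
  taylor-scale b k []      l       = sym (ℤ.*-zeroʳ k)
  taylor-scale b k (c ∷ f) zero    rewrite taylor-scale b k f 0 = alg b k c (taylor b f 0)
    where
    alg : ∀ b k c x → k * c + b * (k * x) ≡ k * (c + b * x)
    alg = solve-∀
  taylor-scale b k (c ∷ f) (suc l)
    rewrite taylor-scale b k f (suc l) | taylor-scale b k f l =
    alg b k (taylor b f (suc l)) (taylor b f l)
    where
    alg : ∀ b k x y → b * (k * x) + k * y ≡ k * (b * x + y)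
    alg = solve-∀

  taylor-mul : ∀ b f g l →
    taylor b (mul f g) l ≡ antidiag (λ i j → taylor b f i * taylor b g j) l
  taylor-mul b []      g l    = sym (antidiag-zero l λ _ _ _ → refl)
  taylor-mul b (c ∷ f) g zero
    rewrite taylor-add b (scale c g) (+ 0 ∷ mul f g) 0 | taylor-scale b c g 0
          | taylor-mul b f g 0 =
    alg b c (taylor b f 0) (taylor b g 0)
    where
    alg : ∀ b c x y → c * y + (+ 0 + b * (x * y)) ≡ (c + b * x) * y
    alg = solve-∀
  taylor-mul b (c ∷ f) g (suc k)
    rewrite taylor-add b (scale c g) (+ 0 ∷ mul f g) (suc k) | taylor-scale b c g (suc k)
          | taylor-mul b f g (suc k) | taylor-mul b f g k = begin
    c * t g (suc k) + (b * (t f 0 * t g (suc k) + A) + B)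
      ≡⟨ alg b c (t f 0) (t g (suc k)) A B ⟩
    (c + b * t f 0) * t g (suc k) + (b * A + B)
      ≡⟨ +-congʳ ((c + b * t f 0) * t g (suc k)) (sym (antidiag-linear b (λ i j → t f (suc i) * t g j) (λ i j → t f i * t g j) k)) ⟩
    (c + b * t f 0) * t g (suc k) +
      antidiag (λ i j → b * (t f (suc i) * t g j) + t f i * t g j) k
      ≡⟨ +-congʳ ((c + b * t f 0) * t g (suc k)) (antidiag-cong (λ i j → alg₂ b (t f (suc i)) (t f i) (t g j)) k) ⟩
    (c + b * t f 0) * t g (suc k) +
      antidiag (λ i j → (b * t f (suc i) + t f i) * t g j) k ∎
    where
    t = taylor b
    A = antidiag (λ i j → t f (suc i) * t g j) k
    B = antidiag (λ i j → t f i * t g j) k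
    alg : ∀ b c x y u v → c * y + (b * (x * y + u) + v) ≡ (c + b * x) * y + (b * u + v)
    alg = solve-∀
    alg₂ : ∀ b x y z → b * (x * z) + y * z ≡ (b * x + y) * z
    alg₂ = solve-∀

  taylor-der : ∀ b f l → taylor b (der f) l ≡ + suc l * taylor b f (suc l)
  taylor-der b []      l    = sym (ℤ.*-zeroʳ (+ suc l))
  taylor-der b (c ∷ f) zero
    rewrite taylor-add b f (+ 0 ∷ der f) 0 | taylor-der b f 0 =
    alg b (taylor b f 0) (taylor b f 1)
    where
    alg : ∀ b x y → x + (+ 0 + b * (+ 1 * y)) ≡ + 1 * (b * y + x)
    alg = solve-∀
  taylor-der b (c ∷ f) (suc k)
    rewrite taylor-add b f (+ 0 ∷ der f) (suc k) | taylor-der b f (suc k) | taylor-der b f k =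
    alg b (+ suc k) (taylor b f (suc k)) (taylor b f (suc (suc k)))
    where
    alg : ∀ b K x y → x + (b * ((+ 1 + K) * y) + K * x) ≡ (+ 1 + K) * (b * y + x)
    alg = solve-∀

  -- The quotient of c ∷ f by x − b, which does not depend on c.
  quot : ℤ → Poly → Poly
  quot b []      = []
  quot b (c ∷ f) = taylor b (c ∷ f) 0 ∷ quot b f

  length-quot : ∀ b f → length (quot b f) ≡ length f
  length-quot b []      = refl
  length-quot b (c ∷ f) = cong suc (length-quot b f)

  taylor-quot-zero : ∀ b y c f →
    taylor y (c ∷ f) 0 ≡ taylor b (c ∷ f) 0 + (y - b) * taylor y (quot b f) 0
  taylor-quot-zero b y c []      = alg b y c
    where
    alg : ∀ b y c → c + y * + 0 ≡ c + b * + 0 + (y - b) * + 0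
    alg = solve-∀
  taylor-quot-zero b y c (e ∷ f) rewrite taylor-quot-zero b y e f =
    alg b y c (e + b * taylor b f 0) (taylor y (quot b f) 0)
    where
    alg : ∀ b y c r x → c + y * (r + (y - b) * x) ≡ c + b * r + (y - b) * (r + y * x)
    alg = solve-∀

  taylor-quot-suc : ∀ b y c f l →
    taylor y (c ∷ f) (suc l) ≡ (y - b) * taylor y (quot b f) (suc l) + taylor y (quot b f) l
  taylor-quot-suc b y c []      l       = alg b y
    where
    alg : ∀ b y → y * + 0 + + 0 ≡ (y - b) * + 0 + + 0
    alg = solve-∀
  taylor-quot-suc b y c (e ∷ f) zero
    rewrite taylor-quot-suc b y e f 0 | taylor-quot-zero b y e f =
    alg b y (e + b * taylor b f 0) (taylor y (quot b f) 1) (taylor y (quot b f) 0)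
    where
    alg : ∀ b y r u v → y * ((y - b) * u + v) + (r + (y - b) * v) ≡ (y - b) * (y * u + v) + (r + y * v)
    alg = solve-∀
  taylor-quot-suc b y c (e ∷ f) (suc l)
    rewrite taylor-quot-suc b y e f (suc l) | taylor-quot-suc b y e f l =
    alg b y (taylor y (quot b f) (suc (suc l))) (taylor y (quot b f) (suc l)) (taylor y (quot b f) l)
    where
    alg : ∀ b y u v w → y * ((y - b) * u + v) + ((y - b) * v + w) ≡ (y - b) * (y * u + v) + (y * v + w)
    alg = solve-∀

  taylor-quot-same : ∀ b c f l → taylor b (c ∷ f) (suc l) ≡ taylor b (quot b f) l
  taylor-quot-same b c f l =
    trans (taylor-quot-suc b b c f l) (alg b (taylor b (quot b f) (suc l)) (taylor b (quot b f) l))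
    where
    alg : ∀ b u v → (b - b) * u + v ≡ v
    alg = solve-∀

  -- c + (x − α) f
  affineMul : ℤ → ℤ → Poly → Poly
  affineMul α c []      = c ∷ []
  affineMul α c (e ∷ f) = (c - α * e) ∷ affineMul α e f

  length-affineMul : ∀ α c f → length (affineMul α c f) ≡ suc (length f)
  length-affineMul α c []      = refl
  length-affineMul α c (e ∷ f) = cong suc (length-affineMul α e f)

  taylor-affineMul-zero : ∀ y α c f →
    taylor y (affineMul α c f) 0 ≡ c + (y - α) * taylor y f 0
  taylor-affineMul-zero y α c []      = alg y α c
    where
    alg : ∀ y α c → c + y * + 0 ≡ c + (y - α) * + 0
    alg = solve-∀
  taylor-affineMul-zero y α c (e ∷ f) rewrite taylor-affineMul-zero y α e f =
    alg y α c e (taylor y f 0)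
    where
    alg : ∀ y α c e x → c - α * e + y * (e + (y - α) * x) ≡ c + (y - α) * (e + y * x)
    alg = solve-∀

  taylor-affineMul-suc : ∀ y α c f l →
    taylor y (affineMul α c f) (suc l) ≡ (y - α) * taylor y f (suc l) + taylor y f l
  taylor-affineMul-suc y α c []      l       = alg y α
    where
    alg : ∀ y α → y * + 0 + + 0 ≡ (y - α) * + 0 + + 0
    alg = solve-∀
  taylor-affineMul-suc y α c (e ∷ f) zero
    rewrite taylor-affineMul-suc y α e f 0 | taylor-affineMul-zero y α e f =
    alg y α e (taylor y f 0) (taylor y f 1)
    where
    alg : ∀ y α e u v → y * ((y - α) * v + u) + (e + (y - α) * u) ≡ (y - α) * (y * v + u) + (e + y * u)
    alg = solve-∀
  taylor-affineMul-suc y α c (e ∷ f) (suc l)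
    rewrite taylor-affineMul-suc y α e f (suc l) | taylor-affineMul-suc y α e f l =
    alg y α (taylor y f (suc (suc l))) (taylor y f (suc l)) (taylor y f l)
    where
    alg : ∀ y α u v w → y * ((y - α) * u + v) + ((y - α) * v + w) ≡ (y - α) * (y * u + v) + (y * v + w)
    alg = solve-∀

  fromRoots : List ℤ → Poly
  fromRoots []       = + 1 ∷ []
  fromRoots (α ∷ αs) = affineMul α (+ 0) (fromRoots αs)

  length-fromRoots : ∀ αs → length (fromRoots αs) ≡ suc (length αs)
  length-fromRoots []       = refl
  length-fromRoots (α ∷ αs) =
    trans (length-affineMul α (+ 0) (fromRoots αs)) (cong suc (length-fromRoots αs))

  taylor-fromRoots-zero : ∀ y α αs →
    taylor y (fromRoots (α ∷ αs)) 0 ≡ (y - α) * taylor y (fromRoots αs) 0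
  taylor-fromRoots-zero y α αs =
    trans (taylor-affineMul-zero y α (+ 0) (fromRoots αs)) (ℤ.+-identityˡ _)

  taylor-fromRoots-suc : ∀ y α αs l →
    taylor y (fromRoots (α ∷ αs)) (suc l) ≡
    (y - α) * taylor y (fromRoots αs) (suc l) + taylor y (fromRoots αs) l
  taylor-fromRoots-suc y α αs = taylor-affineMul-suc y α (+ 0) (fromRoots αs)

  taylor-beyond : ∀ y f l → length f ℕ.≤ l → taylor y f l ≡ + 0
  taylor-beyond y []      l       _         = refl
  taylor-beyond y (c ∷ f) (suc l) (s≤s le)
    rewrite taylor-beyond y f l le | taylor-beyond y f (suc l) (ℕ.m≤n⇒m≤1+n le) =
    trans (ℤ.+-identityʳ _) (ℤ.*-zeroʳ y)

  taylor-fromRoots-beyond : ∀ y αs l → length αs ℕ.< l → taylor y (fromRoots αs) l ≡ + 0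
  taylor-fromRoots-beyond y αs l lt =
    taylor-beyond y (fromRoots αs) l (subst (ℕ._≤ l) (sym (length-fromRoots αs)) lt)

  taylor-fromRoots-lead : ∀ y αs → taylor y (fromRoots αs) (length αs) ≡ + 1
  taylor-fromRoots-lead y []       = +-congʳ (+ 1) (ℤ.*-zeroʳ y)
  taylor-fromRoots-lead y (α ∷ αs)
    rewrite taylor-fromRoots-suc y α αs (length αs)
          | taylor-fromRoots-beyond y αs (suc (length αs)) ℕ.≤-refl
          | taylor-fromRoots-lead y αs
          | ℤ.*-zeroʳ (y - α) = refl

  -- A power of `x − α` is encoded as a repeated root, so that the facts about `fromRoots` on degree
  -- and leading coefficient apply to it; `α = 0` gives the monomials.
  linPow : ℤ → ℕ → Poly
  linPow α D = fromRoots (replicate D α)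

  -- Pascal's rule for the induction in `taylor-linPow`. Subtraction is truncated, so for `l ≥ D`
  -- the factor `x` does not raise `D ∸ suc l` to `D ∸ l`; the binomial coefficient of that term is
  -- then zero.
  pascal-pow : ∀ x D l →
    x * (+ (D C suc l) * x ^ (D ℕ.∸ suc l)) + + (D C l) * x ^ (D ℕ.∸ l) ≡
    + (suc D C suc l) * x ^ (D ℕ.∸ l)
  pascal-pow x D l = go (suc l ℕ.≤? D)
    where
    pascal : + (suc D C suc l) ≡ + (D C l) + + (D C suc l)
    pascal = trans (cong +_ (sym (nCk+nC[k+1]≡[n+1]C[k+1] D l))) (ℤ.pos-+ (D C l) (D C suc l))
    alg₁ : ∀ x b w z → x * (+ 0 * w) + b * z ≡ (b + + 0) * z
    alg₁ = solve-∀
    alg₂ : ∀ x b c z → x * (c * z) + b * (x * z) ≡ (b + c) * (x * z)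
    alg₂ = solve-∀
    Goal : ℤ → ℤ → ℤ → Set
    Goal c s z = x * (c * x ^ (D ℕ.∸ suc l)) + + (D C l) * z ≡ s * z
    go : Dec (suc l ℕ.≤ D) → Goal (+ (D C suc l)) (+ (suc D C suc l)) (x ^ (D ℕ.∸ l))
    go (yes sl≤D) = subst₂ (Goal (+ (D C suc l))) (sym pascal)
      (sym (cong (x ^_) (ℕ.+-∸-assoc 1 sl≤D)))
      (alg₂ x (+ (D C l)) (+ (D C suc l)) (x ^ (D ℕ.∸ suc l)))
    go (no sl≰D) = subst (λ s → Goal (+ (D C suc l)) s (x ^ (D ℕ.∸ l))) (sym pascal)
      (subst (λ c → Goal c (+ (D C l) + c) (x ^ (D ℕ.∸ l)))
        (sym (cong +_ (k>n⇒nCk≡0 (ℕ.≰⇒> sl≰D))))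
        (alg₁ x (+ (D C l)) (x ^ (D ℕ.∸ suc l)) (x ^ (D ℕ.∸ l))))

  taylor-linPow : ∀ y α D l → taylor y (linPow α D) l ≡ + (D C l) * (y - α) ^ (D ℕ.∸ l)
  taylor-linPow y α zero    zero    = +-congʳ (+ 1) (ℤ.*-zeroʳ y)
  taylor-linPow y α zero    (suc l) = trans (ℤ.+-identityʳ _) (ℤ.*-zeroʳ y)
  taylor-linPow y α (suc D) zero    =
    trans (taylor-fromRoots-zero y α (replicate D α))
      (trans (cong ((y - α) *_) (taylor-linPow y α D 0)) (alg (y - α) ((y - α) ^ D)))
    where
    alg : ∀ x z → x * (+ 1 * z) ≡ + 1 * (x * z)
    alg = solve-∀
  taylor-linPow y α (suc D) (suc l) =
    trans (taylor-fromRoots-suc y α (replicate D α) l)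
      (trans (cong₂ (λ u v → (y - α) * u + v) (taylor-linPow y α D (suc l)) (taylor-linPow y α D l))
        (pascal-pow (y - α) D l))

module ModuloPrime (p : ℕ) (p-prime : Prime p) where

  open Polynomials
  open import Data.Integer using (ℤ; +_; -_; _+_; _-_; _*_; _^_; ∣_∣)
  import Data.Integer.Divisibility.Signed as ℤ
  import Data.Integer.Properties as ℤ
  open import Data.Integer.Tactic.RingSolver using (solve-∀)
  open import Data.Empty using (⊥; ⊥-elim)
  open import Data.List using (List; []; _∷_; length; replicate; map; take; _++_)
  open import Data.List.Membership.Propositional using (_∈_)
  open import Data.List.Properties using (length-replicate; length-map; length-++)
  open import Data.List.Relation.Unary.All as All using (All; []; _∷_)
  import Data.List.Relation.Unary.All.Properties as All
  open import Data.List.Relation.Unary.AllPairs as AllPairs using (AllPairs; []; _∷_)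
  import Data.List.Relation.Unary.AllPairs.Properties as AllPairs
  open import Data.List.Relation.Unary.Any as Any using (Any; here; there)
  import Data.List.Relation.Unary.Any.Properties as Any
  open import Data.Nat as ℕ using (zero; suc; z≤n; s≤s)
  open import Data.Nat.Combinatorics using (_C_; nCk+nC[k+1]≡[n+1]C[k+1]; nC1≡n)
  import Data.Nat.Coprimality as ℕ
  import Data.Nat.Divisibility as ℕ
  import Data.Nat.GCD as GCD
  open import Data.Nat.Induction using (<-rec)
  open import Data.Nat.Primality using (euclidsLemma; prime⇒irreducible; prime⇒nonTrivial)
  import Data.Nat.Properties as ℕ
  import Data.Nat.Tactic.RingSolver as ℕ-Solver
  open import Data.Product using (∃; _×_; _,_; proj₁; proj₂)
  open import Data.Sum using (_⊎_; inj₁; inj₂; [_,_]′)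
  open import Function using (_∘_)
  open import Relation.Binary.Definitions using (Tri; tri<; tri≈; tri>)
  open import Relation.Binary.PropositionalEquality hiding (J)
  open import Relation.Nullary using (¬_; yes; no; Dec)
  open import Relation.Nullary.Decidable using (map′; _×-dec_)

  -- Arithmetic and root counting modulo p

  record Null (x : ℤ) : Set where
    constructor null
    field divides : + p ℤ.∣ x

  null-resp : ∀ {x y} → x ≡ y → Null x → Null y
  null-resp refl h = h

  null-0 : Null (+ 0)
  null-0 = null (ℤ.divides (+ 0) refl)

  null-p : Null (+ p)
  null-p = null (ℤ.divides (+ 1) (sym (ℤ.*-identityˡ (+ p))))

  -- With `null₂` and `null₃`, the form in which congruences are derived: the goal is written as an
  -- explicit integer combination of quantities known to be divisible by `p`. Most of the lemmas
  -- called `alg` check such integer identities.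
  null₁ : ∀ {e h} c → Null h → e ≡ c * h → Null e
  null₁ {h = h} c (null (ℤ.divides q eq)) e≡ =
    null (ℤ.divides (c * q) (trans e≡ (trans (cong (c *_) eq) (sym (ℤ.*-assoc c q (+ p))))))

  null₂ : ∀ {e h₁ h₂} c₁ c₂ → Null h₁ → Null h₂ → e ≡ c₁ * h₁ + c₂ * h₂ → Null e
  null₂ c₁ c₂ (null (ℤ.divides q₁ eq₁)) (null (ℤ.divides q₂ eq₂)) e≡ =
    null (ℤ.divides (c₁ * q₁ + c₂ * q₂)
      (trans e≡ (trans (cong₂ (λ x y → c₁ * x + c₂ * y) eq₁ eq₂) (alg c₁ c₂ q₁ q₂ (+ p)))))
    where
    alg : ∀ a b x y p → a * (x * p) + b * (y * p) ≡ (a * x + b * y) * p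
    alg = solve-∀

  null₃ : ∀ {e h₁ h₂ h₃} c₁ c₂ c₃ → Null h₁ → Null h₂ → Null h₃ →
    e ≡ c₁ * h₁ + c₂ * h₂ + c₃ * h₃ → Null e
  null₃ {h₁ = h₁} {h₂} {h₃} c₁ c₂ c₃ n₁ n₂ n₃ e≡ =
    null₂ (+ 1) c₃ (null₂ c₁ c₂ n₁ n₂ refl) n₃
      (trans e≡ (cong (λ z → z + c₃ * h₃) (sym (ℤ.*-identityˡ (c₁ * h₁ + c₂ * h₂)))))

  null-≡0 : ∀ {x} → x ≡ + 0 → Null x
  null-≡0 refl = null-0

  null-diff : ∀ {x y} → x ≡ y → Null (x - y)
  null-diff {x} refl = null-≡0 (ℤ.+-inverseʳ x)

  null-+ : ∀ {x y} → Null x → Null y → Null (x + y)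
  null-+ {x} {y} hx hy = null₂ (+ 1) (+ 1) hx hy (alg x y)
    where
    alg : ∀ x y → x + y ≡ + 1 * x + + 1 * y
    alg = solve-∀

  null-*ˡ : ∀ c {x} → Null x → Null (c * x)
  null-*ˡ c h = null₁ c h refl

  null-*ʳ : ∀ {x} → Null x → ∀ c → Null (x * c)
  null-*ʳ {x} h c = null₁ c h (ℤ.*-comm x c)

  null-integral : ∀ x y → Null (x * y) → Null x ⊎ Null y
  null-integral x y (null d)
    with euclidsLemma ∣ x ∣ ∣ y ∣ p-prime (subst (p ℕ.∣_) (ℤ.abs-* x y) (ℤ.∣⇒∣ᵤ d))
  ... | inj₁ h = inj₁ (null (ℤ.∣ᵤ⇒∣ h))
  ... | inj₂ h = inj₂ (null (ℤ.∣ᵤ⇒∣ h))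

  null-cancel : ∀ x {y} → ¬ Null x → Null (x * y) → Null y
  null-cancel x {y} ¬x h with null-integral x y h
  ... | inj₁ hx = ⊥-elim (¬x hx)
  ... | inj₂ hy = hy

  ¬null-* : ∀ {x y} → ¬ Null x → ¬ Null y → ¬ Null (x * y)
  ¬null-* {x} ¬x ¬y h = ¬y (null-cancel x ¬x h)

  ¬null-^ : ∀ {x} → ¬ Null x → ∀ k → ¬ Null (x ^ k)

  ¬null-small : ∀ k → 0 ℕ.< k → k ℕ.< p → ¬ Null (+ k)
  ¬null-small (suc k) _ k<p (null d) = ℕ.<⇒≱ k<p (ℕ.∣⇒≤ (ℤ.∣⇒∣ᵤ d))

  ¬null-1 : ¬ Null (+ 1)
  ¬null-1 = ¬null-small 1 (s≤s z≤n) (ℕ.nonTrivial⇒n>1 p {{prime⇒nonTrivial p-prime}})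

  ¬null-^ ¬x zero    = ¬null-1
  ¬null-^ ¬x (suc k) = ¬null-* ¬x (¬null-^ ¬x k)

  inverse : ∀ u → ¬ Null u → ∃ λ v → Null (u * v - + 1)
  inverse u ¬u = signed (ℤ.+∣i∣≡i⊎+∣i∣≡-i u)
    where
    coprime : ℕ.Coprime ∣ u ∣ p
    coprime {i} (i∣u , i∣p) with prime⇒irreducible p-prime i∣p
    ... | inj₁ i≡1 = i≡1
    ... | inj₂ i≡p = ⊥-elim (¬u (null (ℤ.∣ᵤ⇒∣ (subst (ℕ._∣ ∣ u ∣) i≡p i∣u))))
    absInverse : ∃ λ v → Null (+ ∣ u ∣ * v - + 1)
    absInverse with ℕ.coprime-Bézout coprime
    ... | GCD.Bézout.+- x y eq = + x , null₁ (+ y) null-p (lhs x y eq)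
      where
      alg : ∀ u x y p → + 1 + y * p ≡ x * u → u * x - + 1 ≡ y * p
      alg u x y p h = trans (cong (_- + 1) (trans (ℤ.*-comm u x) (sym h))) (alg′ (y * p))
        where
        alg′ : ∀ z → + 1 + z - + 1 ≡ z
        alg′ = solve-∀
      lhs : ∀ x y → 1 ℕ.+ y ℕ.* p ≡ x ℕ.* ∣ u ∣ → + ∣ u ∣ * + x - + 1 ≡ + y * + p
      lhs x y eq = alg (+ ∣ u ∣) (+ x) (+ y) (+ p)
        (trans (+-congʳ (+ 1) (sym (ℤ.pos-* y p))) (trans (cong +_ eq) (ℤ.pos-* x ∣ u ∣)))
    ... | GCD.Bézout.-+ x y eq = - (+ x) , null₁ (- (+ y)) null-p (lhs x y eq)
      where
      alg : ∀ u x y p → + 1 + x * u ≡ y * p → u * - x - + 1 ≡ - y * p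
      alg u x y p h = trans (alg₁ u x) (trans (cong -_ h) (alg₂ y p))
        where
        alg₁ : ∀ u x → u * - x - + 1 ≡ - (+ 1 + x * u)
        alg₁ = solve-∀
        alg₂ : ∀ y p → - (y * p) ≡ - y * p
        alg₂ = solve-∀
      lhs : ∀ x y → 1 ℕ.+ x ℕ.* ∣ u ∣ ≡ y ℕ.* p → + ∣ u ∣ * - (+ x) - + 1 ≡ - (+ y) * + p
      lhs x y eq = alg (+ ∣ u ∣) (+ x) (+ y) (+ p)
        (trans (+-congʳ (+ 1) (sym (ℤ.pos-* x ∣ u ∣))) (trans (cong +_ eq) (ℤ.pos-* y p)))
    signed : + ∣ u ∣ ≡ u ⊎ + ∣ u ∣ ≡ - u → ∃ λ v → Null (u * v - + 1)
    signed (inj₁ eq) = subst (λ u → ∃ λ v → Null (u * v - + 1)) eq absInverse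
    signed (inj₂ eq) = - v , null-resp (trans (cong (λ w → w * v - + 1) eq) (alg u v)) h
      where
      v = proj₁ absInverse
      h = proj₂ absInverse
      alg : ∀ u v → - u * v - + 1 ≡ u * - v - + 1
      alg = solve-∀

  -- Vanishing modulo `p` as a polynomial, not as a function. Quantifying over the centre `y` lets
  -- the conclusion be read at zero, at a root, or anywhere else.
  NullPoly : Poly → Set
  NullPoly f = ∀ y l → Null (taylor y f l)

  Distinct : List ℤ → Set
  Distinct = AllPairs (λ x y → ¬ Null (x - y))

  nullPoly-cons : ∀ {c f} → Null c → NullPoly f → NullPoly (c ∷ f)
  nullPoly-cons hc hf y zero    = null-+ hc (null-*ˡ y (hf y 0))
  nullPoly-cons hc hf y (suc l) = null-+ (null-*ˡ y (hf y (suc l))) (hf y l)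

  coeff-zero : ∀ c f → coeff (c ∷ f) 0 ≡ c
  coeff-zero c f = ℤ.+-identityʳ c

  coeff-suc : ∀ c f l → coeff (c ∷ f) (suc l) ≡ coeff f l
  coeff-suc c f l = ℤ.+-identityˡ (coeff f l)

  coeffs⇒nullPoly : ∀ f → (∀ l → Null (coeff f l)) → NullPoly f
  coeffs⇒nullPoly []      h y l = null-0
  coeffs⇒nullPoly (c ∷ f) h     = nullPoly-cons (null-resp (coeff-zero c f) (h 0))
    (coeffs⇒nullPoly f λ l → null-resp (coeff-suc c f l) (h (suc l)))

  -- A root b of multiplicity at least k is recorded by the vanishing of the first k Taylor
  -- coefficients at b.
  Root : ℕ → Poly → ℤ → Set
  Root k f b = ∀ l → l ℕ.< k → Null (taylor b f l)

  module _ (b c : ℤ) (f : Poly) (b-root : Null (taylor b (c ∷ f) 0)) where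

    nullPoly-quot : NullPoly (quot b f) → NullPoly (c ∷ f)
    nullPoly-quot h y zero    = null-resp (sym (taylor-quot-zero b y c f))
      (null-+ b-root (null-*ˡ (y - b) (h y 0)))
    nullPoly-quot h y (suc l) = null-resp (sym (taylor-quot-suc b y c f l))
      (null-+ (null-*ˡ (y - b) (h y (suc l))) (h y l))

    root-quot-same : ∀ {k} → Root (suc k) (c ∷ f) b → Root k (quot b f) b
    root-quot-same h l l<k = null-resp (taylor-quot-same b c f l) (h (suc l) (s≤s l<k))

    -- Away from `b` the factor `y − b` is invertible, so the Taylor coefficients of the quotient at
    -- `y` can be solved for one after another.
    root-quot-other : ∀ {k y} → ¬ Null (b - y) → Root k (c ∷ f) y → Root k (quot b f) y
    root-quot-other {k} {y} b≉y h = go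
      where
      y≉b : ¬ Null (y - b)
      y≉b n = b≉y (null₁ (- (+ 1)) n (alg b y))
        where
        alg : ∀ b y → b - y ≡ - (+ 1) * (y - b)
        alg = solve-∀
      alg₁ : ∀ r z → z ≡ - (+ 1) * r + + 1 * (r + z)
      alg₁ = solve-∀
      alg₂ : ∀ r z → z ≡ - (+ 1) * r + + 1 * (z + r)
      alg₂ = solve-∀
      go : Root k (quot b f) y
      go zero    l<k = null-cancel (y - b) y≉b
        (null₂ (- (+ 1)) (+ 1) b-root (null-resp (taylor-quot-zero b y c f) (h 0 l<k))
          (alg₁ (taylor b (c ∷ f) 0) ((y - b) * taylor y (quot b f) 0)))
      go (suc l) l<k = null-cancel (y - b) y≉b
        (null₂ (- (+ 1)) (+ 1) (go l (ℕ.<-trans ℕ.≤-refl l<k))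
          (null-resp (taylor-quot-suc b y c f l) (h (suc l) l<k))
          (alg₂ (taylor y (quot b f) l) ((y - b) * taylor y (quot b f) (suc l))))

  private
    -- One linear factor is divided out at a time. The point `b` is in progress, with `k` of its
    -- orders left, while the points of `bs` still have all `K`; when `k` reaches zero the next
    -- point takes over.
    manyRoots-short : ∀ K b k bs f → length f ℕ.≤ k ℕ.+ length bs ℕ.* K →
      Distinct (b ∷ bs) → Root k f b → All (Root K f) bs → NullPoly f
    manyRoots-short K b zero    []        []      le dis hb hbs y l = null-0
    manyRoots-short K b zero    (b′ ∷ bs) f       le (_ ∷ dis) hb (hb′ ∷ hbs) =
      manyRoots-short K b′ K bs f le dis hb′ hbs
    manyRoots-short K b (suc k) bs        []      le dis hb hbs y l = null-0
    manyRoots-short K b (suc k) bs        (c ∷ f) (s≤s le) dis@(b≉ ∷ _) hb hbs =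
      nullPoly-quot b c f root
        (manyRoots-short K b k bs (quot b f) (subst (ℕ._≤ _) (sym (length-quot b f)) le) dis
          (root-quot-same b c f root hb) (others b≉ hbs))
      where
      root = hb 0 (s≤s z≤n)
      others : ∀ {bs} → All (λ y → ¬ Null (b - y)) bs → All (Root K (c ∷ f)) bs →
        All (Root K (quot b f)) bs
      others []       []       = []
      others (n ∷ ns) (h ∷ hs) = root-quot-other b c f root n h ∷ others ns hs

  -- Degrees are controlled only modulo `p`, whereas `manyRoots-short` counts list entries.
  -- Truncation changes no Taylor coefficient modulo `p` and turns the first kind of bound into the
  -- second.
  taylor-take : ∀ N f → (∀ l → N ℕ.≤ l → Null (coeff f l)) →
    ∀ y l → Null (taylor y f l - taylor y (take N f) l)
  taylor-take zero    f       h y l = null-resp (sym (ℤ.+-identityʳ _))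
    (coeffs⇒nullPoly f (λ l → h l z≤n) y l)
  taylor-take (suc N) []      h y l = null-0
  taylor-take (suc N) (c ∷ f) h y l = go l
    where
    rec : ∀ y l → Null (taylor y f l - taylor y (take N f) l)
    rec = taylor-take N f λ l N≤l → null-resp (coeff-suc c f l) (h (suc l) (s≤s N≤l))
    alg₀ : ∀ c y u v → c + y * u - (c + y * v) ≡ y * (u - v)
    alg₀ = solve-∀
    alg₁ : ∀ y u v w z → y * u + w - (y * v + z) ≡ y * (u - v) + + 1 * (w - z)
    alg₁ = solve-∀
    go : ∀ l → Null (taylor y (c ∷ f) l - taylor y (c ∷ take N f) l)
    go zero    = null₁ y (rec y 0) (alg₀ c y (taylor y f 0) (taylor y (take N f) 0))
    go (suc l) = null₂ y (+ 1) (rec y (suc l)) (rec y l)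
      (alg₁ y (taylor y f (suc l)) (taylor y (take N f) (suc l)) (taylor y f l) (taylor y (take N f) l))

  length-take≤ : ∀ N (f : Poly) → length (take N f) ℕ.≤ N
  length-take≤ zero    f       = z≤n
  length-take≤ (suc N) []      = z≤n
  length-take≤ (suc N) (c ∷ f) = s≤s (length-take≤ N f)

  manyRoots⇒nullPoly : ∀ K bs f → Distinct bs → All (Root K f) bs →
    (∀ l → length bs ℕ.* K ℕ.≤ l → Null (coeff f l)) → NullPoly f
  manyRoots⇒nullPoly K []       f dis hbs h = coeffs⇒nullPoly f λ l → h l z≤n
  manyRoots⇒nullPoly K (b ∷ bs) f dis (hb ∷ hbs) h y l =
    null₂ (+ 1) (+ 1) (approx y l)
      (manyRoots-short K b K bs f′ (length-take≤ N f) dis (restrict hb) (All.map restrict hbs) y l)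
      (alg (taylor y f l) (taylor y f′ l))
    where
    N  = K ℕ.+ length bs ℕ.* K
    f′ = take N f
    approx : ∀ y l → Null (taylor y f l - taylor y f′ l)
    approx = taylor-take N f h
    alg : ∀ u v → u ≡ + 1 * (u - v) + + 1 * v
    alg = solve-∀
    alg′ : ∀ u v → v ≡ + 1 * u + - (+ 1) * (u - v)
    alg′ = solve-∀
    restrict : ∀ {b} → Root K f b → Root K f′ b
    restrict {b} hb l l<K = null₂ (+ 1) (- (+ 1)) (hb l l<K) (approx b l)
      (alg′ (taylor b f l) (taylor b f′ l))

  -- Divided differences

  Weighted : Set
  Weighted = List (ℤ × ℤ)

  points : Weighted → List ℤ
  points = map proj₁

  wsum : Weighted → (ℤ → ℤ) → ℤ
  wsum []             φ = + 0
  wsum ((α , c) ∷ ws) φ = c * φ α + wsum ws φ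

  wsum-cong : ∀ ws {φ ψ} → (∀ α → φ α ≡ ψ α) → wsum ws φ ≡ wsum ws ψ
  wsum-cong []             eq = refl
  wsum-cong ((α , c) ∷ ws) eq = cong₂ (λ u v → c * u + v) (eq α) (wsum-cong ws eq)

  wsum-linear : ∀ ws a φ ψ → wsum ws (λ α → a * φ α + ψ α) ≡ a * wsum ws φ + wsum ws ψ
  wsum-linear []             a φ ψ = sym (trans (ℤ.+-identityʳ _) (ℤ.*-zeroʳ a))
  wsum-linear ((α , c) ∷ ws) a φ ψ rewrite wsum-linear ws a φ ψ =
    alg a c (φ α) (ψ α) (wsum ws φ) (wsum ws ψ)
    where
    alg : ∀ a c x y u v → c * (a * x + y) + (a * u + v) ≡ a * (c * x + u) + (c * y + v)
    alg = solve-∀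

  wsum-* : ∀ ws a φ → wsum ws (λ α → a * φ α) ≡ a * wsum ws φ
  wsum-* []             a φ = sym (ℤ.*-zeroʳ a)
  wsum-* ((α , c) ∷ ws) a φ rewrite wsum-* ws a φ = alg a c (φ α) (wsum ws φ)
    where
    alg : ∀ a c x u → c * (a * x) + a * u ≡ a * (c * x + u)
    alg = solve-∀

  wsum-null : ∀ ws φ → All (λ α → Null (φ α)) (points ws) → Null (wsum ws φ)
  wsum-null []             φ []       = null-0
  wsum-null ((α , c) ∷ ws) φ (h ∷ hs) = null-+ (null-*ˡ c h) (wsum-null ws φ hs)

  moment : Weighted → ℤ → ℕ → ℤ
  moment ws x k = wsum ws (λ α → (x - α) ^ k)

  -- In the intended instance there are `k + 1` points and `c_α` is the product of `1 / (α′ − α)`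
  -- over the other points `α′`. This is the usual divided difference up to a sign, chosen so that
  -- the powers of `x − α` have top moment `1`.
  record DividedDifference (k : ℕ) (ws : Weighted) : Set where
    field
      low : ∀ x j → j ℕ.< k → Null (moment ws x j)
      top : ∀ x → Null (moment ws x k - + 1)

  module _ (α : ℤ) where

    divideBy : ∀ ws → All (λ β → ¬ Null (α - β)) (points ws) →
      ∃ λ ws′ → points ws′ ≡ points ws ×
        (∀ φ → Null (wsum ws′ (λ β → (α - β) * φ β) - wsum ws φ))
    divideBy []             []       = [] , refl , λ _ → null-0
    divideBy ((β , c) ∷ ws) (n ∷ ns) with inverse (α - β) n | divideBy ws ns
    ... | v , hv | ws′ , eq , h = (β , c * v) ∷ ws′ , cong (β ∷_) eq , λ φ →
      null₂ (c * φ β) (+ 1) hv (h φ)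
        (alg (α - β) c v (φ β) (wsum ws′ (λ β → (α - β) * φ β)) (wsum ws φ))
      where
      alg : ∀ a c v x s t → c * v * (a * x) + s - (c * x + t) ≡ c * x * (a * v - + 1) + + 1 * (s - t)
      alg = solve-∀

    module _ {k ws ws′} (D : DividedDifference k ws)
      (h : ∀ φ → Null (wsum ws′ (λ β → (α - β) * φ β) - wsum ws φ)) where
      open DividedDifference D

      -- The old weights have been divided by `α − β`, and `α` receives the weight that makes the
      -- total zero. Since `x − β = (x − α) + (α − β)`, the new moment of order `j + 1` is `x − α`
      -- times the new moment of order `j` plus the old moment of order `j`.
      extended : Weighted
      extended = (α , - wsum ws′ (λ _ → + 1)) ∷ ws′

      extended-zero : ∀ x → moment extended x 0 ≡ + 0
      extended-zero x = alg (wsum ws′ (λ _ → + 1))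
        where
        alg : ∀ s → - s * + 1 + s ≡ + 0
        alg = solve-∀

      extended-suc : ∀ x j → moment extended x (suc j) ≡
        (x - α) * moment extended x j + wsum ws′ (λ β → (α - β) * (x - β) ^ j)
      extended-suc x j = trans
        (+-congʳ (- wsum ws′ (λ _ → + 1) * ((x - α) * (x - α) ^ j))
          (trans (wsum-cong ws′ λ β → alg₁ x α β ((x - β) ^ j))
            (wsum-linear ws′ (x - α) (λ β → (x - β) ^ j) (λ β → (α - β) * (x - β) ^ j))))
        (alg₂ (x - α) (- wsum ws′ (λ _ → + 1)) ((x - α) ^ j) (moment ws′ x j)
          (wsum ws′ (λ β → (α - β) * (x - β) ^ j)))
        where
        alg₁ : ∀ x α β z → (x - β) * z ≡ (x - α) * z + (α - β) * z
        alg₁ = solve-∀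
        alg₂ : ∀ X s z u v → s * (X * z) + (X * u + v) ≡ X * (s * z + u) + v
        alg₂ = solve-∀

      extended-low : ∀ x j → j ℕ.< suc k → Null (moment extended x j)
      extended-low x zero    _         = null-≡0 (extended-zero x)
      extended-low x (suc j) (s≤s j<k) = null-resp (sym (extended-suc x j))
        (null₃ (x - α) (+ 1) (+ 1) (extended-low x j (ℕ.m≤n⇒m≤1+n j<k))
          (h (λ β → (x - β) ^ j)) (low x j j<k)
          (alg (x - α) (moment extended x j) (wsum ws′ (λ β → (α - β) * (x - β) ^ j)) (moment ws x j)))
        where
        alg : ∀ X u v w → X * u + v ≡ X * u + + 1 * (v - w) + + 1 * w
        alg = solve-∀

      extended-top : ∀ x → Null (moment extended x (suc k) - + 1)
      extended-top x = null-resp (cong (_- + 1) (sym (extended-suc x k)))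
        (null₃ (x - α) (+ 1) (+ 1) (extended-low x k ℕ.≤-refl) (h (λ β → (x - β) ^ k)) (top x)
          (alg (x - α) (moment extended x k) (wsum ws′ (λ β → (α - β) * (x - β) ^ k)) (moment ws x k)))
        where
        alg : ∀ X u v w → X * u + v - + 1 ≡ X * u + + 1 * (v - w) + + 1 * (w - + 1)
        alg = solve-∀

  dividedDifference : ∀ α αs → Distinct (α ∷ αs) →
    ∃ λ ws → points ws ≡ α ∷ αs × DividedDifference (length αs) ws
  dividedDifference α []       dis = (α , + 1) ∷ [] , refl , record
    { low = λ _ _ ()
    ; top = λ _ → null-0
    }
  dividedDifference α (α′ ∷ αs) (α≉ ∷ dis) with dividedDifference α′ αs dis
  ... | ws , eq , D with divideBy α ws (subst (All _) (sym eq) α≉)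
  ...   | ws′ , eq′ , h = extended α {ws = ws} {ws′} D h , cong (α ∷_) (trans eq′ eq) , record
    { low = extended-low α {ws = ws} {ws′} D h
    ; top = extended-top α {ws = ws} {ws′} D h
    }

  module _ {k ws} (D : DividedDifference k ws) (b : ℤ) where
    open DividedDifference D

    moment-poly-step : ∀ c f j →
      wsum ws (λ α → (b - α) ^ j * taylor α (c ∷ f) 0) ≡
      taylor b (c ∷ f) 0 * moment ws b j + - (+ 1) * wsum ws (λ α → (b - α) ^ suc j * taylor α (quot b f) 0)
    moment-poly-step c f j = trans
      (wsum-cong ws λ α → trans (cong ((b - α) ^ j *_) (taylor-quot-zero b α c f))
        (alg b α ((b - α) ^ j) (taylor b (c ∷ f) 0) (taylor α (quot b f) 0)))
      (trans (wsum-linear ws (taylor b (c ∷ f) 0) (λ α → (b - α) ^ j)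
               (λ α → - (+ 1) * ((b - α) ^ suc j * taylor α (quot b f) 0)))
        (+-congʳ (taylor b (c ∷ f) 0 * moment ws b j)
          (wsum-* ws (- (+ 1)) (λ α → (b - α) ^ suc j * taylor α (quot b f) 0))))
      where
      alg : ∀ b α z t u → z * (t + (α - b) * u) ≡ t * z + - (+ 1) * ((b - α) * z * u)
      alg = solve-∀

    -- Writing `f(α) = f(b) + (α − b) · quot(α)` trades one degree of `f` for one factor `b − α`,
    -- until only moments of order below `k` remain. In `moment-poly-top` the same process ends at
    -- the moment of order `k` and isolates the leading coefficient.
    moment-poly-low : ∀ N f j → length f ℕ.≤ N → j ℕ.+ N ℕ.≤ k →
      Null (wsum ws (λ α → (b - α) ^ j * taylor α f 0))
    moment-poly-low N       []      j _        _  =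
      wsum-null ws _ (All.tabulate λ {α} _ → null-≡0 (ℤ.*-zeroʳ ((b - α) ^ j)))
    moment-poly-low (suc N) (c ∷ f) j (s≤s le) jN = null-resp (sym (moment-poly-step c f j))
      (null-+ (null-*ˡ (taylor b (c ∷ f) 0) (low b j (ℕ.≤-trans (ℕ.s≤s (ℕ.m≤m+n j N)) sjN)))
        (null-*ˡ (- (+ 1))
          (moment-poly-low N (quot b f) (suc j) (subst (ℕ._≤ N) (sym (length-quot b f)) le) sjN)))
      where
      sjN : suc j ℕ.+ N ℕ.≤ k
      sjN = subst (ℕ._≤ k) (ℕ.+-suc j N) jN

    moment-poly-top : ∀ N f j → length f ≡ suc N → j ℕ.+ N ≡ k → ¬ Null (taylor b f N) →
      ¬ Null (wsum ws (λ α → (b - α) ^ j * taylor α f 0))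
    moment-poly-top zero    (c ∷ []) j refl jN ¬lead h = ¬lead
      (null₂ (+ 1) (- (taylor b (c ∷ []) 0)) (null-resp eq h) (top b)
        (alg (taylor b (c ∷ []) 0) (moment ws b k)))
      where
      alg : ∀ t m → t ≡ + 1 * (t * m) + - t * (m - + 1)
      alg = solve-∀
      eq : wsum ws (λ α → (b - α) ^ j * taylor α (c ∷ []) 0) ≡ taylor b (c ∷ []) 0 * moment ws b k
      eq = trans (wsum-cong ws λ α → alg′ c b α ((b - α) ^ j))
        (trans (wsum-* ws (taylor b (c ∷ []) 0) (λ α → (b - α) ^ j))
          (cong (λ i → taylor b (c ∷ []) 0 * moment ws b i) (trans (sym (ℕ.+-identityʳ j)) jN)))
        where
        alg′ : ∀ c b α z → z * (c + α * + 0) ≡ (c + b * + 0) * z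
        alg′ = solve-∀
    moment-poly-top (suc N) (c ∷ f) j eq   jN ¬lead h =
      moment-poly-top N (quot b f) (suc j) (trans (length-quot b f) (ℕ.suc-injective eq)) sjN
        (λ h′ → ¬lead (null-resp (sym (taylor-quot-same b c f N)) h′))
        (null₂ (taylor b (c ∷ f) 0) (- (+ 1)) (low b j j<k) (null-resp (moment-poly-step c f j) h)
          (alg (taylor b (c ∷ f) 0) (moment ws b j) (wsum ws (λ α → (b - α) ^ suc j * taylor α (quot b f) 0))))
      where
      sjN : suc j ℕ.+ N ≡ k
      sjN = trans (sym (ℕ.+-suc j N)) jN
      j<k : j ℕ.< k
      j<k = subst (j ℕ.<_) sjN (ℕ.s≤s (ℕ.m≤m+n j N))
      alg : ∀ t m u → u ≡ t * m + - (+ 1) * (t * m + - (+ 1) * u)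
      alg = solve-∀

  -- The auxiliary polynomial of Hanson and Petridis

  -- This is `(l + 1) C(D, l + 1) = (D − l) C(D, l)` with the subtraction moved to the other side.
  C-absorb : ∀ D l → suc l ℕ.* (D C suc l) ℕ.+ l ℕ.* (D C l) ≡ D ℕ.* (D C l)
  C-absorb zero    zero    = refl
  C-absorb zero    (suc l) = cong₂ ℕ._+_ (ℕ.*-zeroʳ (suc (suc l))) (ℕ.*-zeroʳ (suc l))
  C-absorb (suc D) zero    = trans (cong (λ c → 1 ℕ.* c ℕ.+ 0) (nC1≡n (suc D))) (alg (suc D))
    where
    alg : ∀ x → 1 ℕ.* x ℕ.+ 0 ≡ x ℕ.* 1
    alg = ℕ-Solver.solve-∀
  C-absorb (suc D) (suc l) = begin
    suc (suc l) ℕ.* (suc D C suc (suc l)) ℕ.+ suc l ℕ.* (suc D C suc l)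
      ≡⟨ cong₂ (λ u v → suc (suc l) ℕ.* u ℕ.+ suc l ℕ.* v)
           (sym (nCk+nC[k+1]≡[n+1]C[k+1] D (suc l))) (sym (nCk+nC[k+1]≡[n+1]C[k+1] D l)) ⟩
    suc (suc l) ℕ.* (b ℕ.+ c) ℕ.+ suc l ℕ.* (a ℕ.+ b)
      ≡⟨ alg l a b c ⟩
    (suc (suc l) ℕ.* c ℕ.+ suc l ℕ.* b) ℕ.+ (suc l ℕ.* b ℕ.+ l ℕ.* a) ℕ.+ (a ℕ.+ b)
      ≡⟨ cong₂ (λ u v → u ℕ.+ v ℕ.+ (a ℕ.+ b)) (C-absorb D (suc l)) (C-absorb D l) ⟩
    D ℕ.* b ℕ.+ D ℕ.* a ℕ.+ (a ℕ.+ b)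
      ≡⟨ alg′ D a b ⟩
    suc D ℕ.* (a ℕ.+ b)
      ≡⟨ cong (suc D ℕ.*_) (nCk+nC[k+1]≡[n+1]C[k+1] D l) ⟩
    suc D ℕ.* (suc D C suc l) ∎
    where
    open ≡-Reasoning
    a = D C l
    b = D C suc l
    c = D C suc (suc l)
    alg : ∀ l a b c → suc (suc l) ℕ.* (b ℕ.+ c) ℕ.+ suc l ℕ.* (a ℕ.+ b) ≡
      (suc (suc l) ℕ.* c ℕ.+ suc l ℕ.* b) ℕ.+ (suc l ℕ.* b ℕ.+ l ℕ.* a) ℕ.+ (a ℕ.+ b)
    alg = ℕ-Solver.solve-∀
    alg′ : ∀ D a b → D ℕ.* b ℕ.+ D ℕ.* a ℕ.+ (a ℕ.+ b) ≡ suc D ℕ.* (a ℕ.+ b)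
    alg′ = ℕ-Solver.solve-∀

  C-absorb-ℤ : ∀ e l → + suc l * + ((e ℕ.+ l) C suc l) ≡ + e * + ((e ℕ.+ l) C l)
  C-absorb-ℤ e l = trans (sym (ℤ.pos-* (suc l) c₁)) (trans (cong +_ natEq) (ℤ.pos-* e c₀))
    where
    c₀ = (e ℕ.+ l) C l
    c₁ = (e ℕ.+ l) C suc l
    natEq : suc l ℕ.* c₁ ≡ e ℕ.* c₀
    natEq = ℕ.+-cancelʳ-≡ (l ℕ.* c₀) _ _
      (trans (C-absorb (e ℕ.+ l) l) (ℕ.*-distribʳ-+ c₀ e l))

  ¬null-C : ∀ e l → e ℕ.+ l ℕ.< p → ¬ Null (+ ((e ℕ.+ l) C l))
  ¬null-C e zero    lt = ¬null-1
  ¬null-C e (suc l) lt h = ¬null-* (¬null-small (suc e) (s≤s z≤n) (ℕ.≤-<-trans (s≤s (ℕ.m≤m+n e l)) lt′))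
    (¬null-C (suc e) l lt′)
    (null₁ (+ suc l) (subst (λ D → Null (+ (D C suc l))) (ℕ.+-suc e l) h) (sym (C-absorb-ℤ (suc e) l)))
    where
    lt′ : suc e ℕ.+ l ℕ.< p
    lt′ = subst (ℕ._< p) (ℕ.+-suc e l) lt

  antidiag-null : ∀ f k → (∀ i j → i ℕ.+ j ≡ k → Null (f i j)) → Null (antidiag f k)
  antidiag-null f zero    h = h 0 0 refl
  antidiag-null f (suc k) h =
    null-+ (h 0 (suc k) refl) (antidiag-null (λ i j → f (suc i) j) k λ i j eq → h (suc i) j (cong suc eq))

  -- Meant for products whose first factor vanishes to order `k` at a point: the sum may be
  -- restarted at index `k`.
  antidiag-drop : ∀ f k r → (∀ i j → i ℕ.< k → Null (f i j)) →
    Null (antidiag f (r ℕ.+ k) - antidiag (λ i j → f (i ℕ.+ k) j) r)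
  antidiag-drop f zero    r h = null-diff (trans (cong (antidiag f) (ℕ.+-identityʳ r))
    (antidiag-cong (λ i j → cong (λ i → f i j) (sym (ℕ.+-identityʳ i))) r))
  antidiag-drop f (suc k) r h = subst₂ (λ u v → Null (antidiag f u - v)) (sym (ℕ.+-suc r k))
    (antidiag-cong (λ i j → cong (λ i → f i j) (sym (ℕ.+-suc i k))) r)
    (null₂ (+ 1) (+ 1) (h 0 (suc (r ℕ.+ k)) (s≤s z≤n))
      (antidiag-drop (λ i j → f (suc i) j) k r λ i j i<k → h (suc i) j (s≤s i<k))
      (alg (f 0 (suc (r ℕ.+ k))) (antidiag (λ i j → f (suc i) j) (r ℕ.+ k)) _))
    where
    alg : ∀ x u v → x + u - v ≡ + 1 * x + + 1 * (u - v)
    alg = solve-∀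

  fromRoots-root : ∀ y αs → Any (λ α → Null (y - α)) αs → Null (taylor y (fromRoots αs) 0)
  fromRoots-root y (α ∷ αs) (here h)  =
    null-resp (sym (taylor-fromRoots-zero y α αs)) (null-*ʳ h (taylor y (fromRoots αs) 0))
  fromRoots-root y (α ∷ αs) (there h) =
    null-resp (sym (taylor-fromRoots-zero y α αs)) (null-*ˡ (y - α) (fromRoots-root y αs h))

  fromRoots-root⁻ : ∀ y αs → Null (taylor y (fromRoots αs) 0) → Any (λ α → Null (y - α)) αs
  fromRoots-root⁻ y []       h = ⊥-elim (¬null-1 (null-resp (alg y) h))
    where
    alg : ∀ y → + 1 + y * + 0 ≡ + 1
    alg = solve-∀
  fromRoots-root⁻ y (α ∷ αs) h
    with null-integral (y - α) (taylor y (fromRoots αs) 0) (null-resp (taylor-fromRoots-zero y α αs) h)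
  ... | inj₁ h′ = here h′
  ... | inj₂ h′ = there (fromRoots-root⁻ y αs h′)

  module HansonPetridis
    (n′ : ℕ) (ws : Weighted) (dd : DividedDifference (suc n′) ws)
    (ε : ℤ) (ε≉0 : ¬ Null ε) (d′ : ℕ) (D<p : suc d′ ℕ.+ suc n′ ℕ.< p)
    where

    open DividedDifference dd

    k = suc n′
    n = suc k
    d = suc d′
    D = d ℕ.+ k

    Good : ℤ → Set
    Good β = All (λ α → Null ((β - α) ^ d - ε)) (points ws)

    auxSum : Weighted → Poly
    auxSum []             = - ε ∷ []
    auxSum ((α , c) ∷ ws) = add (scale c (linPow α D)) (auxSum ws)

    aux : Poly
    aux = auxSum ws

    taylor-auxSum : ∀ ws y l →
      taylor y (auxSum ws) l ≡ + (D C l) * moment ws y (D ℕ.∸ l) + taylor y (- ε ∷ []) l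
    taylor-auxSum []             y l = sym (trans (cong (_+ taylor y (- ε ∷ []) l) (ℤ.*-zeroʳ (+ (D C l)))) (ℤ.+-identityˡ _))
    taylor-auxSum ((α , c) ∷ ws) y l = trans (taylor-add y (scale c (linPow α D)) (auxSum ws) l)
      (trans (cong₂ _+_ (trans (taylor-scale y c (linPow α D) l) (cong (c *_) (taylor-linPow y α D l)))
               (taylor-auxSum ws y l))
        (alg c (+ (D C l)) ((y - α) ^ (D ℕ.∸ l)) (moment ws y (D ℕ.∸ l)) (taylor y (- ε ∷ []) l)))
      where
      alg : ∀ c B z m t → c * (B * z) + (B * m + t) ≡ B * (c * z + m) + t
      alg = solve-∀

    taylor-aux-suc : ∀ y l → taylor y aux (suc l) ≡ + (D C suc l) * moment ws y (D ℕ.∸ suc l)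
    taylor-aux-suc y l = trans (taylor-auxSum ws y (suc l))
      (alg y (+ (D C suc l)) (moment ws y (D ℕ.∸ suc l)))
      where
      alg : ∀ y B m → B * m + (y * + 0 + + 0) ≡ B * m
      alg = solve-∀

    -- Formally the degree is `D = d + k`, but the coefficient at `l` carries the moment of order
    -- `D − l`, which vanishes for `l > d`. At `l = d` it is the top moment, and the binomial
    -- coefficient `C(D, d)` is left.
    aux-beyond : ∀ l → d ℕ.< l → Null (coeff aux l)
    aux-beyond (suc l) (s≤s d≤l) = null-resp (sym (taylor-aux-suc (+ 0) l))
      (null-*ˡ (+ (D C suc l)) (low (+ 0) (D ℕ.∸ suc l) (s≤s lt)))
      where
      lt : D ℕ.∸ suc l ℕ.≤ n′
      lt = ℕ.≤-trans (ℕ.∸-monoʳ-≤ D (s≤s d≤l))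
        (ℕ.≤-reflexive (trans (cong (ℕ._∸ suc d) (ℕ.+-suc d n′)) (ℕ.m+n∸m≡n d n′)))

    aux-lead : ¬ Null (coeff aux d)
    aux-lead h = ¬null-C k d (subst (ℕ._< p) (ℕ.+-comm d k) D<p)
      (subst (λ D → Null (+ (D C d))) (ℕ.+-comm d k)
        (null₂ (- + (D C d)) (+ 1) (top (+ 0))
          (null-resp (trans (taylor-aux-suc (+ 0) d′)
             (cong (λ e → + (D C d) * moment ws (+ 0) e) (ℕ.m+n∸m≡n d k))) h)
          (alg (+ (D C d)) (moment ws (+ 0) k))))
      where
      alg : ∀ B m → B ≡ - B * (m - + 1) + + 1 * (B * m)
      alg = solve-∀

    -- Modulo `p` the power `(β − α)^d` does not depend on `α`, so it leaves the weighted sum as the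
    -- scalar `ε`.
    good-moment : ∀ β → Good β → ∀ φ → Null (wsum ws (λ α → (β - α) ^ d * φ α) - ε * wsum ws φ)
    good-moment β good φ = null-resp eq
      (wsum-null ws (λ α → - ε * φ α + (β - α) ^ d * φ α) (All.map go good))
      where
      alg₁ : ∀ z e x → - e * x + z * x ≡ x * (z - e)
      alg₁ = solve-∀
      alg₂ : ∀ e u v → - e * u + v ≡ v - e * u
      alg₂ = solve-∀
      go : ∀ {α} → Null ((β - α) ^ d - ε) → Null (- ε * φ α + (β - α) ^ d * φ α)
      go {α} h = null₁ (φ α) h (alg₁ ((β - α) ^ d) ε (φ α))
      eq : wsum ws (λ α → - ε * φ α + (β - α) ^ d * φ α) ≡ wsum ws (λ α → (β - α) ^ d * φ α) - ε * wsum ws φ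
      eq = trans (wsum-linear ws (- ε) φ (λ α → (β - α) ^ d * φ α)) (alg₂ ε (wsum ws φ) _)

    good-moment-+ : ∀ β → Good β → ∀ e → Null (moment ws β (d ℕ.+ e) - ε * moment ws β e)
    good-moment-+ β good e = subst (λ m → Null (m - ε * moment ws β e))
      (wsum-cong ws λ α → sym (ℤ.^-distribˡ-+-* (β - α) d e))
      (good-moment β good (λ α → (β - α) ^ e))

    -- Once `ε` is taken out, the Taylor coefficient at `l` contains the moment of order `k − l`.
    -- For `l = 0` this is `1` and the constant `− ε` cancels it; for `0 < l ≤ k` it vanishes.
    aux-root : ∀ β → Good β → Root n aux β
    aux-root β good zero    _ = null-resp (sym (taylor-auxSum ws β 0))
      (null₂ (+ 1) ε (good-moment-+ β good k) (top β)
        (alg β ε (moment ws β D) (moment ws β k)))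
      where
      alg : ∀ b e m m′ → + 1 * m + (- e + b * + 0) ≡ + 1 * (m - e * m′) + e * (m′ - + 1)
      alg = solve-∀
    aux-root β good (suc l) (s≤s l<k) = null-resp (sym (taylor-aux-suc β l))
      (null-*ˡ (+ (D C suc l)) (subst (λ e → Null (moment ws β e)) (sym (ℕ.+-∸-assoc d l<k))
        (null₂ (+ 1) ε (good-moment-+ β good (k ℕ.∸ suc l)) (low β (k ℕ.∸ suc l) (s≤s (ℕ.m∸n≤m n′ l)))
          (alg (moment ws β (d ℕ.+ (k ℕ.∸ suc l))) ε (moment ws β (k ℕ.∸ suc l))))))
      where
      alg : ∀ m e m′ → m ≡ + 1 * (m - e * m′) + e * m′
      alg = solve-∀

    bound : ∀ βs → Distinct βs → All Good βs → length βs ℕ.* n ℕ.≤ d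
    bound βs dis good with length βs ℕ.* n ℕ.≤? d
    ... | yes le = le
    ... | no  nle = ⊥-elim (aux-lead
      (manyRoots⇒nullPoly n βs aux dis (All.map (λ {β} → aux-root β) good)
        (λ l le → aux-beyond l (ℕ.<-≤-trans (ℕ.≰⇒> nle) le)) (+ 0) d))

  -- Taylor coefficients at the points of the second summand

  -- The expansion of `f` around `b` is needed in two ways: evaluated at the points of the other
  -- set, and through its Taylor coefficients at `b`. The cofactor `w` serves both.
  splitOff : ∀ b f N → length f ≡ suc N → ∃ λ w → length w ≡ N ×
    (∀ y → taylor y f 0 ≡ taylor b f 0 + (y - b) * taylor y w 0) ×
    (∀ l → taylor b f (suc l) ≡ taylor b w l)
  splitOff b (c ∷ f) N eq = quot b f , trans (length-quot b f) (ℕ.suc-injective eq) ,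
    (λ y → taylor-quot-zero b y c f) , taylor-quot-same b c f

  fromRoots-allRoots : ∀ αs → All (λ α → Null (taylor α (fromRoots αs) 0)) αs
  fromRoots-allRoots αs = All.tabulate λ {α} α∈ →
    fromRoots-root α αs (Any.map null-diff α∈)

  -- The arguments are sequences of Taylor coefficients, so `g 2` is `g″ / 2` and `g 3` is `g‴ / 6`.
  -- In derivatives the first relation reads `2(d − 1) q′ g′ = n(n + 1) q g″`.
  Relation₁ Relation₂ : ℕ → ℕ → (ℕ → ℤ) → (ℕ → ℤ) → Set
  Relation₁ d n q g =
    Null ((+ d - + 1) * q 1 * g 1 - + n * (+ n + + 1) * q 0 * g 2)
  Relation₂ d n q g =
    Null (+ 2 * (+ d - + 2) * + n * (+ n + + 1) * q 1 * g 2
        - + 2 * (+ d - + 1) * (+ d - + 2) * q 2 * g 1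
        - (+ n - + 1) * (+ n + + 2) * (+ d - + 1) * q 1 * g 2
        - + 2 * + n * (+ n + + 1) * (+ n + + 2) * q 0 * g 3)

  module LocalRelations
    (n′ : ℕ) (ws : Weighted) (dd : DividedDifference (suc n′) ws)
    (ws-length : length (points ws) ≡ suc (suc n′))
    (ε : ℤ) (ε≉0 : ¬ Null ε) (d″ : ℕ) (D<p : suc (suc (suc d″)) ℕ.+ suc n′ ℕ.< p)
    (βs : List ℤ) (distinct : Distinct βs)
    (good : All (λ β → All (λ α → Null ((β - α) ^ suc (suc (suc d″)) - ε)) (points ws)) βs)
    (full : length βs ℕ.* suc (suc n′) ≡ suc (suc (suc d″)))
    where

    open DividedDifference dd
    open HansonPetridis n′ ws dd ε ε≉0 (suc (suc d″)) D<p

    q g : Poly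
    q = fromRoots (points ws)
    g = fromRoots βs

    m = length βs

    -- aux − const · g^n = 0, in the form of the differential equation aux′ g = n aux g′.
    ode : Poly
    ode = add (mul (der aux) g) (scale (- + n) (mul aux (der g)))

    lhsTerm rhsTerm : ℤ → ℕ → ℕ → ℤ
    lhsTerm b i j = + suc i * taylor b aux (suc i) * taylor b g j
    rhsTerm b i j = taylor b aux i * (+ suc j * taylor b g (suc j))

    taylor-ode : ∀ b l → taylor b ode l ≡ antidiag (lhsTerm b) l + - + n * antidiag (rhsTerm b) l
    taylor-ode b l = trans (taylor-add b (mul (der aux) g) (scale (- + n) (mul aux (der g))) l)
      (cong₂ _+_
        (trans (taylor-mul b (der aux) g l)
          (antidiag-cong (λ i j → cong (_* taylor b g j) (taylor-der b aux i)) l))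
        (trans (taylor-scale b (- + n) (mul aux (der g)) l)
          (cong (- + n *_) (trans (taylor-mul b aux (der g) l)
            (antidiag-cong (λ i j → cong (taylor b aux i *_) (taylor-der b g j)) l)))))

    ode-null : ∀ b l → (∀ i j → i ℕ.+ j ≡ l → Null (lhsTerm b i j)) →
      (∀ i j → i ℕ.+ j ≡ l → Null (rhsTerm b i j)) → Null (taylor b ode l)
    ode-null b l h₁ h₂ = null-resp (sym (taylor-ode b l))
      (null-+ (antidiag-null (lhsTerm b) l h₁) (null-*ˡ (- + n) (antidiag-null (rhsTerm b) l h₂)))

    -- Both `aux′ g` and `aux g′` have degree below `d + m`, and by `full` this number is
    -- `m (n + 1)`: the count of roots of order `n + 1` that `ode-root` supplies.
    ode-beyond : ∀ l → m ℕ.* suc n ℕ.≤ l → Null (coeff ode l)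
    ode-beyond l le = ode-null (+ 0) l h₁ h₂
      where
      le′ : d ℕ.+ m ℕ.≤ l
      le′ = subst (ℕ._≤ l) (trans (ℕ.*-suc m n) (trans (cong (m ℕ.+_) full) (ℕ.+-comm m d))) le
      g-beyond : ∀ j → m ℕ.< j → Null (coeff g j)
      g-beyond j lt = null-≡0 (taylor-fromRoots-beyond (+ 0) βs j lt)
      h₁ : ∀ i j → i ℕ.+ j ≡ l → Null (lhsTerm (+ 0) i j)
      h₁ i j eq with d ℕ.≤? i
      ... | yes d≤i = null-*ʳ (null-*ˡ (+ suc i) (aux-beyond (suc i) (s≤s d≤i))) (coeff g j)
      ... | no  d≰i = null-*ˡ (+ suc i * coeff aux (suc i)) (g-beyond j
        (ℕ.+-cancelˡ-< i m j (ℕ.<-≤-trans (ℕ.+-monoˡ-< m (ℕ.≰⇒> d≰i)) (subst (d ℕ.+ m ℕ.≤_) (sym eq) le′))))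
      h₂ : ∀ i j → i ℕ.+ j ≡ l → Null (rhsTerm (+ 0) i j)
      h₂ i j eq with suc d ℕ.≤? i
      ... | yes d<i = null-*ʳ (aux-beyond i d<i) (+ suc j * coeff g (suc j))
      ... | no  d≮i = null-*ˡ (coeff aux i) (null-*ˡ (+ suc j) (g-beyond (suc j) (s≤s
        (ℕ.+-cancelˡ-≤ d m j (ℕ.≤-trans (subst (d ℕ.+ m ℕ.≤_) (sym eq) le′) (ℕ.+-monoˡ-≤ j (ℕ.≤-pred (ℕ.≰⇒> d≮i))))))))

    module _ (β : ℤ) (β-good : Good β) (β-root : Null (taylor β g 0)) where

      A G : ℕ → ℤ
      A = taylor β aux
      G = taylor β g

      A-null : ∀ i → i ℕ.< n → Null (A i)
      A-null = aux-root β β-good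

      ode-low : ∀ l → l ℕ.≤ k → Null (taylor β ode l)
      ode-low l l≤k = ode-null β l h₁ h₂
        where
        h₁ : ∀ i j → i ℕ.+ j ≡ l → Null (lhsTerm β i j)
        h₁ i zero    eq = null-*ˡ (+ suc i * A (suc i)) β-root
        h₁ i (suc j) eq = null-*ʳ (null-*ˡ (+ suc i) (A-null (suc i) (s≤s
          (ℕ.≤-trans (ℕ.≤-trans (s≤s (ℕ.m≤m+n i j)) (ℕ.≤-reflexive (trans (sym (ℕ.+-suc i j)) eq))) l≤k)))) (G (suc j))
        h₂ : ∀ i j → i ℕ.+ j ≡ l → Null (rhsTerm β i j)
        h₂ i j eq = null-*ʳ (A-null i (s≤s (ℕ.≤-trans (ℕ.m≤m+n i j) (ℕ.≤-trans (ℕ.≤-reflexive eq) l≤k)))) (+ suc j * G (suc j))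

      ode-high : ∀ r → Null (taylor β ode (suc r ℕ.+ k) -
        (antidiag (λ i j → lhsTerm β (i ℕ.+ k) j) (suc r) + - + n * antidiag (λ i j → rhsTerm β (i ℕ.+ n) j) r))
      ode-high r = null₂ (+ 1) (- + n)
        (antidiag-drop (lhsTerm β) k (suc r) λ i j i<k →
          null-*ʳ (null-*ˡ (+ suc i) (A-null (suc i) (s≤s i<k))) (G j))
        (antidiag-drop (rhsTerm β) n r λ i j i<n → null-*ʳ (A-null i i<n) (+ suc j * G (suc j)))
        (trans (cong (_- (X + - + n * Y)) (trans (taylor-ode β (suc r ℕ.+ k))
                 (cong (λ l → antidiag (lhsTerm β) (suc r ℕ.+ k) + - + n * antidiag (rhsTerm β) l) (sym (ℕ.+-suc r k)))))
          (alg (+ n) (antidiag (lhsTerm β) (suc r ℕ.+ k)) (antidiag (rhsTerm β) (r ℕ.+ n)) X Y))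
        where
        X = antidiag (λ i j → lhsTerm β (i ℕ.+ k) j) (suc r)
        Y = antidiag (λ i j → rhsTerm β (i ℕ.+ n) j) r
        alg : ∀ n u v x y → u + - n * v - (x + - n * y) ≡ + 1 * (u - x) + - n * (v - y)
        alg = solve-∀

      -- Each of the two products has order at least `n` at `β`. In the coefficient of `s^n` both
      -- contribute `n` times `A n * G 1` and cancel, which gives the extra order.
      ode-root : Root (suc n) ode β
      ode-root l (s≤s l≤n) with l ℕ.≤? k
      ... | yes l≤k = ode-low l l≤k
      ... | no  l≰k = subst (Null ∘ taylor β ode) (ℕ.≤-antisym (ℕ.≰⇒> l≰k) l≤n)
        (null₂ (+ 1) (+ suc n * A (suc n)) (ode-high 0) β-root
          (alg (+ n) (+ suc n) (A n) (A (suc n)) (G 1) (G 0) (taylor β ode n)))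
        where
        alg : ∀ n n′ a a′ u v y → y ≡
          + 1 * (y - (n * a * u + n′ * a′ * v + - n * (a * (+ 1 * u)))) + (n′ * a′) * v
        alg = solve-∀

    ode-nullPoly : NullPoly ode
    ode-nullPoly = manyRoots⇒nullPoly (suc n) βs ode distinct
      (All.zipWith (λ { {β} (h , r) → ode-root β h r }) (good , fromRoots-allRoots βs)) ode-beyond

    module _ (β : ℤ) (β-good : Good β) (β-root : Null (taylor β g 0)) where

      private
        A₀ = taylor β aux n
        A₁ = taylor β aux (1 ℕ.+ n)
        A₂ = taylor β aux (2 ℕ.+ n)
        A₃ = taylor β aux (3 ℕ.+ n)
        g₀ = taylor β g 0
        g₁ = taylor β g 1
        g₂ = taylor β g 2
        g₃ = taylor β g 3
        q₀ = taylor β q 0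
        q₁ = taylor β q 1
        q₂ = taylor β q 2
        N  = + n
        -- Here `d` is `d″ + 3`, so `e` stands for `d − 2`, and `M₁`, `M₂`, `M₃` are the moments of
        -- orders `d − 1`, `d − 2`, `d − 3`.
        e  = + suc d″
        M₁ = moment ws β (suc (suc d″))
        M₂ = moment ws β (suc d″)
        M₃ = moment ws β d″
        B₀ = + (D C n)
        B₁ = + (D C (1 ℕ.+ n))
        B₂ = + (D C (2 ℕ.+ n))

      -- This is the coefficient of `s^(n + 1)` in the differential equation at `β`, the first one
      -- that does not vanish automatically. The next coefficient gives `order₂`.
      order₁ : Null (A₁ * g₁ - N * A₀ * g₂)
      order₁ = null₃ (- (+ 1)) (+ 1) (- ((+ 2 + N) * A₂)) (ode-high β β-good β-root 1)
        (ode-nullPoly β (2 ℕ.+ k)) β-root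
        (alg N A₀ A₁ A₂ g₀ g₁ g₂ (taylor β ode (2 ℕ.+ k)))
        where
        alg : ∀ n a₀ a₁ a₂ g₀ g₁ g₂ y → a₁ * g₁ - n * a₀ * g₂ ≡
          - (+ 1) * (y - (n * a₀ * g₂ + ((+ 1 + n) * a₁ * g₁ + (+ 2 + n) * a₂ * g₀)
            + - n * (a₀ * (+ 2 * g₂) + a₁ * (+ 1 * g₁)))) + + 1 * y + - ((+ 2 + n) * a₂) * g₀
        alg = solve-∀

      order₂ : Null (+ 2 * A₂ * g₁ + (+ 1 - N) * A₁ * g₂ - + 2 * N * A₀ * g₃)
      order₂ = null₃ (- (+ 1)) (+ 1) (- ((+ 3 + N) * A₃)) (ode-high β β-good β-root 2)
        (ode-nullPoly β (3 ℕ.+ k)) β-root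
        (alg N A₀ A₁ A₂ A₃ g₀ g₁ g₂ g₃ (taylor β ode (3 ℕ.+ k)))
        where
        alg : ∀ n a₀ a₁ a₂ a₃ g₀ g₁ g₂ g₃ y →
          + 2 * a₂ * g₁ + (+ 1 - n) * a₁ * g₂ - + 2 * n * a₀ * g₃ ≡
          - (+ 1) * (y - (n * a₀ * g₃ + ((+ 1 + n) * a₁ * g₂ + ((+ 2 + n) * a₂ * g₁ + (+ 3 + n) * a₃ * g₀))
            + - n * (a₀ * (+ 3 * g₃) + (a₁ * (+ 2 * g₂) + a₂ * (+ 1 * g₁))))) + + 1 * y + - ((+ 3 + n) * a₃) * g₀
        alg = solve-∀

      A₀≡ : A₀ ≡ B₀ * M₁
      A₀≡ = trans (taylor-aux-suc β k) (cong (λ e → B₀ * moment ws β e) (ℕ.m+n∸n≡m (2 ℕ.+ d″) k))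

      A₁≡ : A₁ ≡ B₁ * M₂
      A₁≡ = trans (taylor-aux-suc β (1 ℕ.+ k)) (cong (λ e → B₁ * moment ws β e) (ℕ.m+n∸n≡m (1 ℕ.+ d″) k))

      A₂≡ : A₂ ≡ B₂ * M₃
      A₂≡ = trans (taylor-aux-suc β (2 ℕ.+ k)) (cong (λ e → B₂ * moment ws β e) (ℕ.m+n∸n≡m d″ k))

      D≡₁ : (2 ℕ.+ d″) ℕ.+ n ≡ D
      D≡₁ = ℕ.+-suc (2 ℕ.+ d″) k

      D≡₂ : (1 ℕ.+ d″) ℕ.+ (1 ℕ.+ n) ≡ D
      D≡₂ = trans (ℕ.+-suc (1 ℕ.+ d″) n) D≡₁

      B₁≡ : (+ 1 + N) * B₁ ≡ (+ 1 + e) * B₀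
      B₁≡ = subst (λ D → (+ 1 + N) * + (D C suc n) ≡ (+ 1 + e) * + (D C n)) D≡₁ (C-absorb-ℤ (2 ℕ.+ d″) n)

      B₂≡ : (+ 2 + N) * B₂ ≡ e * B₁
      B₂≡ = subst (λ D → (+ 2 + N) * + (D C suc (suc n)) ≡ e * + (D C suc n)) D≡₂ (C-absorb-ℤ (1 ℕ.+ d″) (suc n))

      ¬null-B₀ : ¬ Null B₀
      ¬null-B₀ = subst (λ D → ¬ Null (+ (D C n))) D≡₁ (¬null-C (2 ℕ.+ d″) n (subst (ℕ._< p) (sym D≡₁) D<p))

      -- A congruence valid at each root of `q` is summed against the weights, with `(β − α)^d`
      -- replaced by `ε`. It is applied to `q(α) = 0` expanded around `β` and multiplied by a power
      -- of `β − α` that gives the remainder the full factor `(β − α)^d`.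
      transfer : ∀ ψ φ → (∀ α → Null (taylor α q 0) → Null (+ 1 * ψ α + (β - α) ^ d * φ α)) →
        Null (wsum ws ψ + ε * wsum ws φ)
      transfer ψ φ h = null₂ (+ 1) (- (+ 1))
        (null-resp (wsum-linear ws (+ 1) ψ (λ α → (β - α) ^ d * φ α))
          (wsum-null ws (λ α → + 1 * ψ α + (β - α) ^ d * φ α)
            (All.map (λ {α} → h α) (fromRoots-allRoots (points ws)))))
        (good-moment β β-good φ)
        (alg (wsum ws ψ) (wsum ws (λ α → (β - α) ^ d * φ α)) ε (wsum ws φ))
        where
        alg : ∀ s t e f → s + e * f ≡ + 1 * (+ 1 * s + t) + - (+ 1) * (t - e * f)
        alg = solve-∀

      private
        split₁ = splitOff β q n (trans (length-fromRoots (points ws)) (cong suc ws-length))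
        w₁ = proj₁ split₁
        split₂ = splitOff β w₁ k (proj₁ (proj₂ split₁))
        w₂ = proj₁ split₂
        split₃ = splitOff β w₂ n′ (proj₁ (proj₂ split₂))
        w₃ = proj₁ split₃

        pow₀ : Poly → ℤ → ℤ
        pow₀ w α = (β - α) ^ 0 * taylor α w 0

        q₁≡ : q₁ ≡ taylor β w₁ 0
        q₁≡ = proj₂ (proj₂ (proj₂ split₁)) 0

        q₂≡ : q₂ ≡ taylor β w₂ 0
        q₂≡ = trans (proj₂ (proj₂ (proj₂ split₁)) 1) (proj₂ (proj₂ (proj₂ split₂)) 0)

        expand₁ : ∀ α → taylor α q 0 ≡ q₀ + (α - β) * taylor α w₁ 0
        expand₁ = proj₁ (proj₂ (proj₂ split₁))

        expand₂ : ∀ α → taylor α q 0 ≡ q₀ + (α - β) * (q₁ + (α - β) * taylor α w₂ 0)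
        expand₂ α = trans (expand₁ α) (cong (λ z → q₀ + (α - β) * z)
          (trans (proj₁ (proj₂ (proj₂ split₂)) α) (cong (_+ (α - β) * taylor α w₂ 0) (sym q₁≡))))

        expand₃ : ∀ α → taylor α q 0 ≡ q₀ + (α - β) * (q₁ + (α - β) * (q₂ + (α - β) * taylor α w₃ 0))
        expand₃ α = trans (expand₂ α) (cong (λ z → q₀ + (α - β) * (q₁ + (α - β) * z))
          (trans (proj₁ (proj₂ (proj₂ split₃)) α) (cong (_+ (α - β) * taylor α w₃ 0) (sym q₂≡))))

      -- Multiplying `q₀ + (α − β) w₁(α) = 0` by `(β − α)^(d − 1)` and summing gives
      -- `q₀ M₁ = ε Σ c_α w₁(α)`. Since `w₁` is monic of degree `k`, the weights do not annihilate
      -- it.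
      ¬null-q₀M₁ : ¬ Null (q₀ * M₁)
      ¬null-q₀M₁ h = moment-poly-top dd β k w₁ 0 (proj₁ (proj₂ split₁)) refl ¬lead
        (null-cancel ε ε≉0 (null₂ (+ 1) (- (+ 1)) h
          (null-resp (cong₂ (λ u v → u + ε * v) (wsum-* ws q₀ (λ α → (β - α) ^ suc (suc d″)))
              (wsum-* ws (- (+ 1)) (pow₀ w₁)))
            (transfer (λ α → q₀ * (β - α) ^ suc (suc d″)) (λ α → - (+ 1) * pow₀ w₁ α) λ α r →
              null₁ ((β - α) ^ suc (suc d″)) (null-resp (expand₁ α) r)
                (alg₁ α β ((β - α) ^ suc (suc d″)) q₀ (taylor α w₁ 0))))
          (alg₂ q₀ M₁ ε (wsum ws (pow₀ w₁)))))
        where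
        alg₁ : ∀ α β z q w → + 1 * (q * z) + (β - α) * z * (- (+ 1) * (+ 1 * w)) ≡ z * (q + (α - β) * w)
        alg₁ = solve-∀
        alg₂ : ∀ q M e w → e * w ≡ + 1 * (q * M) + - (+ 1) * (q * M + e * (- (+ 1) * w))
        alg₂ = solve-∀
        ¬lead : ¬ Null (taylor β w₁ k)
        ¬lead h = ¬null-1 (null-resp (trans (sym (proj₂ (proj₂ (proj₂ split₁)) k))
          (trans (cong (taylor β q) (sym ws-length)) (taylor-fromRoots-lead β (points ws)))) h)

      ¬null-q₀ : ¬ Null q₀
      ¬null-q₀ h = ¬null-q₀M₁ (null-*ʳ h M₁)

      ¬null-M₁ : ¬ Null M₁
      ¬null-M₁ h = ¬null-q₀M₁ (null-*ˡ q₀ h)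

      -- The same computation with one more term of the expansion: the remainder now has degree
      -- `k − 1` and is annihilated. One term further gives `moment₃`.
      moment₂ : Null (q₀ * M₂ - q₁ * M₁)
      moment₂ = null₂ (+ 1) (- ε)
        (null-resp (cong (_+ ε * wsum ws (pow₀ w₂)) (trans
            (wsum-linear ws q₀ (λ α → (β - α) ^ suc d″) (λ α → - q₁ * (β - α) ^ suc (suc d″)))
            (+-congʳ (q₀ * M₂) (wsum-* ws (- q₁) (λ α → (β - α) ^ suc (suc d″))))))
          (transfer (λ α → q₀ * (β - α) ^ suc d″ + - q₁ * (β - α) ^ suc (suc d″)) (pow₀ w₂) λ α r →
            null₁ ((β - α) ^ suc d″) (null-resp (expand₂ α) r)
              (alg₁ α β ((β - α) ^ suc d″) q₀ q₁ (taylor α w₂ 0))))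
        (moment-poly-low dd β k w₂ 0 (ℕ.≤-reflexive (proj₁ (proj₂ split₂))) ℕ.≤-refl)
        (alg₂ q₀ M₂ q₁ M₁ ε (wsum ws (pow₀ w₂)))
        where
        alg₁ : ∀ α β z q₀ q₁ w → + 1 * (q₀ * z + - q₁ * ((β - α) * z)) + (β - α) * ((β - α) * z) * (+ 1 * w) ≡
          z * (q₀ + (α - β) * (q₁ + (α - β) * w))
        alg₁ = solve-∀
        alg₂ : ∀ q M q′ M′ e w → q * M - q′ * M′ ≡ + 1 * (q * M + - q′ * M′ + e * w) + - e * w
        alg₂ = solve-∀

      moment₃ : Null (q₀ * M₃ - q₁ * M₂ + q₂ * M₁)
      moment₃ = null₂ (+ 1) ε
        (null-resp (cong₂ (λ u v → u + ε * v)
            (trans (wsum-linear ws q₀ (λ α → (β - α) ^ d″)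
                (λ α → - q₁ * (β - α) ^ suc d″ + q₂ * (β - α) ^ suc (suc d″)))
              (+-congʳ (q₀ * M₃) (trans
                (wsum-linear ws (- q₁) (λ α → (β - α) ^ suc d″) (λ α → q₂ * (β - α) ^ suc (suc d″)))
                (+-congʳ (- q₁ * M₂) (wsum-* ws q₂ (λ α → (β - α) ^ suc (suc d″)))))))
            (wsum-* ws (- (+ 1)) (pow₀ w₃)))
          (transfer
            (λ α → q₀ * (β - α) ^ d″ + (- q₁ * (β - α) ^ suc d″ + q₂ * (β - α) ^ suc (suc d″)))
            (λ α → - (+ 1) * pow₀ w₃ α) λ α r →
            null₁ ((β - α) ^ d″) (null-resp (expand₃ α) r)
              (alg₁ α β ((β - α) ^ d″) q₀ q₁ q₂ (taylor α w₃ 0))))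
        (moment-poly-low dd β n′ w₃ 0 (ℕ.≤-reflexive (proj₁ (proj₂ split₃))) (ℕ.n≤1+n n′))
        (alg₂ q₀ M₃ q₁ M₂ q₂ M₁ ε (wsum ws (pow₀ w₃)))
        where
        alg₁ : ∀ α β z q₀ q₁ q₂ w →
          + 1 * (q₀ * z + (- q₁ * ((β - α) * z) + q₂ * ((β - α) * ((β - α) * z)))) +
            (β - α) * ((β - α) * ((β - α) * z)) * (- (+ 1) * (+ 1 * w)) ≡
          z * (q₀ + (α - β) * (q₁ + (α - β) * (q₂ + (α - β) * w)))
        alg₁ = solve-∀
        alg₂ : ∀ q M q′ M′ q″ M″ e w → q * M - q′ * M′ + q″ * M″ ≡
          + 1 * (q * M + (- q′ * M′ + q″ * M″) + e * (- (+ 1) * w)) + e * w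
        alg₂ = solve-∀

      -- In `order₁` the coefficients `A₀` and `A₁` are binomial coefficients times moments. Through
      -- `moment₂` and the absorption identity everything becomes a multiple of `B₀ * M₁`, which is
      -- invertible.
      relation₁ : Relation₁ d n (taylor β q) (taylor β g)
      relation₁ = null-resp (alg′ e N q₀ q₁ g₁ g₂) (null-cancel (B₀ * M₁) (¬null-* ¬null-B₀ ¬null-M₁)
        (null₃ ((N + + 1) * q₀) (- (N + + 1) * B₁ * g₁) (- M₁ * q₁ * g₁)
          (null-resp (cong₂ (λ a a′ → a′ * g₁ - N * a * g₂) A₀≡ A₁≡) order₁)
          moment₂ (null-diff B₁≡)
          (alg e N q₀ q₁ g₁ g₂ B₀ B₁ M₁ M₂)))
        where
        alg′ : ∀ e N q₀ q₁ g₁ g₂ → (+ 1 + e) * q₁ * g₁ - N * (N + + 1) * q₀ * g₂ ≡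
          (+ 2 + e - + 1) * q₁ * g₁ - N * (N + + 1) * q₀ * g₂
        alg′ = solve-∀
        alg : ∀ e N q₀ q₁ g₁ g₂ B₀ B₁ M₁ M₂ →
          B₀ * M₁ * ((+ 1 + e) * q₁ * g₁ - N * (N + + 1) * q₀ * g₂) ≡
          (N + + 1) * q₀ * (B₁ * M₂ * g₁ - N * (B₀ * M₁) * g₂) +
          - (N + + 1) * B₁ * g₁ * (q₀ * M₂ - q₁ * M₁) +
          - M₁ * q₁ * g₁ * ((+ 1 + N) * B₁ - (+ 1 + e) * B₀)
        alg = solve-∀

      -- The same substitutions in `order₂` give `X`, which is homogeneous of degree two in `q`.
      -- Subtracting `2 e q₁` times `relation₁` removes the term with `q₁²`, and the rest is
      -- divisible by `q₀`.
      relation₂ : Relation₂ d n (taylor β q) (taylor β g)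
      relation₂ = null-cancel q₀ ¬null-q₀ (null₂ (+ 1) (- (+ 2) * e * q₁) X relation₁
          (alg₄ e N q₀ q₁ q₂ g₁ g₂ g₃))
        where
        hₑ : Null (q₀ * q₀ * M₃ - (q₁ * q₁ - q₀ * q₂) * M₁)
        hₑ = null₂ q₀ q₁ moment₃ moment₂ (alg₁ q₀ q₁ q₂ M₁ M₂ M₃)
          where
          alg₁ : ∀ q₀ q₁ q₂ M₁ M₂ M₃ → q₀ * q₀ * M₃ - (q₁ * q₁ - q₀ * q₂) * M₁ ≡
            q₀ * (q₀ * M₃ - q₁ * M₂ + q₂ * M₁) + q₁ * (q₀ * M₂ - q₁ * M₁)
          alg₁ = solve-∀
        h_f : Null ((N + + 1) * (N + + 2) * B₂ - (+ 1 + e) * e * B₀)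
        h_f = null₂ (N + + 1) e (null-diff B₂≡) (null-diff B₁≡) (alg₂ e N B₀ B₁ B₂)
          where
          alg₂ : ∀ e N B₀ B₁ B₂ → (N + + 1) * (N + + 2) * B₂ - (+ 1 + e) * e * B₀ ≡
            (N + + 1) * ((+ 2 + N) * B₂ - e * B₁) + e * ((+ 1 + N) * B₁ - (+ 1 + e) * B₀)
          alg₂ = solve-∀
        T₁ : Null ((N + + 1) * (N + + 2) * (q₀ * q₀) * (+ 2 * (B₂ * M₃) * g₁)
          - + 2 * (+ 1 + e) * e * B₀ * (q₁ * q₁ - q₀ * q₂) * M₁ * g₁)
        T₁ = null₂ (+ 2 * (N + + 1) * (N + + 2) * B₂ * g₁) (+ 2 * (q₁ * q₁ - q₀ * q₂) * M₁ * g₁) hₑ h_f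
          (alg e N (q₀ * q₀) (q₁ * q₁ - q₀ * q₂) g₁ B₀ B₂ M₁ M₃)
          where
          alg : ∀ e N s t g₁ B₀ B₂ M₁ M₃ →
            (N + + 1) * (N + + 2) * s * (+ 2 * (B₂ * M₃) * g₁) - + 2 * (+ 1 + e) * e * B₀ * t * M₁ * g₁ ≡
            + 2 * (N + + 1) * (N + + 2) * B₂ * g₁ * (s * M₃ - t * M₁) +
            + 2 * t * M₁ * g₁ * ((N + + 1) * (N + + 2) * B₂ - (+ 1 + e) * e * B₀)
          alg = solve-∀
        T₂ : Null ((N + + 1) * (N + + 2) * (q₀ * q₀) * ((+ 1 - N) * (B₁ * M₂) * g₂)
          - (+ 1 - N) * (N + + 2) * (+ 1 + e) * B₀ * M₁ * q₀ * q₁ * g₂)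
        T₂ = null₂ ((+ 1 - N) * (N + + 2) * q₀ * g₂ * (N + + 1) * B₁) ((+ 1 - N) * (N + + 2) * q₀ * g₂ * q₁ * M₁)
          moment₂ (null-diff B₁≡) (alg e N q₀ q₁ g₂ B₀ B₁ M₁ M₂)
          where
          alg : ∀ e N q₀ q₁ g₂ B₀ B₁ M₁ M₂ →
            (N + + 1) * (N + + 2) * (q₀ * q₀) * ((+ 1 - N) * (B₁ * M₂) * g₂)
              - (+ 1 - N) * (N + + 2) * (+ 1 + e) * B₀ * M₁ * q₀ * q₁ * g₂ ≡
            (+ 1 - N) * (N + + 2) * q₀ * g₂ * (N + + 1) * B₁ * (q₀ * M₂ - q₁ * M₁) +
            (+ 1 - N) * (N + + 2) * q₀ * g₂ * q₁ * M₁ * ((+ 1 + N) * B₁ - (+ 1 + e) * B₀)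
          alg = solve-∀
        order₂′ : Null (+ 2 * (B₂ * M₃) * g₁ + (+ 1 - N) * (B₁ * M₂) * g₂ - + 2 * N * (B₀ * M₁) * g₃)
        order₂′ = subst (λ a₂ → Null (+ 2 * a₂ * g₁ + (+ 1 - N) * (B₁ * M₂) * g₂ - + 2 * N * (B₀ * M₁) * g₃)) A₂≡
          (null-resp (cong₂ (λ a a′ → + 2 * A₂ * g₁ + (+ 1 - N) * a′ * g₂ - + 2 * N * a * g₃) A₀≡ A₁≡) order₂)
        X : Null (+ 2 * (+ 1 + e) * e * (q₁ * q₁ - q₀ * q₂) * g₁ + (+ 1 - N) * (N + + 2) * (+ 1 + e) * q₀ * q₁ * g₂
          - + 2 * N * (N + + 1) * (N + + 2) * (q₀ * q₀) * g₃)
        X = null-cancel (B₀ * M₁) (¬null-* ¬null-B₀ ¬null-M₁)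
          (null₃ ((N + + 1) * (N + + 2) * (q₀ * q₀)) (- (+ 1)) (- (+ 1)) order₂′ T₁ T₂
            (alg₃ (+ 2 * (B₂ * M₃) * g₁) ((+ 1 - N) * (B₁ * M₂) * g₂) B₀ M₁ e N q₀ q₁ (q₀ * q₀) (q₁ * q₁ - q₀ * q₂) g₁ g₂ g₃))
          where
          alg₃ : ∀ x y B₀ M₁ e N q₀ q₁ s t g₁ g₂ g₃ →
            B₀ * M₁ * (+ 2 * (+ 1 + e) * e * t * g₁ + (+ 1 - N) * (N + + 2) * (+ 1 + e) * q₀ * q₁ * g₂
              - + 2 * N * (N + + 1) * (N + + 2) * s * g₃) ≡
            (N + + 1) * (N + + 2) * s * (x + y - + 2 * N * (B₀ * M₁) * g₃) +
            - (+ 1) * ((N + + 1) * (N + + 2) * s * x - + 2 * (+ 1 + e) * e * B₀ * t * M₁ * g₁) +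
            - (+ 1) * ((N + + 1) * (N + + 2) * s * y - (+ 1 - N) * (N + + 2) * (+ 1 + e) * B₀ * M₁ * q₀ * q₁ * g₂)
          alg₃ = solve-∀
        alg₄ : ∀ e N q₀ q₁ q₂ g₁ g₂ g₃ →
          q₀ * (+ 2 * (+ 2 + e - + 2) * N * (N + + 1) * q₁ * g₂
            - + 2 * (+ 2 + e - + 1) * (+ 2 + e - + 2) * q₂ * g₁
            - (N - + 1) * (N + + 2) * (+ 2 + e - + 1) * q₁ * g₂
            - + 2 * N * (N + + 1) * (N + + 2) * q₀ * g₃) ≡
          + 1 * (+ 2 * (+ 1 + e) * e * (q₁ * q₁ - q₀ * q₂) * g₁ + (+ 1 - N) * (N + + 2) * (+ 1 + e) * q₀ * q₁ * g₂
            - + 2 * N * (N + + 1) * (N + + 2) * (q₀ * q₀) * g₃) +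
          - (+ 2) * e * q₁ * ((+ 2 + e - + 1) * q₁ * g₁ - N * (N + + 1) * q₀ * g₂)
        alg₄ = solve-∀

  -- Bilinear differential relations

  falling : ℕ → ℕ → ℤ
  falling zero    a       = + 1
  falling (suc i) zero    = + 0
  falling (suc i) (suc a) = + suc a * falling i a

  derN : ℕ → Poly → Poly
  derN zero    f = f
  derN (suc i) f = derN i (der f)

  taylor-derN : ∀ b i f l → taylor b (derN i f) l ≡ falling i (i ℕ.+ l) * taylor b f (i ℕ.+ l)
  taylor-derN b zero    f l = sym (ℤ.*-identityˡ _)
  taylor-derN b (suc i) f l = trans (taylor-derN b i (der f) l)
    (trans (cong (falling i (i ℕ.+ l) *_) (taylor-der b f (i ℕ.+ l)))
      (alg (falling i (i ℕ.+ l)) (+ suc (i ℕ.+ l)) (taylor b f (suc (i ℕ.+ l)))))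
    where
    alg : ∀ x y z → x * (y * z) ≡ y * x * z
    alg = solve-∀

  -- (c , i , j) stands for the term c · q⁽ⁱ⁾ g⁽ʲ⁾.
  BilinearOp : Set
  BilinearOp = List (ℤ × ℕ × ℕ)

  bilinear : BilinearOp → Poly → Poly → Poly
  bilinear []                 q g = []
  bilinear ((c , i , j) ∷ ts) q g = add (scale c (mul (derN i q) (derN j g))) (bilinear ts q g)

  kernel : BilinearOp → ℕ → ℕ → ℤ
  kernel []                 a b = + 0
  kernel ((c , i , j) ∷ ts) a b = c * (falling i a * falling j b) + kernel ts a b

  Order : ℕ → BilinearOp → Set
  Order r = All (λ (c , i , j) → i ℕ.+ j ≡ r)

  falling-antidiagˡ : ∀ i f (φ : ℕ → ℤ) k →
    antidiag (λ u v → coeff (derN i f) u * φ v) k ≡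
    antidiag (λ a v → falling i a * coeff f a * φ v) (i ℕ.+ k)
  falling-antidiagˡ zero    f φ k =
    antidiag-cong (λ u v → cong (_* φ v) (sym (ℤ.*-identityˡ (coeff f u)))) k
  falling-antidiagˡ (suc i) f φ k = trans (falling-antidiagˡ i (der f) φ k)
    (trans (antidiag-cong (λ a v → cong (_* φ v) (trans (cong (falling i a *_) (taylor-der (+ 0) f a))
        (alg (falling i a) (+ suc a) (coeff f (suc a))))) (i ℕ.+ k))
      (sym (antidiag-shiftˡ (λ a v → falling (suc i) a * coeff f a * φ v) (λ v → refl) (i ℕ.+ k))))
    where
    alg : ∀ x y z → x * (y * z) ≡ y * x * z
    alg = solve-∀

  falling-antidiagʳ : ∀ j g (φ : ℕ → ℤ) k →
    antidiag (λ u v → φ u * coeff (derN j g) v) k ≡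
    antidiag (λ u b → φ u * (falling j b * coeff g b)) (j ℕ.+ k)
  falling-antidiagʳ zero    g φ k =
    antidiag-cong (λ u v → cong (φ u *_) (sym (ℤ.*-identityˡ (coeff g v)))) k
  falling-antidiagʳ (suc j) g φ k = trans (falling-antidiagʳ j (der g) φ k)
    (trans (antidiag-cong (λ u b → cong (φ u *_) (trans (cong (falling j b *_) (taylor-der (+ 0) g b))
        (alg (falling j b) (+ suc b) (coeff g (suc b))))) (j ℕ.+ k))
      (sym (antidiag-shiftʳ (λ u b → φ u * (falling (suc j) b * coeff g b)) (λ u → ℤ.*-zeroʳ (φ u)) (j ℕ.+ k))))
    where
    alg : ∀ x y z → x * (y * z) ≡ y * x * z
    alg = solve-∀

  -- On a pair of monomials `x^a`, `x^b` a homogeneous operator of order `r` acts by one number, its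
  -- kernel, and lowers the total degree by `r`. Summing over the whole antidiagonal is legitimate
  -- because falling factorials vanish wherever a derivative kills the monomial.
  coeff-bilinear : ∀ {r} ts → Order r ts → ∀ q g k →
    coeff (bilinear ts q g) k ≡ antidiag (λ a b → kernel ts a b * (coeff q a * coeff g b)) (r ℕ.+ k)
  coeff-bilinear {r} []                 []       q g k = sym (antidiag-zero (r ℕ.+ k) λ _ _ _ → refl)
  coeff-bilinear     ((c , i , j) ∷ ts) (refl ∷ h) q g k =
    trans (taylor-add (+ 0) (scale c (mul (derN i q) (derN j g))) (bilinear ts q g) k)
    (trans (cong₂ _+_
        (trans (taylor-scale (+ 0) c (mul (derN i q) (derN j g)) k)
          (cong (c *_) (trans (taylor-mul (+ 0) (derN i q) (derN j g) k)
            (trans (falling-antidiagˡ i q (coeff (derN j g)) k)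
              (trans (falling-antidiagʳ j g (λ a → falling i a * coeff q a) (i ℕ.+ k))
                (cong (antidiag F) index))))))
        (coeff-bilinear ts h q g k))
      (trans (sym (antidiag-linear c F (λ a b → kernel ts a b * (coeff q a * coeff g b)) (i ℕ.+ j ℕ.+ k)))
        (antidiag-cong (λ a b → alg c (falling i a) (falling j b) (kernel ts a b) (coeff q a) (coeff g b)) (i ℕ.+ j ℕ.+ k))))
    where
    F : ℕ → ℕ → ℤ
    F a b = falling i a * coeff q a * (falling j b * coeff g b)
    index : j ℕ.+ (i ℕ.+ k) ≡ i ℕ.+ j ℕ.+ k
    index = trans (sym (ℕ.+-assoc j i k)) (cong (ℕ._+ k) (ℕ.+-comm j i))
    alg : ∀ c x y K u v → c * (x * u * (y * v)) + K * (u * v) ≡ (c * (x * y) + K) * (u * v)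
    alg = solve-∀

  coeff-bilinear-beyond : ∀ r ts → Order (suc r) ts → ∀ αs βs l → length αs ℕ.+ length βs ℕ.≤ l →
    Null (coeff (bilinear ts (fromRoots αs) (fromRoots βs)) l)
  coeff-bilinear-beyond r ts order αs βs l le = null-≡0 (trans
    (coeff-bilinear ts order (fromRoots αs) (fromRoots βs) l)
    (antidiag-zero (suc r ℕ.+ l) λ a b eq → trans (cong (kernel ts a b *_) (zeroProduct a b eq)) (ℤ.*-zeroʳ (kernel ts a b))))
    where
    zeroProduct : ∀ a b → a ℕ.+ b ≡ suc r ℕ.+ l → coeff (fromRoots αs) a * coeff (fromRoots βs) b ≡ + 0
    zeroProduct a b eq with suc (length αs) ℕ.≤? a
    ... | yes n<a = cong (_* coeff (fromRoots βs) b) (taylor-fromRoots-beyond (+ 0) αs a n<a)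
    ... | no  n≮a = trans (cong (coeff (fromRoots αs) a *_) (taylor-fromRoots-beyond (+ 0) βs b m<b))
                      (ℤ.*-zeroʳ (coeff (fromRoots αs) a))
      where
      a≤n : a ℕ.≤ length αs
      a≤n = ℕ.≤-pred (ℕ.≰⇒> n≮a)
      m<b : length βs ℕ.< b
      m<b = ℕ.+-cancelˡ-< (length αs) (length βs) b (ℕ.≤-<-trans le
        (ℕ.<-≤-trans (s≤s (ℕ.m≤n+m l r)) (ℕ.≤-trans (ℕ.≤-reflexive (sym eq)) (ℕ.+-monoˡ-≤ b a≤n))))

  -- Positive order brings the degree below `n + m`, so the `n + m` incongruent points suffice.
  bilinear-nullPoly : ∀ r ts → Order (suc r) ts → ∀ αs βs → Distinct (αs ++ βs) →
    All (λ α → Null (taylor α (bilinear ts (fromRoots αs) (fromRoots βs)) 0)) αs →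
    All (λ β → Null (taylor β (bilinear ts (fromRoots αs) (fromRoots βs)) 0)) βs →
    NullPoly (bilinear ts (fromRoots αs) (fromRoots βs))
  bilinear-nullPoly r ts order αs βs dis hα hβ =
    manyRoots⇒nullPoly 1 (αs ++ βs) (bilinear ts (fromRoots αs) (fromRoots βs)) dis
      (All.map (λ h → λ { zero _ → h ; (suc l) (s≤s ()) }) (All.++⁺ hα hβ))
      (λ l le → coeff-bilinear-beyond r ts order αs βs l
        (ℕ.≤-trans (ℕ.≤-reflexive (trans (sym (length-++ αs)) (sym (ℕ.*-identityʳ _)))) le))

  -- Configurations and the identities of second and third order

  record Config (d : ℕ) (αs βs : List ℤ) : Set where
    field
      distinctˡ : Distinct αs
      distinctʳ : Distinct βs
      ε         : ℤ
      ε≉0       : ¬ Null ε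
      powers    : All (λ β → All (λ α → Null ((β - α) ^ d - ε)) αs) βs
      sizeˡ     : 2 ℕ.≤ length αs
      sizeʳ     : 2 ℕ.≤ length βs
      full      : length βs ℕ.* length αs ≡ d
      small     : d ℕ.+ d ℕ.< p

  neg-^ : ∀ x d → (- x) ^ d ≡ (- (+ 1)) ^ d * x ^ d
  neg-^ x zero    = refl
  neg-^ x (suc d) = trans (cong (- x *_) (neg-^ x d)) (alg x ((- (+ 1)) ^ d) (x ^ d))
    where
    alg : ∀ x s z → - x * (s * z) ≡ - (+ 1) * s * (x * z)
    alg = solve-∀

  ¬null-neg1 : ¬ Null (- (+ 1))
  ¬null-neg1 h = ¬null-1 (null-*ˡ (- (+ 1)) h)

  -- Exchanging the sets reverses all differences and so multiplies the common power by `(−1)^d`.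
  -- This is why a configuration carries a general `ε` instead of `1`.
  swap : ∀ {d αs βs} → Config d αs βs → Config d βs αs
  swap {d} {αs} {βs} cfg = record
    { distinctˡ = distinctʳ
    ; distinctʳ = distinctˡ
    ; ε         = (- (+ 1)) ^ d * ε
    ; ε≉0       = ¬null-* (¬null-^ ¬null-neg1 d) ε≉0
    ; powers    = All.map (All.map λ {β} → flip β) (All.All-swap powers)
    ; sizeˡ     = sizeʳ
    ; sizeʳ     = sizeˡ
    ; full      = trans (ℕ.*-comm (length αs) (length βs)) full
    ; small     = small
    }
    where
    open Config cfg
    flip : ∀ β {α} → Null ((β - α) ^ d - ε) → Null ((α - β) ^ d - (- (+ 1)) ^ d * ε)
    flip β {α} h = null₁ ((- (+ 1)) ^ d) h
      (trans (cong (_- (- (+ 1)) ^ d * ε) (trans (cong (_^ d) (alg₁ α β)) (neg-^ (β - α) d)))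
        (alg₂ ((- (+ 1)) ^ d) ((β - α) ^ d) ε))
      where
      alg₁ : ∀ α β → α - β ≡ - (β - α)
      alg₁ = solve-∀
      alg₂ : ∀ s z e → s * z - s * e ≡ s * (z - e)
      alg₂ = solve-∀

  LocalRelation : ℕ → List ℤ → List ℤ → ℤ → Set
  LocalRelation d αs βs β = Relation₁ d (length αs) q g × Relation₂ d (length αs) q g
    where
    q = taylor β (fromRoots αs)
    g = taylor β (fromRoots βs)

  localRelations : ∀ {d αs βs} → Config d αs βs → All (LocalRelation d αs βs) βs
  localRelations {d} {α ∷ α′ ∷ αs} {βs} cfg = go d refl
    where
    open Config cfg
    4≤d : 4 ℕ.≤ d
    4≤d = subst (4 ℕ.≤_) full (ℕ.*-mono-≤ sizeʳ sizeˡ)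
    n′ = length αs
    n<d : suc (suc n′) ℕ.≤ d
    n<d = subst (suc (suc n′) ℕ.≤_) full (ℕ.m≤n*m (suc (suc n′)) (length βs) {{ℕ.>-nonZero (ℕ.<-trans (s≤s z≤n) sizeʳ)}})
    D<p : d ℕ.+ suc n′ ℕ.< p
    D<p = ℕ.≤-<-trans (ℕ.+-monoʳ-≤ d (ℕ.≤-trans (ℕ.n≤1+n _) n<d)) small
    dd = dividedDifference α (α′ ∷ αs) distinctˡ
    ws = proj₁ dd
    points≡ : points ws ≡ α ∷ α′ ∷ αs
    points≡ = proj₁ (proj₂ dd)
    -- The moment of order `d − 3` occurs in the local relations, so `d` has to be exhibited as
    -- `d″ + 3`; the smaller cases contradict `4≤d`.
    go : ∀ d₀ → d₀ ≡ d → All (LocalRelation d (α ∷ α′ ∷ αs) βs) βs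
    go zero                   refl = ⊥-elim (ℕ.n≮0 4≤d)
    go (suc zero)             refl = ⊥-elim (ℕ.n≮0 (ℕ.≤-pred 4≤d))
    go (suc (suc zero))       refl = ⊥-elim (ℕ.n≮0 (ℕ.≤-pred (ℕ.≤-pred 4≤d)))
    go (suc (suc (suc d″)))   refl = All.zipWith (λ { {β} (h , r) →
        subst (λ l → Relation₁ d n (taylor β (fromRoots l)) (taylor β (fromRoots βs))) points≡
          (relation₁ β h r) ,
        subst (λ l → Relation₂ d n (taylor β (fromRoots l)) (taylor β (fromRoots βs))) points≡
          (relation₂ β h r) })
      (good , fromRoots-allRoots βs)
      where
      good : All (λ β → All (λ α → Null ((β - α) ^ d - ε)) (points ws)) βs
      good = subst (λ l → All (λ β → All (λ α → Null ((β - α) ^ d - ε)) l) βs) (sym points≡) powers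
      open LocalRelations n′ ws (proj₂ (proj₂ dd)) (cong length points≡) ε ε≉0 d″ D<p
        βs distinctʳ good full using (relation₁; relation₂)
      n = suc (suc n′)
  localRelations {αs = []}     cfg = ⊥-elim (ℕ.n≮0 (Config.sizeˡ cfg))
  localRelations {αs = α ∷ []} cfg = ⊥-elim (ℕ.n≮0 (ℕ.≤-pred (Config.sizeˡ cfg)))

  bilinearTaylor : BilinearOp → (ℕ → ℤ) → (ℕ → ℤ) → ℕ → ℤ
  bilinearTaylor []                 q g l = + 0
  bilinearTaylor ((c , i , j) ∷ ts) q g l =
    c * antidiag (λ u v → falling i (i ℕ.+ u) * q (i ℕ.+ u) * (falling j (j ℕ.+ v) * g (j ℕ.+ v))) l
      + bilinearTaylor ts q g l

  taylor-bilinear : ∀ b ts q g l →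
    taylor b (bilinear ts q g) l ≡ bilinearTaylor ts (taylor b q) (taylor b g) l
  taylor-bilinear b []                 q g l = refl
  taylor-bilinear b ((c , i , j) ∷ ts) q g l =
    trans (taylor-add b (scale c (mul (derN i q) (derN j g))) (bilinear ts q g) l)
      (cong₂ _+_
        (trans (taylor-scale b c (mul (derN i q) (derN j g)) l)
          (cong (c *_) (trans (taylor-mul b (derN i q) (derN j g) l)
            (antidiag-cong (λ u v → cong₂ _*_ (taylor-derN b i q u) (taylor-derN b j g v)) l))))
        (taylor-bilinear b ts q g l))

  -- n(n+1) q g″ − 2(d−1) q′ g′ + m(m+1) q″ g
  quadratic : ℕ → ℕ → ℕ → BilinearOp
  quadratic n m d =
    (+ n * (+ n + + 1) , 0 , 2) ∷ (- (+ 2 * (+ d - + 1)) , 1 , 1) ∷ (+ m * (+ m + + 1) , 2 , 0) ∷ []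

  cubicA cubicB : ℤ → ℤ
  cubicA N = N * (+ 3 * N * N + + 4 * N - + 1)
  cubicB N = - (+ 3 * (+ 3 * N * N * N - + 2 * N * N - + 5 * N + + 2))

  -- a (q‴ g − q g‴) + b (q″ g′ − q′ g″)
  cubic : ℕ → BilinearOp
  cubic n = (cubicA (+ n) , 3 , 0) ∷ (- cubicA (+ n) , 0 , 3) ∷
    (cubicB (+ n) , 2 , 1) ∷ (- cubicB (+ n) , 1 , 2) ∷ []

  quadraticKernel : ℤ → ℤ → ℤ → ℤ → ℤ → ℤ
  quadraticKernel N M δ a b =
    N * (N + + 1) * (b * (b - + 1)) - + 2 * (δ - + 1) * (a * b) + M * (M + + 1) * (a * (a - + 1))

  cubicKernel : ℤ → ℤ → ℤ → ℤ
  cubicKernel N a b =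
    cubicA N * (a * (a - + 1) * (a - + 2) - b * (b - + 1) * (b - + 2))
      + cubicB N * (a * (a - + 1) * b - a * (b * (b - + 1)))

  falling₁ : ∀ a → falling 1 a ≡ + a
  falling₁ zero    = refl
  falling₁ (suc a) = ℤ.*-identityʳ (+ suc a)

  falling₂ : ∀ a → falling 2 a ≡ + a * (+ a - + 1)
  falling₂ zero    = refl
  falling₂ (suc a) = trans (cong (+ suc a *_) (falling₁ a)) (alg (+ a))
    where
    alg : ∀ a → (+ 1 + a) * a ≡ (+ 1 + a) * (+ 1 + a - + 1)
    alg = solve-∀

  falling₃ : ∀ a → falling 3 a ≡ + a * (+ a - + 1) * (+ a - + 2)
  falling₃ zero    = refl
  falling₃ (suc a) = trans (cong (+ suc a *_) (falling₂ a)) (alg (+ a))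
    where
    alg : ∀ a → (+ 1 + a) * (a * (a - + 1)) ≡ (+ 1 + a) * (+ 1 + a - + 1) * (+ 1 + a - + 2)
    alg = solve-∀

  kernel-quadratic : ∀ n m d a b →
    kernel (quadratic n m d) a b ≡ quadraticKernel (+ n) (+ m) (+ d) (+ a) (+ b)
  kernel-quadratic n m d a b
    rewrite falling₁ a | falling₁ b | falling₂ a | falling₂ b = alg (+ n) (+ m) (+ d) (+ a) (+ b)
    where
    alg : ∀ N M δ a b →
      N * (N + + 1) * (+ 1 * (b * (b - + 1))) + (- (+ 2 * (δ - + 1)) * (a * b)
        + (M * (M + + 1) * (a * (a - + 1) * + 1) + + 0)) ≡
      N * (N + + 1) * (b * (b - + 1)) - + 2 * (δ - + 1) * (a * b) + M * (M + + 1) * (a * (a - + 1))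
    alg = solve-∀

  kernel-cubic : ∀ n a b → kernel (cubic n) a b ≡ cubicKernel (+ n) (+ a) (+ b)
  kernel-cubic n a b
    rewrite falling₁ a | falling₁ b | falling₂ a | falling₂ b | falling₃ a | falling₃ b =
    alg (cubicA (+ n)) (cubicB (+ n)) (+ a) (+ b)
    where
    alg : ∀ A B a b →
      A * (a * (a - + 1) * (a - + 2) * + 1) + (- A * (+ 1 * (b * (b - + 1) * (b - + 2)))
        + (B * (a * (a - + 1) * b) + (- B * (a * (b * (b - + 1))) + + 0))) ≡
      A * (a * (a - + 1) * (a - + 2) - b * (b - + 1) * (b - + 2)) + B * (a * (a - + 1) * b - a * (b * (b - + 1)))
    alg = solve-∀

  null-pow-cong : ∀ {x y} d → Null (x - y) → Null (x ^ d - y ^ d)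
  null-pow-cong         zero    h = null-0
  null-pow-cong {x} {y} (suc d) h = null₂ (x ^ d) y h (null-pow-cong d h) (alg x y (x ^ d) (y ^ d))
    where
    alg : ∀ x y u v → x * u - y * v ≡ u * (x - y) + y * (u - v)
    alg = solve-∀

  module _ {d αs βs} (cfg : Config d αs βs) where
    open Config cfg

    private
      n = length αs
      m = length βs

    full>0 : 0 ℕ.< d
    full>0 = subst (0 ℕ.<_) full (ℕ.*-mono-≤ (ℕ.<-trans (s≤s z≤n) sizeʳ) (ℕ.<-trans (s≤s z≤n) sizeˡ))

    disjoint : All (λ α → All (λ β → ¬ Null (α - β)) βs) αs
    disjoint = All.map (λ {α} → All.map λ {β} → go α β) (All.All-swap powers)
      where
      null-^ : ∀ {x} e → 0 ℕ.< e → Null x → Null (x ^ e)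
      null-^ {x} (suc e) _ h = null-*ʳ h (x ^ e)
      go : ∀ α β → Null ((β - α) ^ d - ε) → ¬ Null (α - β)
      go α β h h′ = ε≉0 (null₂ (- (+ 1)) (+ 1) h
        (null-^ d full>0 (null₁ (- (+ 1)) h′ (alg₁ α β))) (alg₂ ((β - α) ^ d) ε))
        where
        alg₁ : ∀ α β → β - α ≡ - (+ 1) * (α - β)
        alg₁ = solve-∀
        alg₂ : ∀ z e → e ≡ - (+ 1) * (z - e) + + 1 * z
        alg₂ = solve-∀

    all-distinct : Distinct (αs ++ βs)
    all-distinct = AllPairs.++⁺ distinctˡ distinctʳ disjoint

  -- At a root of `g` the term with `q″ g` drops out and the rest is `−2` times the first local
  -- relation. At a root of `q` the term with `q g″` drops out and the rest is that relation for the
  -- swapped configuration. The middle coefficient is common to both, so one polynomial serves both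
  -- sets.
  quadratic-nullPoly : ∀ {d αs βs} (cfg : Config d αs βs) →
    NullPoly (bilinear (quadratic (length αs) (length βs) d) (fromRoots αs) (fromRoots βs))
  quadratic-nullPoly {d} {αs} {βs} cfg =
    bilinear-nullPoly 1 ts (refl ∷ refl ∷ refl ∷ []) αs βs (all-distinct cfg)
      (All.zipWith (λ { {α} (h , r) → null-resp (sym (taylor-bilinear α ts q g 0))
          (null₂ (- (+ 2)) (N * (N + + 1) * (+ 2 * taylor α g 2)) (proj₁ h) r
            (algˡ N M (+ d) (taylor α q 0) (taylor α q 1) (taylor α q 2) (taylor α g 0) (taylor α g 1) (taylor α g 2))) })
        (localRelations (swap cfg) , fromRoots-allRoots αs))
      (All.zipWith (λ { {β} (h , r) → null-resp (sym (taylor-bilinear β ts q g 0))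
          (null₂ (- (+ 2)) (M * (M + + 1) * (+ 2 * taylor β q 2)) (proj₁ h) r
            (algʳ N M (+ d) (taylor β q 0) (taylor β q 1) (taylor β q 2) (taylor β g 0) (taylor β g 1) (taylor β g 2))) })
        (localRelations cfg , fromRoots-allRoots βs))
    where
    ts = quadratic (length αs) (length βs) d
    q = fromRoots αs
    g = fromRoots βs
    N = + length αs
    M = + length βs
    algʳ : ∀ N M δ q₀ q₁ q₂ g₀ g₁ g₂ →
      N * (N + + 1) * (+ 1 * q₀ * (+ 2 * g₂)) + (- (+ 2 * (δ - + 1)) * (+ 1 * q₁ * (+ 1 * g₁))
        + (M * (M + + 1) * (+ 2 * q₂ * (+ 1 * g₀)) + + 0)) ≡
      - (+ 2) * ((δ - + 1) * q₁ * g₁ - N * (N + + 1) * q₀ * g₂) + M * (M + + 1) * (+ 2 * q₂) * g₀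
    algʳ = solve-∀
    algˡ : ∀ N M δ q₀ q₁ q₂ g₀ g₁ g₂ →
      N * (N + + 1) * (+ 1 * q₀ * (+ 2 * g₂)) + (- (+ 2 * (δ - + 1)) * (+ 1 * q₁ * (+ 1 * g₁))
        + (M * (M + + 1) * (+ 2 * q₂ * (+ 1 * g₀)) + + 0)) ≡
      - (+ 2) * ((δ - + 1) * g₁ * q₁ - M * (M + + 1) * g₀ * q₂) + N * (N + + 1) * (+ 2 * g₂) * q₀
    algˡ = solve-∀

  quadratic-relation : ∀ {d αs βs} (cfg : Config d αs βs) k → 2 ℕ.≤ k →
    Null (antidiag (λ a b → quadraticKernel (+ length αs) (+ length βs) (+ d) (+ a) (+ b) *
      (coeff (fromRoots αs) a * coeff (fromRoots βs) b)) k)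
  quadratic-relation {d} {αs} {βs} cfg (suc (suc k)) _ = null-resp
    (trans (coeff-bilinear ts (refl ∷ refl ∷ refl ∷ []) (fromRoots αs) (fromRoots βs) k)
      (antidiag-cong (λ a b → cong (_* (coeff (fromRoots αs) a * coeff (fromRoots βs) b))
        (kernel-quadratic (length αs) (length βs) d a b)) (suc (suc k))))
    (quadratic-nullPoly cfg (+ 0) k)
    where
    ts = quadratic (length αs) (length βs) d
  quadratic-relation cfg (suc zero) (s≤s ())

  module _ (n : ℕ) where

    private
      N = + n
      A = cubicA N
      B = cubicB N

    -- Where `g` vanishes, the second local relation and the derivative of the quadratic identity
    -- involve only `q₁ g₂`, `q₂ g₁` and `q₀ g₃`. Antisymmetry requires opposite coefficients at the
    -- first two products. In the two relations these coefficients add up to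
    -- `−(N + 1)(N − 2)(N² − 3)` and `−4(N + 1)(N − 2)`, whence the multipliers `12` and `9 − 3N²`.
    -- The common factor `N + 1` is cancelled.
    cubicAt : ∀ {d αs βs} → Config d αs βs → length αs ≡ n → length βs ≡ n →
      All (λ β → Null (taylor β (bilinear (cubic n) (fromRoots αs) (fromRoots βs)) 0)) βs
    cubicAt {d} {αs} {βs} cfg refl m≡n =
      All.zipWith (λ { {β} (h , r) → go β (proj₂ h) r }) (localRelations cfg , fromRoots-allRoots βs)
      where
      open Config cfg
      q = fromRoots αs
      g = fromRoots βs
      d≡ : + d ≡ N * N
      d≡ = trans (cong +_ (trans (sym full) (cong (ℕ._* n) m≡n))) (ℤ.pos-* n n)
      n<d : n ℕ.< d
      n<d = ℕ.<-≤-trans (ℕ.m<m*n n (length βs) {{ℕ.>-nonZero (ℕ.<-trans (s≤s z≤n) sizeˡ)}} sizeʳ)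
        (ℕ.≤-reflexive (trans (ℕ.*-comm n (length βs)) full))
      ¬null-N+1 : ¬ Null (N + + 1)
      ¬null-N+1 = subst (λ k → ¬ Null (+ k)) (ℕ.+-comm 1 n)
        (¬null-small (suc n) (s≤s z≤n) (ℕ.≤-<-trans n<d (ℕ.≤-<-trans (ℕ.m≤m+n d d) small)))
      go : ∀ β → Relation₂ d n (taylor β q) (taylor β g) → Null (taylor β g 0) →
        Null (taylor β (bilinear (cubic n) q g) 0)
      go β h r = null-resp (sym (taylor-bilinear β (cubic n) q g 0))
        (null-cancel (N + + 1) ¬null-N+1
          (null₃ (+ 12) (+ 9 - + 3 * N * N)
            (((N + + 1) * A - (+ 9 - + 3 * N * N) * N * (N + + 1)) * (+ 6 * taylor β q 3))
            (null-resp (cong relation d≡) h)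
            (null-resp (trans (taylor-bilinear β (quadratic n (length βs) d) q g 1)
                (cong₂ first (cong +_ m≡n) d≡))
              (quadratic-nullPoly cfg β 1))
            r
            (alg N (taylor β q 0) (taylor β q 1) (taylor β q 2) (taylor β q 3)
              (taylor β g 0) (taylor β g 1) (taylor β g 2) (taylor β g 3))))
        where
        relation : ℤ → ℤ
        relation δ = + 2 * (δ - + 2) * N * (N + + 1) * taylor β q 1 * taylor β g 2
          - + 2 * (δ - + 1) * (δ - + 2) * taylor β q 2 * taylor β g 1
          - (N - + 1) * (N + + 2) * (δ - + 1) * taylor β q 1 * taylor β g 2
          - + 2 * N * (N + + 1) * (N + + 2) * taylor β q 0 * taylor β g 3
        first : ℤ → ℤ → ℤ
        first M δ = bilinearTaylor
          ((N * (N + + 1) , 0 , 2) ∷ (- (+ 2 * (δ - + 1)) , 1 , 1) ∷ (M * (M + + 1) , 2 , 0) ∷ [])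
          (taylor β q) (taylor β g) 1
        alg : ∀ N q₀ q₁ q₂ q₃ g₀ g₁ g₂ g₃ →
          (N + + 1) * (N * (+ 3 * N * N + + 4 * N - + 1) * (+ 6 * q₃ * (+ 1 * g₀))
            + (- (N * (+ 3 * N * N + + 4 * N - + 1)) * (+ 1 * q₀ * (+ 6 * g₃))
            + (- (+ 3 * (+ 3 * N * N * N - + 2 * N * N - + 5 * N + + 2)) * (+ 2 * q₂ * (+ 1 * g₁))
            + (- - (+ 3 * (+ 3 * N * N * N - + 2 * N * N - + 5 * N + + 2)) * (+ 1 * q₁ * (+ 2 * g₂)) + + 0)))) ≡
          + 12 * (+ 2 * (N * N - + 2) * N * (N + + 1) * q₁ * g₂
            - + 2 * (N * N - + 1) * (N * N - + 2) * q₂ * g₁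
            - (N - + 1) * (N + + 2) * (N * N - + 1) * q₁ * g₂
            - + 2 * N * (N + + 1) * (N + + 2) * q₀ * g₃) +
          (+ 9 - + 3 * N * N) *
            (N * (N + + 1) * (+ 1 * q₀ * (+ 6 * g₃) + + 1 * q₁ * (+ 2 * g₂))
            + (- (+ 2 * (N * N - + 1)) * (+ 1 * q₁ * (+ 2 * g₂) + + 2 * q₂ * (+ 1 * g₁))
            + (N * (N + + 1) * (+ 2 * q₂ * (+ 1 * g₁) + + 6 * q₃ * (+ 1 * g₀)) + + 0))) +
          ((N + + 1) * (N * (+ 3 * N * N + + 4 * N - + 1)) - (+ 9 - + 3 * N * N) * N * (N + + 1)) * (+ 6 * q₃) * g₀
        alg = solve-∀

    -- Carries the vanishing at the second set, applied to the swapped configuration, over to the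
    -- first set.
    cubic-antisym : ∀ y q g → taylor y (bilinear (cubic n) q g) 0 ≡
      - (+ 1) * taylor y (bilinear (cubic n) g q) 0
    cubic-antisym y q g = trans (taylor-bilinear y (cubic n) q g 0)
      (trans (alg A B (taylor y q 0) (taylor y q 1) (taylor y q 2) (taylor y q 3)
          (taylor y g 0) (taylor y g 1) (taylor y g 2) (taylor y g 3))
        (cong (- (+ 1) *_) (sym (taylor-bilinear y (cubic n) g q 0))))
      where
      alg : ∀ A B q₀ q₁ q₂ q₃ g₀ g₁ g₂ g₃ →
        A * (+ 6 * q₃ * (+ 1 * g₀)) + (- A * (+ 1 * q₀ * (+ 6 * g₃))
          + (B * (+ 2 * q₂ * (+ 1 * g₁)) + (- B * (+ 1 * q₁ * (+ 2 * g₂)) + + 0))) ≡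
        - (+ 1) * (A * (+ 6 * g₃ * (+ 1 * q₀)) + (- A * (+ 1 * g₀ * (+ 6 * q₃))
          + (B * (+ 2 * g₂ * (+ 1 * q₁)) + (- B * (+ 1 * g₁ * (+ 2 * q₂)) + + 0))))
      alg = solve-∀

    cubic-nullPoly : ∀ {d αs βs} (cfg : Config d αs βs) → length αs ≡ n → length βs ≡ n →
      NullPoly (bilinear (cubic n) (fromRoots αs) (fromRoots βs))
    cubic-nullPoly {d} {αs} {βs} cfg eqα eqβ =
      bilinear-nullPoly 2 (cubic n) (refl ∷ refl ∷ refl ∷ refl ∷ []) αs βs (all-distinct cfg)
        (All.map (λ {α} h → null₁ (- (+ 1)) h (cubic-antisym α (fromRoots αs) (fromRoots βs)))
          (cubicAt (swap cfg) eqβ eqα))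
        (cubicAt cfg eqα eqβ)

    cubic-relation : ∀ {d αs βs} (cfg : Config d αs βs) → length αs ≡ n → length βs ≡ n →
      ∀ k → 3 ℕ.≤ k → Null (antidiag (λ a b → cubicKernel N (+ a) (+ b) *
        (coeff (fromRoots αs) a * coeff (fromRoots βs) b)) k)
    cubic-relation {d} {αs} {βs} cfg eqα eqβ (suc (suc (suc k))) _ = null-resp
      (trans (coeff-bilinear (cubic n) (refl ∷ refl ∷ refl ∷ refl ∷ []) (fromRoots αs) (fromRoots βs) k)
        (antidiag-cong (λ a b → cong (_* (coeff (fromRoots αs) a * coeff (fromRoots βs) b))
          (kernel-cubic n a b)) (suc (suc (suc k)))))
      (cubic-nullPoly cfg eqα eqβ (+ 0) k)
    cubic-relation cfg eqα eqβ (suc (suc zero)) (s≤s (s≤s ()))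
    cubic-relation cfg eqα eqβ (suc zero) (s≤s ())

  -- Newton's identities and extreme coefficients

  -- The coefficient of x^(n−j) in fromRoots αs, n being the length of αs.
  top : List ℤ → ℕ → ℤ
  top []       zero    = + 1
  top []       (suc j) = + 0
  top (α ∷ αs) zero    = + 1
  top (α ∷ αs) (suc j) = top αs (suc j) - α * top αs j

  top-zero : ∀ αs → top αs 0 ≡ + 1
  top-zero []       = refl
  top-zero (α ∷ αs) = refl

  top-beyond : ∀ αs j → length αs ℕ.< j → top αs j ≡ + 0
  top-beyond []       (suc j) _        = refl
  top-beyond (α ∷ αs) (suc j) (s≤s lt)
    rewrite top-beyond αs (suc j) (ℕ.m<n⇒m<1+n lt) | top-beyond αs j lt = alg α
    where
    alg : ∀ α → + 0 - α * + 0 ≡ + 0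
    alg = solve-∀

  coeff-top : ∀ αs i j → i ℕ.+ j ≡ length αs → coeff (fromRoots αs) i ≡ top αs j
  coeff-top []       zero    zero    eq = refl
  coeff-top (α ∷ αs) zero    (suc j) eq
    rewrite taylor-fromRoots-zero (+ 0) α αs | coeff-top αs 0 j (ℕ.suc-injective eq)
          | top-beyond αs (suc j) (ℕ.≤-reflexive (sym eq)) = alg α (top αs j)
    where
    alg : ∀ α x → (+ 0 - α) * x ≡ + 0 - α * x
    alg = solve-∀
  coeff-top (α ∷ αs) (suc i) zero    eq
    rewrite taylor-fromRoots-suc (+ 0) α αs i
          | taylor-fromRoots-beyond (+ 0) αs (suc i) (ℕ.≤-reflexive (trans (sym eq) (ℕ.+-identityʳ (suc i))))
          | coeff-top αs i 0 (ℕ.suc-injective eq) | top-zero αs = alg α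
    where
    alg : ∀ α → (+ 0 - α) * + 0 + + 1 ≡ + 1
    alg = solve-∀
  coeff-top (α ∷ αs) (suc i) (suc j) eq
    rewrite taylor-fromRoots-suc (+ 0) α αs i
          | coeff-top αs (suc i) j (trans (sym (ℕ.+-suc i j)) (ℕ.suc-injective eq))
          | coeff-top αs i (suc j) (ℕ.suc-injective eq) = alg α (top αs j) (top αs (suc j))
    where
    alg : ∀ α x y → (+ 0 - α) * x + y ≡ y - α * x
    alg = solve-∀

  sumOver : List ℤ → (ℤ → ℤ) → ℤ
  sumOver []       φ = + 0
  sumOver (α ∷ αs) φ = φ α + sumOver αs φ

  sumOver-cong : ∀ αs {φ ψ} → (∀ α → φ α ≡ ψ α) → sumOver αs φ ≡ sumOver αs ψ
  sumOver-cong []       eq = refl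
  sumOver-cong (α ∷ αs) eq = cong₂ _+_ (eq α) (sumOver-cong αs eq)

  sumOver-linear : ∀ αs a φ ψ →
    sumOver αs (λ α → a * φ α + ψ α) ≡ a * sumOver αs φ + sumOver αs ψ
  sumOver-linear []       a φ ψ = sym (trans (ℤ.+-identityʳ _) (ℤ.*-zeroʳ a))
  sumOver-linear (α ∷ αs) a φ ψ rewrite sumOver-linear αs a φ ψ =
    alg a (φ α) (ψ α) (sumOver αs φ) (sumOver αs ψ)
    where
    alg : ∀ a x y u v → a * x + y + (a * u + v) ≡ a * (x + u) + (y + v)
    alg = solve-∀

  sumOver-const : ∀ αs c → sumOver αs (λ _ → c) ≡ + length αs * c
  sumOver-const []       c = refl
  sumOver-const (α ∷ αs) c rewrite sumOver-const αs c = alg c (+ length αs)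
    where
    alg : ∀ c n → c + n * c ≡ (+ 1 + n) * c
    alg = solve-∀

  powerSum : List ℤ → ℕ → ℤ
  powerSum αs k = sumOver αs (_^ k)

  -- With the value `0` at order zero, Newton's identity becomes a sum over a full antidiagonal.
  powerSum⁺ : List ℤ → ℕ → ℤ
  powerSum⁺ αs zero    = + 0
  powerSum⁺ αs (suc k) = powerSum αs (suc k)

  geometric : ∀ α (σ : ℕ → ℤ) k →
    antidiag (λ i j → σ i * α ^ suc j) (suc k) ≡
    α * antidiag (λ i j → σ i * α ^ suc j) k + α * σ (suc k)
  geometric α σ zero    = alg α (σ 0) (σ 1)
    where
    alg : ∀ α x y → x * (α * (α * + 1)) + y * (α * + 1) ≡ α * (x * (α * + 1)) + α * y
    alg = solve-∀
  geometric α σ (suc k) =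
    trans (+-congʳ (σ 0 * α ^ suc (suc (suc k))) (geometric α (σ ∘ suc) k))
      (alg α (σ 0) (α ^ suc (suc k)) (antidiag (λ i j → σ (suc i) * α ^ suc j) k) (σ (suc (suc k))))
    where
    alg : ∀ α x z u y → x * (α * z) + (α * u + α * y) ≡ α * (x * z + u) + α * y
    alg = solve-∀

  newton : ∀ αs k → + k * top αs k + antidiag (λ i j → top αs i * powerSum⁺ αs j) k ≡ + 0
  newton []       zero    = refl
  newton []       (suc k) = cong₂ _+_ (ℤ.*-zeroʳ (+ suc k))
    (antidiag-zero {λ i j → top [] i * powerSum⁺ [] j} (suc k)
      λ { i zero eq → ℤ.*-zeroʳ (top [] i) ; i (suc j) eq → ℤ.*-zeroʳ (top [] i) })
  newton (α ∷ αs) zero    = refl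
  newton (α ∷ αs) (suc k) = begin
    + suc k * (E (suc k) - α * E k) + antidiag (λ i j → E′ i * powerSum⁺ (α ∷ αs) j) (suc k)
      ≡⟨ +-congʳ (+ suc k * (E (suc k) - α * E k)) (trans (antidiag-cong split (suc k))
           (trans (antidiag-linear (+ 1) (λ i j → E′ i * P j) (λ i j → E′ i * π j) (suc k))
             (cong₂ (λ u v → + 1 * u + v) twist geometricPart))) ⟩
    + suc k * (E (suc k) - α * E k) + (+ 1 * (EP (suc k) + - α * EP k) + α * E k)
      ≡⟨ alg α (+ k) (E (suc k)) (E k) (EP (suc k)) (EP k) ⟩
    + suc k * E (suc k) + EP (suc k) - α * (+ k * E k + EP k)
      ≡⟨ cong₂ (λ u v → u - α * v) (newton αs (suc k)) (newton αs k) ⟩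
    + 0 - α * + 0
      ≡⟨ alg′ α ⟩
    + 0 ∎
    where
    open ≡-Reasoning
    E  = top αs
    E′ = top (α ∷ αs)
    P  = powerSum⁺ αs
    π : ℕ → ℤ
    π zero    = + 0
    π (suc j) = α ^ suc j
    EP : ℕ → ℤ
    EP = antidiag (λ i j → E i * P j)
    alg : ∀ α k x y u v → (+ 1 + k) * (x - α * y) + (+ 1 * (u + - α * v) + α * y) ≡
      (+ 1 + k) * x + u - α * (k * y + v)
    alg = solve-∀
    alg′ : ∀ α → + 0 - α * + 0 ≡ + 0
    alg′ = solve-∀
    split : ∀ i j → E′ i * powerSum⁺ (α ∷ αs) j ≡ + 1 * (E′ i * P j) + E′ i * π j
    split i zero    = alg₀ (E′ i)
      where
      alg₀ : ∀ x → x * + 0 ≡ + 1 * (x * + 0) + x * + 0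
      alg₀ = solve-∀
    split i (suc j) = alg₁ (E′ i) (α ^ suc j) (powerSum αs (suc j))
      where
      alg₁ : ∀ x y z → x * (y + z) ≡ + 1 * (x * z) + x * y
      alg₁ = solve-∀
    -- Passing from αs to α ∷ αs multiplies the generating series by 1 − α t.
    twisted : ∀ (φ : ℕ → ℤ) k → antidiag (λ i j → E′ i * φ j) (suc k) ≡
      antidiag (λ i j → E i * φ j) (suc k) + - α * antidiag (λ i j → E i * φ j) k
    twisted φ k = trans (cong₂ (λ u v → u * φ (suc k) + v) (sym (top-zero αs))
        (trans (antidiag-cong (λ i j → alg₁ α (E (suc i)) (E i) (φ j)) k)
          (antidiag-linear (- α) (λ i j → E i * φ j) (λ i j → E (suc i) * φ j) k)))
      (alg₂ (- α) (E 0 * φ (suc k)) (antidiag (λ i j → E i * φ j) k) (antidiag (λ i j → E (suc i) * φ j) k))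
      where
      alg₁ : ∀ α x y z → (x - α * y) * z ≡ - α * (y * z) + x * z
      alg₁ = solve-∀
      alg₂ : ∀ a x u v → x + (a * u + v) ≡ x + v + a * u
      alg₂ = solve-∀
    twist : antidiag (λ i j → E′ i * P j) (suc k) ≡ EP (suc k) + - α * EP k
    twist = twisted P k
    shifted : ∀ k → antidiag (λ i j → E i * π j) (suc k) ≡ antidiag (λ i j → E i * α ^ suc j) k
    shifted k = antidiag-shiftʳ (λ i j → E i * π j) (λ i → ℤ.*-zeroʳ (E i)) k
    -- The factor `1 − α t` cancels the denominator of the geometric series of the powers of `α`, so
    -- a single term survives.
    geometricPart : antidiag (λ i j → E′ i * π j) (suc k) ≡ α * E k
    geometricPart = trans (twisted π k) (trans (cong (_+ - α * antidiag (λ i j → E i * π j) k) (shifted k)) (step k))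
      where
      step : ∀ k → antidiag (λ i j → E i * α ^ suc j) k + - α * antidiag (λ i j → E i * π j) k ≡ α * E k
      step zero    = alg₀ α (E 0)
        where
        alg₀ : ∀ α x → x * (α * + 1) + - α * (x * + 0) ≡ α * x
        alg₀ = solve-∀
      step (suc k) = trans (cong₂ (λ u v → u + - α * v) (geometric α E k) (shifted k))
        (alg₁ α (antidiag (λ i j → E i * α ^ suc j) k) (E (suc k)))
        where
        alg₁ : ∀ α u x → α * u + α * x + - α * u ≡ α * x
        alg₁ = solve-∀

  antidiag-single : ∀ f k i j → i ℕ.+ j ≡ k →
    (∀ i′ j′ → i′ ℕ.+ j′ ≡ k → i′ ≢ i → Null (f i′ j′)) → Null (antidiag f k - f i j)
  antidiag-single f zero    zero    j refl h = null-diff {f 0 0} refl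
  antidiag-single f (suc k) zero    j refl h =
    null-resp (alg (f 0 (suc k)) (antidiag (λ i j → f (suc i) j) k))
      (antidiag-null (λ i j → f (suc i) j) k λ i j eq → h (suc i) j (cong suc eq) λ ())
    where
    alg : ∀ x u → u ≡ x + u - x
    alg = solve-∀
  antidiag-single f (suc k) (suc i) j eq h =
    null₂ (+ 1) (+ 1) (h 0 (suc k) refl λ ())
      (antidiag-single (λ i j → f (suc i) j) k i j (ℕ.suc-injective eq)
        λ i′ j′ eq′ i′≢i → h (suc i′) j′ (cong suc eq′) (i′≢i ∘ ℕ.suc-injective))
      (alg (f 0 (suc k)) (antidiag (λ i j → f (suc i) j) k) (f (suc i) j))
    where
    alg : ∀ x u y → x + u - y ≡ + 1 * x + + 1 * (u - y)
    alg = solve-∀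

  antidiag-pair : ∀ f k i j i₁ j₁ → i ℕ.< i₁ → i ℕ.+ j ≡ k → i₁ ℕ.+ j₁ ≡ k →
    (∀ i′ j′ → i′ ℕ.+ j′ ≡ k → i′ ≢ i → i′ ≢ i₁ → Null (f i′ j′)) →
    Null (antidiag f k - (f i j + f i₁ j₁))
  antidiag-pair f (suc k) zero    j (suc i₁) j₁ lt refl eq₁ h =
    null-resp (alg (f 0 (suc k)) (antidiag (λ i j → f (suc i) j) k) (f (suc i₁) j₁))
      (antidiag-single (λ i j → f (suc i) j) k i₁ j₁ (ℕ.suc-injective eq₁)
        λ i′ j′ eq′ i′≢i → h (suc i′) j′ (cong suc eq′) (λ ()) (i′≢i ∘ ℕ.suc-injective))
    where
    alg : ∀ x u y → u - y ≡ x + u - (x + y)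
    alg = solve-∀
  antidiag-pair f (suc k) (suc i) j (suc i₁) j₁ (s≤s lt) eq eq₁ h =
    null₂ (+ 1) (+ 1) (h 0 (suc k) refl (λ ()) (λ ()))
      (antidiag-pair (λ i j → f (suc i) j) k i j i₁ j₁ lt (ℕ.suc-injective eq) (ℕ.suc-injective eq₁)
        λ i′ j′ eq′ n n₁ → h (suc i′) j′ (cong suc eq′) (n ∘ ℕ.suc-injective) (n₁ ∘ ℕ.suc-injective))
      (alg (f 0 (suc k)) (antidiag (λ i j → f (suc i) j) k) (f (suc i) j + f (suc i₁) j₁))
    where
    alg : ∀ x u y → x + u - y ≡ + 1 * x + + 1 * (u - y)
    alg = solve-∀

  newton-lowest : ∀ αs w → 0 ℕ.< w → (∀ j → 0 ℕ.< j → j ℕ.< w → Null (top αs j)) →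
    Null (+ w * top αs w + powerSum αs w)
  newton-lowest αs (suc w) _ h = null₂ (+ 1) (- (+ 1)) (null-≡0 (newton αs (suc w)))
    (antidiag-single F (suc w) 0 (suc w) refl other)
    (trans (cong (λ x → + suc w * top αs (suc w) + x)
        (trans (sym (ℤ.*-identityˡ (powerSum αs (suc w)))) (cong (_* powerSum αs (suc w)) (sym (top-zero αs)))))
      (alg (+ suc w * top αs (suc w)) (antidiag F (suc w)) (F 0 (suc w))))
    where
    F : ℕ → ℕ → ℤ
    F i j = top αs i * powerSum⁺ αs j
    alg : ∀ x u y → x + y ≡ + 1 * (x + u) + - (+ 1) * (u - y)
    alg = solve-∀
    other : ∀ i j → i ℕ.+ j ≡ suc w → i ≢ 0 → Null (F i j)
    other zero    j       eq i≢0 = ⊥-elim (i≢0 refl)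
    other (suc i) zero    eq i≢0 = null-≡0 (ℤ.*-zeroʳ (top αs (suc i)))
    other (suc i) (suc j) eq i≢0 = null-*ʳ (h (suc i) (s≤s z≤n)
      (ℕ.≤-<-trans (ℕ.m≤m+n (suc i) j) (ℕ.≤-reflexive (trans (sym (ℕ.+-suc (suc i) j)) eq))))
      (powerSum αs (suc j))

  powerSums-vanish : ∀ αs w → (∀ j → 0 ℕ.< j → j ℕ.< w → Null (top αs j)) →
    ∀ j → 0 ℕ.< j → j ℕ.< w → Null (powerSum αs j)
  powerSums-vanish αs w h j 0<j j<w = null₂ (+ 1) (- (+ j))
    (newton-lowest αs j 0<j λ i 0<i i<j → h i 0<i (ℕ.<-trans i<j j<w)) (h j 0<j j<w)
    (alg (+ j) (top αs j) (powerSum αs j))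
    where
    alg : ∀ j x y → y ≡ + 1 * (j * x + y) + - j * x
    alg = solve-∀

  module _ (βs : List ℤ) (w : ℕ) (vanish : ∀ j → 0 ℕ.< j → j ℕ.< w → Null (powerSum βs j)) where

    -- Every monomial of `x^k f` other than the top one has positive degree below `w`, so its power
    -- sum vanishes.
    sumOver-poly : ∀ N f k → length f ≡ suc N → 0 ℕ.< k → k ℕ.+ N ≡ w →
      Null (sumOver βs (λ β → β ^ k * taylor β f 0) - coeff f N * powerSum βs w)
    sumOver-poly zero    (c ∷ []) k refl 0<k eq = null-≡0 (trans
      (cong₂ (λ u v → u - coeff (c ∷ []) 0 * powerSum βs v)
        (trans (sumOver-cong βs λ β → alg₁ c β (β ^ k)) (sumOver-linear βs c (_^ k) (λ _ → + 0)))
        (trans (sym eq) (ℕ.+-identityʳ k)))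
      (trans (cong (λ z → c * powerSum βs k + z - coeff (c ∷ []) 0 * powerSum βs k)
          (trans (sumOver-const βs (+ 0)) (ℤ.*-zeroʳ (+ length βs))))
        (alg₂ c (powerSum βs k))))
      where
      alg₁ : ∀ c β z → z * (c + β * + 0) ≡ c * z + + 0
      alg₁ = solve-∀
      alg₂ : ∀ c P → c * P + + 0 - (c + + 0) * P ≡ + 0
      alg₂ = solve-∀
    sumOver-poly (suc N) (c ∷ f) k eqf 0<k eq =
      null₂ c (+ 1) (vanish k 0<k k<w)
        (sumOver-poly N f (suc k) (ℕ.suc-injective eqf) (s≤s z≤n) (trans (sym (ℕ.+-suc k N)) eq))
        (trans (cong₂ (λ u v → u - v * powerSum βs w)
            (trans (sumOver-cong βs λ β → alg₁ c β (β ^ k) (taylor β f 0))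
              (sumOver-linear βs c (_^ k) (λ β → β ^ suc k * taylor β f 0)))
            (coeff-suc c f N))
          (alg₂ c (powerSum βs k) (sumOver βs (λ β → β ^ suc k * taylor β f 0)) (coeff f N * powerSum βs w)))
      where
      k<w : k ℕ.< w
      k<w = subst (k ℕ.<_) eq (ℕ.m<m+n k (s≤s z≤n))
      alg₁ : ∀ c β z t → z * (c + β * t) ≡ c * z + β * z * t
      alg₁ = solve-∀
      alg₂ : ∀ c x y z → c * x + y - z ≡ c * x + + 1 * (y - z)
      alg₂ = solve-∀

    -- Of the binomial expansion only the powers `β^0` and `β^w` survive. The constant term is split
    -- off first, because the power sum of order zero is the number of points and does not vanish.
    sumOver-shifted : 0 ℕ.< w → ∀ α →
      Null (sumOver βs (λ β → (β - α) ^ w) - (+ length βs * (- α) ^ w + powerSum βs w))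
    sumOver-shifted 0<w α = split (linPow α w) refl
      where
      value : ∀ y → taylor y (linPow α w) 0 ≡ (y - α) ^ w
      value y = trans (taylor-linPow y α w 0) (ℤ.*-identityˡ _)
      len : length (linPow α w) ≡ suc w
      len = trans (length-fromRoots (replicate w α)) (cong suc (length-replicate w))
      lead : coeff (linPow α w) w ≡ + 1
      lead = trans (cong (coeff (linPow α w)) (sym (length-replicate w)))
        (taylor-fromRoots-lead (+ 0) (replicate w α))
      split : ∀ f → f ≡ linPow α w →
        Null (sumOver βs (λ β → (β - α) ^ w) - (+ length βs * (- α) ^ w + powerSum βs w))
      split []      eq = ⊥-elim (ℕ.0≢1+n (trans (cong length eq) len))
      split (c ∷ f) eq = go w 0<w refl
        where
        go : ∀ w₀ → 0 ℕ.< w₀ → w₀ ≡ w →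
          Null (sumOver βs (λ β → (β - α) ^ w) - (+ length βs * (- α) ^ w + powerSum βs w))
        go (suc N) _ refl = null-resp
          (cong₂ (λ u v → u - (+ length βs * v + powerSum βs w)) sumEq constEq)
          (null-resp (alg (+ length βs * c) (sumOver βs (λ β → β ^ 1 * taylor β f 0)) (coeff f N) (powerSum βs w) leadEq)
            (sumOver-poly N f 1 (ℕ.suc-injective (trans (cong length eq) len)) (s≤s z≤n) refl))
          where
          leadEq : coeff f N ≡ + 1
          leadEq = trans (sym (coeff-suc c f N)) (trans (cong (λ f → coeff f (suc N)) eq) lead)
          constEq : c ≡ (- α) ^ w
          constEq = trans (sym (coeff-zero c f)) (trans (cong (λ f → coeff f 0) eq)
            (trans (value (+ 0)) (cong (_^ w) (ℤ.+-identityˡ (- α)))))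
          sumEq : + length βs * c + sumOver βs (λ β → β ^ 1 * taylor β f 0) ≡ sumOver βs (λ β → (β - α) ^ w)
          sumEq = trans (sym (trans (sumOver-linear βs (+ 1) (λ _ → c) (λ β → β ^ 1 * taylor β f 0))
              (cong (_+ sumOver βs (λ β → β ^ 1 * taylor β f 0)) (trans (ℤ.*-identityˡ _) (sumOver-const βs c)))))
            (sumOver-cong βs λ β → trans (alg₁ c β (taylor β f 0))
              (trans (cong (λ f → taylor β f 0) eq) (value β)))
            where
            alg₁ : ∀ c β t → + 1 * c + β * + 1 * t ≡ c + β * t
            alg₁ = solve-∀
          alg : ∀ x s l P → l ≡ + 1 → s - l * P ≡ x + s - (x + P)
          alg x s l P refl = alg₂ x s P
            where
            alg₂ : ∀ x s P → s - + 1 * P ≡ x + s - (x + P)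
            alg₂ = solve-∀

  -- Summands of different sizes

  null? : ∀ x → Dec (Null x)
  null? x = map′ null Null.divides (+ p ℤ.∣? x)

  null-^⁻ : ∀ x k → Null (x ^ k) → Null x
  null-^⁻ x zero    h = ⊥-elim (¬null-1 h)
  null-^⁻ x (suc k) h with null-integral x (x ^ k) h
  ... | inj₁ h′ = h′
  ... | inj₂ h′ = null-^⁻ x k h′

  null-small⇒≡ : ∀ {i j} → i ℕ.≤ j → j ℕ.< p → Null (+ j - + i) → i ≡ j
  null-small⇒≡ {i} {j} i≤j j<p h with ℕ.m≤n⇒∃[o]m+o≡n i≤j
  ... | zero  , refl = sym (ℕ.+-identityʳ i)
  ... | suc o , refl = ⊥-elim (¬null-small (suc o) (s≤s z≤n) (ℕ.≤-<-trans (ℕ.m≤n+m (suc o) i) j<p)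
    (null-resp (alg (+ i) (+ suc o)) h))
    where
    alg : ∀ i o → i + o - i ≡ o
    alg = solve-∀

  -- On the antidiagonal `w` below the top degree `n + m`, the two extreme terms pair a coefficient
  -- with a leading coefficient `1`; the terms in between are the products assumed to vanish. The
  -- bilinear relation thus becomes linear in the two coefficients of weight `w`.
  linearPart : ∀ (K : ℕ → ℕ → ℤ) αs βs u v w → 0 ℕ.< w →
    u ℕ.+ w ≡ length αs → v ℕ.+ w ≡ length βs →
    (∀ x y → 0 ℕ.< x → 0 ℕ.< y → x ℕ.+ y ≡ w → Null (top αs x * top βs y)) →
    Null (antidiag (λ a b → K a b * (coeff (fromRoots αs) a * coeff (fromRoots βs) b)) (u ℕ.+ length βs)) →
    Null (K u (length βs) * top αs w + K (length αs) v * top βs w)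
  linearPart K αs βs u v w 0<w u+w v+w middle h =
    null-resp (cong₂ _+_
        (cong (K u m *_) (trans (cong₂ _*_ (coeff-top αs u w u+w) (coeff-top βs m 0 (ℕ.+-identityʳ m)))
          (trans (cong (top αs w *_) (top-zero βs)) (ℤ.*-identityʳ (top αs w)))))
        (cong (K n v *_) (trans (cong₂ _*_ (coeff-top αs n 0 (ℕ.+-identityʳ n)) (coeff-top βs v w v+w))
          (trans (cong (_* top βs w) (top-zero αs)) (ℤ.*-identityˡ (top βs w))))))
      (null₂ (+ 1) (- (+ 1)) h
        (antidiag-pair F (u ℕ.+ m) u m n v u<n refl n+v other)
        (alg (antidiag F (u ℕ.+ m)) (F u m) (F n v)))
    where
    n = length αs
    m = length βs
    F : ℕ → ℕ → ℤ
    F a b = K a b * (coeff (fromRoots αs) a * coeff (fromRoots βs) b)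
    alg : ∀ s x y → x + y ≡ + 1 * s + - (+ 1) * (s - (x + y))
    alg = solve-∀
    u<n : u ℕ.< n
    u<n = subst (u ℕ.<_) u+w (ℕ.m<m+n u 0<w)
    n+v : n ℕ.+ v ≡ u ℕ.+ m
    n+v = trans (cong (ℕ._+ v) (sym u+w)) (trans (ℕ.+-assoc u w v) (cong (u ℕ.+_) (trans (ℕ.+-comm w v) v+w)))
    other : ∀ i j → i ℕ.+ j ≡ u ℕ.+ m → i ≢ u → i ≢ n → Null (F i j)
    other i j eq i≢u i≢n = null-*ˡ (K i j) (go (ℕ.≤-total i n) (ℕ.≤-total j m))
      where
      go : i ℕ.≤ n ⊎ n ℕ.≤ i → j ℕ.≤ m ⊎ m ℕ.≤ j →
        Null (coeff (fromRoots αs) i * coeff (fromRoots βs) j)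
      go (inj₂ n≤i) _ = null-*ʳ (null-≡0 (taylor-fromRoots-beyond (+ 0) αs i (ℕ.≤∧≢⇒< n≤i (i≢n ∘ sym))))
        (coeff (fromRoots βs) j)
      go (inj₁ i≤n) (inj₂ m≤j) = null-*ˡ (coeff (fromRoots αs) i)
        (null-≡0 (taylor-fromRoots-beyond (+ 0) βs j (ℕ.≤∧≢⇒< m≤j m≢j)))
        where
        m≢j : m ≢ j
        m≢j m≡j = i≢u (ℕ.+-cancelʳ-≡ m i u (trans (cong (i ℕ.+_) m≡j) eq))
      go (inj₁ i≤n) (inj₁ j≤m) with ℕ.m≤n⇒∃[o]m+o≡n i≤n | ℕ.m≤n⇒∃[o]m+o≡n j≤m
      ... | x , i+x | y , j+y =
        subst₂ (λ s t → Null (s * t)) (sym (coeff-top αs i x i+x)) (sym (coeff-top βs j y j+y))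
          (middle x y (ℕ.n≢0⇒n>0 x≢0) (ℕ.n≢0⇒n>0 y≢0) x+y)
        where
        x+y : x ℕ.+ y ≡ w
        x+y = ℕ.+-cancelˡ-≡ (u ℕ.+ m) (x ℕ.+ y) w (trans (cong (ℕ._+ (x ℕ.+ y)) (sym eq))
          (trans (alg₁ i j x y) (trans (cong₂ ℕ._+_ (trans i+x (sym u+w)) j+y) (alg₂ u w m))))
          where
          alg₁ : ∀ i j x y → i ℕ.+ j ℕ.+ (x ℕ.+ y) ≡ i ℕ.+ x ℕ.+ (j ℕ.+ y)
          alg₁ = ℕ-Solver.solve-∀
          alg₂ : ∀ u w m → u ℕ.+ w ℕ.+ m ≡ u ℕ.+ m ℕ.+ w
          alg₂ = ℕ-Solver.solve-∀
        x≢0 : x ≢ 0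
        x≢0 refl = i≢n (trans (sym (ℕ.+-identityʳ i)) i+x)
        y≢0 : y ≢ 0
        y≢0 refl = i≢u (ℕ.+-cancelʳ-≡ w i u (trans (cong (i ℕ.+_) (trans (sym x+y) (ℕ.+-identityʳ x))) (trans i+x (sym u+w))))

  top-zeros : ∀ n j → top (replicate n (+ 0)) (suc j) ≡ + 0
  top-zeros zero    j = refl
  top-zeros (suc n) j rewrite top-zeros n j = refl

  -- Otherwise the polynomial would be `x^n` modulo `p`, whose only root is zero, while `αs`
  -- contains two incongruent roots.
  tops-vanish⇒⊥ : ∀ αs → Distinct αs → 2 ℕ.≤ length αs →
    (∀ w → 0 ℕ.< w → w ℕ.≤ length αs → Null (top αs w)) → ⊥
  tops-vanish⇒⊥ []            dis le h = ℕ.n≮0 le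
  tops-vanish⇒⊥ (α ∷ [])      dis le h = ℕ.n≮0 (ℕ.≤-pred le)
  tops-vanish⇒⊥ αs@(α ∷ α′ ∷ αs′) ((α≉α′ ∷ _) ∷ _) le h =
    α≉α′ (null₂ (+ 1) (- (+ 1)) (root (here refl)) (root (there (here refl))) (alg α α′))
    where
    n = length αs
    alg : ∀ x y → x - y ≡ + 1 * x + - (+ 1) * y
    alg = solve-∀
    f : Poly
    f = add (fromRoots αs) (scale (- (+ 1)) (linPow (+ 0) n))
    taylor-f : ∀ y l → taylor y f l ≡ taylor y (fromRoots αs) l + - (+ 1) * taylor y (linPow (+ 0) n) l
    taylor-f y l = trans (taylor-add y (fromRoots αs) (scale (- (+ 1)) (linPow (+ 0) n)) l)
      (+-congʳ (taylor y (fromRoots αs) l) (taylor-scale y (- (+ 1)) (linPow (+ 0) n) l))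
    f-null : NullPoly f
    f-null = coeffs⇒nullPoly f λ l → null-resp (sym (taylor-f (+ 0) l)) (go l (ℕ.<-cmp l n))
      where
      lenPow = length-replicate n {x = + 0}
      go : ∀ l → Tri (l ℕ.< n) (l ≡ n) (n ℕ.< l) → Null (coeff (fromRoots αs) l + - (+ 1) * coeff (linPow (+ 0) n) l)
      go l (tri< l<n _ _) with ℕ.m≤n⇒∃[o]m+o≡n l<n
      ... | o , l+o = null-+ (null-resp (sym (coeff-top αs l (suc o) (trans (ℕ.+-suc l o) l+o)))
          (h (suc o) (s≤s z≤n) (ℕ.≤-trans (ℕ.m≤n+m (suc o) l) (ℕ.≤-reflexive (trans (ℕ.+-suc l o) l+o)))))
        (null-*ˡ (- (+ 1)) (null-≡0 (trans (coeff-top (replicate n (+ 0)) l (suc o)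
            (trans (trans (ℕ.+-suc l o) l+o) (sym lenPow))) (top-zeros n o))))
      go l (tri≈ _ refl _) = null-≡0 (cong₂ (λ u v → u + - (+ 1) * v)
        (taylor-fromRoots-lead (+ 0) αs)
        (trans (cong (coeff (linPow (+ 0) n)) (sym lenPow)) (taylor-fromRoots-lead (+ 0) (replicate n (+ 0)))))
      go l (tri> _ _ n<l) = null-≡0 (cong₂ (λ u v → u + - (+ 1) * v)
        (taylor-fromRoots-beyond (+ 0) αs l n<l)
        (taylor-fromRoots-beyond (+ 0) (replicate n (+ 0)) l (subst (ℕ._< l) (sym lenPow) n<l)))
    root : ∀ {y} → y ∈ αs → Null y
    root {y} y∈ = null-^⁻ y n (null₂ (+ 1) (- (+ 1))
      (fromRoots-root y αs (Any.map null-diff y∈))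
      (null-resp (taylor-f y 0) (f-null y 0))
      (trans (sym value) (alg′ (taylor y (fromRoots αs) 0) (taylor y (linPow (+ 0) n) 0))))
      where
      value : taylor y (linPow (+ 0) n) 0 ≡ y ^ n
      value = trans (taylor-linPow y (+ 0) n 0) (trans (ℤ.*-identityˡ _) (cong (_^ n) (ℤ.+-identityʳ y)))
      alg′ : ∀ u v → v ≡ + 1 * u + - (+ 1) * (u + - (+ 1) * v)
      alg′ = solve-∀

  -- Zero would belong to both sets modulo `p`, but the differences between the sets are nonzero,
  -- their `d`-th power being `ε`.
  commonRoot : ∀ {d αs βs} → Config d αs βs →
    Null (coeff (fromRoots αs) 0) → Null (coeff (fromRoots βs) 0) → ⊥
  commonRoot {αs = αs} {βs} cfg hα hβ = go (disjoint cfg) (fromRoots-root⁻ (+ 0) αs hα) (fromRoots-root⁻ (+ 0) βs hβ)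
    where
    alg : ∀ α β → α - β ≡ - (+ 1) * (+ 0 - α) + + 1 * (+ 0 - β)
    alg = solve-∀
    inner : ∀ α {βs} → All (λ β → ¬ Null (α - β)) βs → Null (+ 0 - α) → Any (λ β → Null (+ 0 - β)) βs → ⊥
    inner α (_∷_ {x = β} n _) h (here h′)  = n (null₂ (- (+ 1)) (+ 1) h h′ (alg α β))
    inner α (_ ∷ ns)          h (there i) = inner α ns h i
    go : ∀ {αs} → All (λ α → All (λ β → ¬ Null (α - β)) βs) αs →
      Any (λ α → Null (+ 0 - α)) αs → Any (λ β → Null (+ 0 - β)) βs → ⊥
    go (_∷_ {x = α} n _) (here h)  i = inner α n h i
    go (_ ∷ ns)          (there j) i = go ns j i

  -- For a sumset equal to `Γ` these are the power sums of the roots of `x^d − 1`. Stated on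
  -- differences, the property survives the translation that centres `αs`.
  PowerSumsVanish : ℕ → List ℤ → List ℤ → Set
  PowerSumsVanish d αs βs = ∀ w → 0 ℕ.< w → w ℕ.< d →
    Null (sumOver αs (λ α → sumOver βs (λ β → (β - α) ^ w)))

  sumOver-null : ∀ αs {φ} → (∀ α → Null (φ α)) → Null (sumOver αs φ)
  sumOver-null []       h = null-0
  sumOver-null (α ∷ αs) h = null-+ (h α) (sumOver-null αs h)

  sign-cases : ∀ w → (- (+ 1)) ^ w ≡ + 1 ⊎ (- (+ 1)) ^ w ≡ - (+ 1)
  sign-cases zero    = inj₁ refl
  sign-cases (suc w) with sign-cases w
  ... | inj₁ eq = inj₂ (cong (- (+ 1) *_) eq)
  ... | inj₂ eq = inj₁ (cong (- (+ 1) *_) eq)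

  module Unequal {d αs βs} (cfg : Config d αs βs) (n<m : length αs ℕ.< length βs)
    (psums : PowerSumsVanish d αs βs) (centred : Null (top αs 1)) where

    open Config cfg

    private
      n = length αs
      m = length βs
      N = + n
      M = + m

      m<d : m ℕ.< d
      m<d = subst (m ℕ.<_) full (ℕ.m<m*n m n {{ℕ.>-nonZero (ℕ.<-trans (s≤s z≤n) sizeʳ)}} sizeˡ)

      d<p : d ℕ.< p
      d<p = ℕ.≤-<-trans (ℕ.m≤m+n d d) small

      ¬null-≤d : ∀ k → 0 ℕ.< k → k ℕ.≤ d → ¬ Null (+ k)
      ¬null-≤d k 0<k k≤d = ¬null-small k 0<k (ℕ.≤-<-trans k≤d d<p)

      d≡ : + d ≡ M * N
      d≡ = trans (cong +_ (sym full)) (ℤ.pos-* m n)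

    Vanishing : ℕ → Set
    Vanishing w = Null (top αs w) × Null (top βs w)

    module Step (w : ℕ) (0<w : 0 ℕ.< w) (w≤n : w ℕ.≤ n)
      (below : ∀ j → 0 ℕ.< j → j ℕ.< w → Vanishing j) where

      private
        a = top αs w
        b = top βs w
        W = + w
        s = (- (+ 1)) ^ w
        u = proj₁ (ℕ.m≤n⇒∃[o]m+o≡n w≤n)
        v = proj₁ (ℕ.m≤n⇒∃[o]m+o≡n (ℕ.≤-trans w≤n (ℕ.<⇒≤ n<m)))
        u+w : u ℕ.+ w ≡ n
        u+w = trans (ℕ.+-comm u w) (proj₂ (ℕ.m≤n⇒∃[o]m+o≡n w≤n))
        v+w : v ℕ.+ w ≡ m
        v+w = trans (ℕ.+-comm v w) (proj₂ (ℕ.m≤n⇒∃[o]m+o≡n (ℕ.≤-trans w≤n (ℕ.<⇒≤ n<m))))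
        w≤d : w ℕ.≤ d
        w≤d = ℕ.≤-trans w≤n (ℕ.≤-trans (ℕ.<⇒≤ n<m) (ℕ.<⇒≤ m<d))
        Pα = powerSum αs w
        Pβ = powerSum βs w
        X = (M + + 1) * (W + + 1) - + 2 * (N + + 1)
        Y = (N + + 1) * (W + + 1) - + 2 * (M + + 1)

      -- Since the lower power sums of `βs` vanish, the inner sum reduces to `m (−α)^w` plus the
      -- power sum of `βs`; summing over `α` gives the two terms.
      powerSums : Null (M * s * Pα + N * Pβ)
      powerSums = null₂ (- (+ 1)) (+ 1) (sumOver-null αs each) (psums w 0<w (ℕ.<-trans (ℕ.≤-<-trans w≤n n<m) m<d))
        (trans (alg (M * s * Pα + N * Pβ) S)
          (cong (λ z → - (+ 1) * z + + 1 * S) (sym sumEq)))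
        where
        inner : ℤ → ℤ
        inner α = sumOver βs (λ β → (β - α) ^ w)
        S = sumOver αs inner
        φ : ℤ → ℤ
        φ α = - (+ 1) * (M * s * α ^ w + Pβ) + inner α
        each : ∀ α → Null (φ α)
        each α = null-resp (trans (alg₁ (inner α) M ((- α) ^ w) Pβ)
            (cong (λ z → - (+ 1) * (z + Pβ) + inner α) (trans (cong (M *_) (neg-^ α w)) (sym (ℤ.*-assoc M s (α ^ w))))))
          (sumOver-shifted βs w (powerSums-vanish βs w λ j 0<j j<w → proj₂ (below j 0<j j<w)) 0<w α)
          where
          alg₁ : ∀ x M z P → x - (M * z + P) ≡ - (+ 1) * (M * z + P) + x
          alg₁ = solve-∀
        sumEq : sumOver αs φ ≡ - (+ 1) * (M * s * Pα + N * Pβ) + S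
        sumEq = trans (sumOver-linear αs (- (+ 1)) (λ α → M * s * α ^ w + Pβ) inner)
          (cong (λ z → - (+ 1) * z + S) (trans (sumOver-linear αs (M * s) (_^ w) (λ _ → Pβ))
            (+-congʳ (M * s * Pα) (sumOver-const αs Pβ))))
        alg : ∀ x S → x ≡ - (+ 1) * (- (+ 1) * x + S) + + 1 * S
        alg = solve-∀

      relationS : Null (M * s * a + N * b)
      relationS = null-cancel W (¬null-≤d w 0<w w≤d)
        (null₃ (- (+ 1)) (M * s) N powerSums
          (newton-lowest αs w 0<w λ j 0<j j<w → proj₁ (below j 0<j j<w))
          (newton-lowest βs w 0<w λ j 0<j j<w → proj₂ (below j 0<j j<w))
          (alg W M s N a b Pα Pβ))
        where
        alg : ∀ W M s N a b P Q → W * (M * s * a + N * b) ≡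
          - (+ 1) * (M * s * P + N * Q) + M * s * (W * a + P) + N * (W * b + Q)
        alg = solve-∀

      -- The quadratic identity in total weight `w`: all products of two lower coefficients vanish
      -- by `below`. With `d = mn` substituted, a factor `w` splits off.
      relationZ : Null (M * a * X + N * b * Y)
      relationZ = null-cancel W (¬null-≤d w 0<w w≤d)
        (null-resp (trans (cong₂ (λ N M → kernelSum N M (M * N)) (sym N≡) (sym M≡))
            (trans (alg (+ u) (+ v) W a b) (cong₂ target N≡ M≡)))
          (null-resp (cong (kernelSum N M) d≡)
            (linearPart (λ i j → quadraticKernel N M (+ d) (+ i) (+ j)) αs βs u v w 0<w u+w v+w
              (λ x y 0<x 0<y x+y → null-*ʳ (proj₁ (below x 0<x (subst (x ℕ.<_) x+y (ℕ.m<m+n x 0<y)))) (top βs y))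
              (quadratic-relation cfg (u ℕ.+ m) (ℕ.≤-trans sizeʳ (ℕ.m≤n+m m u))))))
        where
        N≡ : + u + W ≡ N
        N≡ = cong +_ u+w
        M≡ : + v + W ≡ M
        M≡ = cong +_ v+w
        kernelSum : ℤ → ℤ → ℤ → ℤ
        kernelSum N M δ = quadraticKernel N M δ (+ u) M * a + quadraticKernel N M δ N (+ v) * b
        target : ℤ → ℤ → ℤ
        target N M = W * (M * a * ((M + + 1) * (W + + 1) - + 2 * (N + + 1)) + N * b * ((N + + 1) * (W + + 1) - + 2 * (M + + 1)))
        alg : ∀ U V W a b →
          ((U + W) * (U + W + + 1) * ((V + W) * (V + W - + 1)) - + 2 * ((V + W) * (U + W) - + 1) * (U * (V + W))
            + (V + W) * (V + W + + 1) * (U * (U - + 1))) * a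
          + ((U + W) * (U + W + + 1) * (V * (V - + 1)) - + 2 * ((V + W) * (U + W) - + 1) * ((U + W) * V)
            + (V + W) * (V + W + + 1) * ((U + W) * (U + W - + 1))) * b ≡
          W * ((V + W) * a * ((V + W + + 1) * (W + + 1) - + 2 * (U + W + + 1))
            + (U + W) * b * ((U + W + + 1) * (W + + 1) - + 2 * (V + W + + 1)))
        alg = solve-∀

      eliminated : Null (M * ((X - s * Y) * a))
      eliminated = null₂ (+ 1) (- Y) relationZ relationS (alg M s N a b X Y)
        where
        alg : ∀ M s N a b X Y → M * ((X - s * Y) * a) ≡ + 1 * (M * a * X + N * b * Y) + - Y * (M * s * a + N * b)
        alg = solve-∀

      -- For `s = 1` the expression is `(M − N)(W + 3)`, for `s = −1` it is `(W − 1)(M + N + 2)`.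
      -- All four factors are positive and at most `2d`. The factor `W − 1` is the reason why weight
      -- one is settled by centring instead.
      ¬null-factor : 1 ℕ.< w → ¬ Null (X - s * Y)
      ¬null-factor 1<w with sign-cases w
      ... | inj₁ eq = λ h → ¬null-* (¬null-≤d r 0<r (ℕ.≤-trans (ℕ.m≤n+m r n) (ℕ.≤-trans (ℕ.≤-reflexive n+r) (ℕ.<⇒≤ m<d))))
          (¬null-small (w ℕ.+ 3) (ℕ.≤-trans (s≤s z≤n) (ℕ.m≤n+m 3 w))
            (ℕ.≤-<-trans (ℕ.+-mono-≤ w≤d 3≤d) small))
          (null-resp (trans (cong (λ s → X - s * Y) eq) (trans (cong (λ M → X′ M - + 1 * Y′ M) (sym M≡)) (alg N (+ r) W))) h)
        where
        r = proj₁ (ℕ.m≤n⇒∃[o]m+o≡n (ℕ.<⇒≤ n<m))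
        n+r : n ℕ.+ r ≡ m
        n+r = proj₂ (ℕ.m≤n⇒∃[o]m+o≡n (ℕ.<⇒≤ n<m))
        0<r : 0 ℕ.< r
        0<r = ℕ.n≢0⇒n>0 λ { r≡0 → ℕ.<⇒≢ n<m (trans (sym (ℕ.+-identityʳ n)) (trans (cong (n ℕ.+_) (sym r≡0)) n+r)) }
        M≡ : N + + r ≡ M
        M≡ = cong +_ n+r
        3≤d : 3 ℕ.≤ d
        3≤d = ℕ.≤-trans (s≤s sizeˡ) (ℕ.≤-trans n<m (ℕ.<⇒≤ m<d))
        X′ Y′ : ℤ → ℤ
        X′ M = (M + + 1) * (W + + 1) - + 2 * (N + + 1)
        Y′ M = (N + + 1) * (W + + 1) - + 2 * (M + + 1)
        alg : ∀ N R W → (N + R + + 1) * (W + + 1) - + 2 * (N + + 1) - + 1 * ((N + + 1) * (W + + 1) - + 2 * (N + R + + 1)) ≡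
          R * (W + + 3)
        alg = solve-∀
      ... | inj₂ eq with ℕ.m≤n⇒∃[o]m+o≡n 1<w
      ...   | o , 2+o = λ h → ¬null-* (¬null-≤d (suc o) (s≤s z≤n) (ℕ.≤-trans (ℕ.≤-trans (ℕ.n≤1+n _) (ℕ.≤-reflexive 2+o)) w≤d))
          (¬null-small (m ℕ.+ n ℕ.+ 2) (ℕ.≤-trans (s≤s z≤n) (ℕ.m≤n+m 2 (m ℕ.+ n)))
            (ℕ.≤-<-trans (ℕ.≤-trans (ℕ.≤-reflexive (ℕ.+-assoc m n 2)) (ℕ.+-mono-≤ (ℕ.<⇒≤ m<d) n+2≤d)) small))
          (null-resp (trans (cong (λ s → X - s * Y) eq) (trans (cong (λ W → X′ W - - (+ 1) * Y′ W) (sym W≡)) (alg N M (+ o)))) h)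
        where
        W≡ : + 2 + + o ≡ W
        W≡ = cong +_ 2+o
        n+2≤d : n ℕ.+ 2 ℕ.≤ d
        n+2≤d = ℕ.≤-trans (ℕ.≤-reflexive (ℕ.+-comm n 2)) (ℕ.≤-trans (s≤s n<m) m<d)
        X′ Y′ : ℤ → ℤ
        X′ W = (M + + 1) * (W + + 1) - + 2 * (N + + 1)
        Y′ W = (N + + 1) * (W + + 1) - + 2 * (M + + 1)
        alg : ∀ N M O → (M + + 1) * (+ 2 + O + + 1) - + 2 * (N + + 1) - - (+ 1) * ((N + + 1) * (+ 2 + O + + 1) - + 2 * (M + + 1)) ≡
          (+ 1 + O) * (M + N + + 2)
        alg = solve-∀

      a-null : Null a
      a-null with ℕ.m≤n⇒m<n∨m≡n 0<w
      ... | inj₁ 1<w  = null-cancel (X - s * Y) (¬null-factor 1<w)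
        (null-cancel M (¬null-≤d m (ℕ.<-trans (s≤s z≤n) sizeʳ) (ℕ.<⇒≤ m<d)) eliminated)
      ... | inj₂ refl = centred

      b-null : Null b
      b-null = null-cancel N (¬null-≤d n (ℕ.<-trans (s≤s z≤n) sizeˡ) (ℕ.≤-trans (ℕ.<⇒≤ n<m) (ℕ.<⇒≤ m<d)))
        (null₂ (+ 1) (- (M * s)) relationS a-null (alg (M * s) N a b))
        where
        alg : ∀ x N a b → N * b ≡ + 1 * (x * a + N * b) + - x * a
        alg = solve-∀

    vanishing : ∀ w → 0 ℕ.< w → w ℕ.≤ n → Vanishing w
    vanishing = <-rec (λ w → 0 ℕ.< w → w ℕ.≤ n → Vanishing w) λ w rec 0<w w≤n →
      let below = λ j 0<j j<w → rec j<w 0<j (ℕ.≤-trans (ℕ.<⇒≤ j<w) w≤n) in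
      Step.a-null w 0<w w≤n below , Step.b-null w 0<w w≤n below

    contradiction : ⊥
    contradiction = tops-vanish⇒⊥ αs distinctˡ sizeˡ λ w 0<w w≤n → proj₁ (vanishing w 0<w w≤n)

  -- Summands of equal size

  -- At weight `W` the cubic identity amounts to `−WN` times this number times `a − b`. As a
  -- polynomial in `W` it has leading coefficient `3N² + 4N − 1` and linear coefficient `3 − 9N²`;
  -- its values at `1` and `2` are `−12N(N − 1)` and `−12N(N − 2)`.
  weightFactor : ℤ → ℤ → ℤ
  weightFactor N W =
    + 3 * N * N * (W * W - + 3 * W - + 2) + + 4 * N * (W * W + + 2) - (W - + 1) * (W - + 2)

  module Equal {d αs βs} (cfg : Config d αs βs) (n : ℕ) (αs-length : length αs ≡ n) (βs-length : length βs ≡ n)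
    (3≤n : 3 ℕ.≤ n) (bound : 14 ℕ.* (n ℕ.* n ℕ.* n) ℕ.< p) where

    open Config cfg

    private
      N = + n
      q = coeff (fromRoots αs)
      g = coeff (fromRoots βs)

      1≤n : 1 ℕ.≤ n
      1≤n = ℕ.≤-trans (s≤s z≤n) 3≤n

      d≡ : + d ≡ N * N
      d≡ = trans (cong +_ (trans (sym full) (cong₂ ℕ._*_ βs-length αs-length))) (ℤ.pos-* n n)

      n≤n³ : n ℕ.≤ n ℕ.* n ℕ.* n
      n≤n³ = ℕ.m≤n*m n (n ℕ.* n) {{ℕ.>-nonZero (ℕ.*-mono-≤ 1≤n 1≤n)}}

      ¬null-≤4n : ∀ k → 0 ℕ.< k → k ℕ.≤ 14 ℕ.* n → ¬ Null (+ k)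
      ¬null-≤4n k 0<k k≤ = ¬null-small k 0<k (ℕ.≤-<-trans k≤ (ℕ.≤-<-trans (ℕ.*-monoʳ-≤ 14 n≤n³) bound))

      n≤14n : n ℕ.≤ 14 ℕ.* n
      n≤14n = ℕ.m≤n*m n 14

      ¬null-≤n : ∀ k → 0 ℕ.< k → k ℕ.≤ n → ¬ Null (+ k)
      ¬null-≤n k 0<k k≤n = ¬null-≤4n k 0<k (ℕ.≤-trans k≤n n≤14n)

      ¬null-N : ¬ Null N
      ¬null-N = ¬null-≤n n 1≤n ℕ.≤-refl

      ¬null-N+1 : ¬ Null (N + + 1)
      ¬null-N+1 = ¬null-≤4n (n ℕ.+ 1) (ℕ.m≤n+m 1 n) (ℕ.≤-trans (ℕ.+-monoʳ-≤ n 1≤n) (ℕ.+-monoʳ-≤ n (ℕ.m≤m+n n _)))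

      ¬null-two : ¬ Null (+ 2)
      ¬null-two = ¬null-≤n 2 (s≤s z≤n) (ℕ.≤-trans (ℕ.n≤1+n 2) 3≤n)

      ¬null-12 : ¬ Null (+ 12)
      ¬null-12 = ¬null-≤4n 12 (s≤s z≤n) (ℕ.≤-trans (ℕ.m≤m+n 12 2) (ℕ.*-monoʳ-≤ 14 1≤n))

      ¬null-pred : ∀ i k → 0 ℕ.< k → i ℕ.+ k ℕ.≤ n → ¬ Null (+ (i ℕ.+ k) - + i)
      ¬null-pred i k 0<k le h = ¬null-≤n k 0<k (ℕ.≤-trans (ℕ.m≤n+m k i) le) (null-resp (alg (+ i) (+ k)) h)
        where
        alg : ∀ i k → i + k - i ≡ k
        alg = solve-∀

      n₀ = proj₁ (ℕ.m≤n⇒∃[o]m+o≡n 3≤n)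
      n≡ : 3 ℕ.+ n₀ ≡ n
      n≡ = proj₂ (ℕ.m≤n⇒∃[o]m+o≡n 3≤n)

      N≡ : + 3 + + n₀ ≡ N
      N≡ = cong +_ n≡

      -- 3n² + 4n − 1 for n = 3 + n₀
      leading : ℕ
      leading = 3 ℕ.* n₀ ℕ.* n₀ ℕ.+ 22 ℕ.* n₀ ℕ.+ 38

      leading≡ : + leading ≡ + 3 * N * N + + 4 * N - + 1
      leading≡ = trans (cast n₀) (trans (alg (+ n₀)) (cong (λ N → + 3 * N * N + + 4 * N - + 1) N≡))
        where
        cast : ∀ k → + (3 ℕ.* k ℕ.* k ℕ.+ 22 ℕ.* k ℕ.+ 38) ≡ + 3 * + k * + k + + 22 * + k + + 38
        cast k = cong (_+ + 38) (cong₂ _+_ (trans (ℤ.pos-* (3 ℕ.* k) k) (cong (_* + k) (ℤ.pos-* 3 k))) (ℤ.pos-* 22 k))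
        alg : ∀ k → + 3 * k * k + + 22 * k + + 38 ≡ + 3 * (+ 3 + k) * (+ 3 + k) + + 4 * (+ 3 + k) - + 1
        alg = solve-∀

      ¬null-leading : ¬ Null (+ 3 * N * N + + 4 * N - + 1)
      ¬null-leading h = ¬null-small leading (ℕ.≤-trans (s≤s z≤n) (ℕ.m≤n+m 38 _)) (ℕ.≤-<-trans le bound)
        (null-resp (sym leading≡) h)
        where
        -- With `n = 3 + n₀` the gap between the two sides of the inequality is a polynomial in `n₀`
        -- with nonnegative coefficients, so it can be written down as a natural number.
        alg : ∀ k → 3 ℕ.* k ℕ.* k ℕ.+ 22 ℕ.* k ℕ.+ 38 ℕ.+ (14 ℕ.* k ℕ.* k ℕ.* k ℕ.+ 123 ℕ.* k ℕ.* k ℕ.+ 356 ℕ.* k ℕ.+ 340)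
          ≡ 14 ℕ.* ((3 ℕ.+ k) ℕ.* (3 ℕ.+ k) ℕ.* (3 ℕ.+ k))
        alg = ℕ-Solver.solve-∀
        le : leading ℕ.≤ 14 ℕ.* (n ℕ.* n ℕ.* n)
        le = subst (λ n → leading ℕ.≤ 14 ℕ.* (n ℕ.* n ℕ.* n)) n≡
          (ℕ.≤-trans (ℕ.m≤m+n leading _) (ℕ.≤-reflexive (alg n₀)))

      -- weightFactor N is quadratic, and this expression vanishes when 3 + r is the sum of its roots.
      ¬null-rootSum : ∀ r → 3 ℕ.+ r ℕ.≤ n ℕ.+ n →
        ¬ Null ((+ 3 * N * N + + 4 * N - + 1) * (+ 3 + + r) - + 9 * N * N + + 3)
      ¬null-rootSum r le h = ¬null-small e 0<e (ℕ.≤-<-trans e≤ bound) (null-resp (sym e≡) h)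
        where
        e = 12 ℕ.* n ℕ.+ leading ℕ.* r
        0<e : 0 ℕ.< e
        0<e = ℕ.≤-trans (ℕ.*-mono-≤ {1} {12} (s≤s z≤n) 1≤n) (ℕ.m≤m+n (12 ℕ.* n) _)
        e≡ : + e ≡ (+ 3 * N * N + + 4 * N - + 1) * (+ 3 + + r) - + 9 * N * N + + 3
        e≡ = trans (cong₂ _+_ (ℤ.pos-* 12 n) (trans (ℤ.pos-* leading r) (cong (_* + r) leading≡))) (alg N (+ r))
          where
          alg : ∀ N R → + 12 * N + (+ 3 * N * N + + 4 * N - + 1) * R ≡
            (+ 3 * N * N + + 4 * N - + 1) * (+ 3 + R) - + 9 * N * N + + 3
          alg = solve-∀
        e≤ : e ℕ.≤ 14 ℕ.* (n ℕ.* n ℕ.* n)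
        e≤ with ℕ.m≤n⇒∃[o]m+o≡n le
        ... | o , 3+r+o = ℕ.≤-trans (ℕ.m≤m+n e (leading ℕ.* o))
          (ℕ.≤-trans (ℕ.≤-reflexive (trans (alg₁ n leading r o)
              (trans (cong (λ s → 12 ℕ.* n ℕ.+ leading ℕ.* s) r+o) (cong (λ n → 12 ℕ.* n ℕ.+ leading ℕ.* (3 ℕ.+ 2 ℕ.* n₀)) (sym n≡)))))
            (subst (λ n → 12 ℕ.* (3 ℕ.+ n₀) ℕ.+ leading ℕ.* (3 ℕ.+ 2 ℕ.* n₀) ℕ.≤ 14 ℕ.* (n ℕ.* n ℕ.* n)) n≡
              (ℕ.≤-trans (ℕ.m≤m+n _ _) (ℕ.≤-reflexive (alg₂ n₀)))))
          where
          alg₁ : ∀ n l r o → 12 ℕ.* n ℕ.+ l ℕ.* r ℕ.+ l ℕ.* o ≡ 12 ℕ.* n ℕ.+ l ℕ.* (r ℕ.+ o)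
          alg₁ = ℕ-Solver.solve-∀
          r+o : r ℕ.+ o ≡ 3 ℕ.+ 2 ℕ.* n₀
          r+o = ℕ.+-cancelˡ-≡ 3 _ _ (trans 3+r+o (trans (cong₂ ℕ._+_ (sym n≡) (sym n≡)) (alg₃ n₀)))
            where
            alg₃ : ∀ k → 3 ℕ.+ k ℕ.+ (3 ℕ.+ k) ≡ 3 ℕ.+ (3 ℕ.+ 2 ℕ.* k)
            alg₃ = ℕ-Solver.solve-∀
          alg₂ : ∀ k → 12 ℕ.* (3 ℕ.+ k) ℕ.+ (3 ℕ.* k ℕ.* k ℕ.+ 22 ℕ.* k ℕ.+ 38) ℕ.* (3 ℕ.+ 2 ℕ.* k)
              ℕ.+ (8 ℕ.* k ℕ.* k ℕ.* k ℕ.+ 73 ℕ.* k ℕ.* k ℕ.+ 224 ℕ.* k ℕ.+ 228)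
            ≡ 14 ℕ.* ((3 ℕ.+ k) ℕ.* (3 ℕ.+ k) ℕ.* (3 ℕ.+ k))
          alg₂ = ℕ-Solver.solve-∀

    Vanishing : ℕ → Set
    Vanishing w = Null (top αs w) × Null (top βs w)

    module Weight (w u : ℕ) (0<w : 0 ℕ.< w) (u+w : u ℕ.+ w ≡ n)
      (middle : ∀ x y → 0 ℕ.< x → 0 ℕ.< y → x ℕ.+ y ≡ w → Null (top αs x * top βs y)) where

      private
        a = top αs w
        b = top βs w
        W = + w
        U≡ : + u + W ≡ N
        U≡ = cong +_ u+w
        w≤n : w ℕ.≤ n
        w≤n = ℕ.≤-trans (ℕ.m≤n+m w u) (ℕ.≤-reflexive u+w)
        linear : ∀ K → Null (antidiag (λ i j → K i j * (q i * g j)) (u ℕ.+ n)) → Null (K u n * a + K n u * b)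
        linear K h = subst₂ (λ i j → Null (K u j * a + K i u * b)) αs-length βs-length
          (linearPart K αs βs u u w 0<w (trans u+w (sym αs-length)) (trans u+w (sym βs-length)) middle
            (subst (λ j → Null (antidiag (λ i j → K i j * (q i * g j)) (u ℕ.+ j))) (sym βs-length) h))

      -- For `n = m` and `d = n²` the quadratic kernel is symmetric, so it sees only `a + b`, with a
      -- factor `W − 1` that excludes weight one.
      quadraticPart : 1 ℕ.< w → Null (a + b)
      quadraticPart 1<w with ℕ.m≤n⇒∃[o]m+o≡n 1<w
      ... | o , 2+o = null-cancel (W * N * (N + + 1) * (W - + 1))
        (¬null-* (¬null-* (¬null-* (¬null-≤n w 0<w w≤n) ¬null-N) ¬null-N+1)
          (subst (λ w → ¬ Null (+ w - + 1)) 2+o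
            (¬null-pred 1 (suc o) (s≤s z≤n) (ℕ.≤-trans (ℕ.≤-reflexive 2+o) w≤n))))
        (null-resp (trans (cong (λ N → quadraticKernel N N (N * N) (+ u) N * a + quadraticKernel N N (N * N) N (+ u) * b) (sym U≡))
            (trans (alg (+ u) W a b) (cong (λ N → W * N * (N + + 1) * (W - + 1) * (a + b)) U≡)))
          (linear (λ i j → quadraticKernel N N (N * N) (+ i) (+ j))
            (subst₂ (λ M δ → Null (antidiag (λ i j → quadraticKernel N M δ (+ i) (+ j) * (q i * g j)) (u ℕ.+ n)))
              (cong +_ βs-length) d≡
              (subst (λ M → Null (antidiag (λ i j → quadraticKernel M (+ length βs) (+ d) (+ i) (+ j) * (q i * g j)) (u ℕ.+ n)))
                (cong +_ αs-length)
                (quadratic-relation cfg (u ℕ.+ n) (ℕ.≤-trans (ℕ.≤-trans (ℕ.n≤1+n 2) 3≤n) (ℕ.m≤n+m n u)))))))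
        where
        alg : ∀ U W a b →
          ((U + W) * (U + W + + 1) * ((U + W) * (U + W - + 1)) - + 2 * ((U + W) * (U + W) - + 1) * (U * (U + W))
            + (U + W) * (U + W + + 1) * (U * (U - + 1))) * a
          + ((U + W) * (U + W + + 1) * (U * (U - + 1)) - + 2 * ((U + W) * (U + W) - + 1) * ((U + W) * U)
            + (U + W) * (U + W + + 1) * ((U + W) * (U + W - + 1))) * b ≡
          W * (U + W) * (U + W + + 1) * (W - + 1) * (a + b)
        alg = solve-∀

      cubicPart : Null (weightFactor N W * (a - b))
      cubicPart = null-cancel (- (W * N)) (λ h → ¬null-* (¬null-≤n w 0<w w≤n) ¬null-N (null₁ (- (+ 1)) h (alg′ W N)))
        (null-resp (trans (cong (λ N → cubicKernel N (+ u) N * a + cubicKernel N N (+ u) * b) (sym U≡))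
            (trans (alg (+ u) W a b) (cong (λ N → - (W * N) * (weightFactor N W * (a - b))) U≡)))
          (linear (λ i j → cubicKernel N (+ i) (+ j))
            (cubic-relation n cfg αs-length βs-length (u ℕ.+ n) (ℕ.≤-trans 3≤n (ℕ.m≤n+m n u)))))
        where
        alg′ : ∀ W N → W * N ≡ - (+ 1) * - (W * N)
        alg′ = solve-∀
        alg : ∀ U W a b →
          ((U + W) * (+ 3 * (U + W) * (U + W) + + 4 * (U + W) - + 1)
              * (U * (U - + 1) * (U - + 2) - (U + W) * (U + W - + 1) * (U + W - + 2))
            + - (+ 3 * (+ 3 * (U + W) * (U + W) * (U + W) - + 2 * (U + W) * (U + W) - + 5 * (U + W) + + 2))
              * (U * (U - + 1) * (U + W) - U * ((U + W) * (U + W - + 1)))) * a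
          + ((U + W) * (+ 3 * (U + W) * (U + W) + + 4 * (U + W) - + 1)
              * ((U + W) * (U + W - + 1) * (U + W - + 2) - U * (U - + 1) * (U - + 2))
            + - (+ 3 * (+ 3 * (U + W) * (U + W) * (U + W) - + 2 * (U + W) * (U + W) - + 5 * (U + W) + + 2))
              * ((U + W) * (U + W - + 1) * U - (U + W) * (U * (U - + 1)))) * b ≡
          - (W * (U + W)) * ((+ 3 * (U + W) * (U + W) * (W * W - + 3 * W - + 2)
            + + 4 * (U + W) * (W * W + + 2) - (W - + 1) * (W - + 2)) * (a - b))
        alg = solve-∀

      both-null : 1 ℕ.< w → ¬ Null (weightFactor N W) → Vanishing w
      both-null 1<w ¬F = null-cancel (+ 2) ¬null-two (null₂ (+ 1) (+ 1) (quadraticPart 1<w) diff (alg₁ a b)) ,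
                         null-cancel (+ 2) ¬null-two (null₂ (+ 1) (- (+ 1)) (quadraticPart 1<w) diff (alg₂ a b))
        where
        diff : Null (a - b)
        diff = null-cancel (weightFactor N W) ¬F cubicPart
        alg₁ : ∀ a b → + 2 * a ≡ + 1 * (a + b) + + 1 * (a - b)
        alg₁ = solve-∀
        alg₂ : ∀ a b → + 2 * b ≡ + 1 * (a + b) + - (+ 1) * (a - b)
        alg₂ = solve-∀

    module _ (centred : Null (top αs 1)) where

      -- Centring takes the place of the quadratic identity, which is empty at weight one, and the
      -- cubic identity still yields `a − b`.
      vanishing₁ : Vanishing 1
      vanishing₁ = centred , null₂ (- (+ 1)) (+ 1)
        (null-cancel (weightFactor N (+ 1)) ¬F (Weight.cubicPart 1 (2 ℕ.+ n₀) (s≤s z≤n) (trans (ℕ.+-comm (2 ℕ.+ n₀) 1) n≡) noMiddle))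
        centred (alg (top αs 1) (top βs 1))
        where
        alg : ∀ a b → b ≡ - (+ 1) * (a - b) + + 1 * a
        alg = solve-∀
        noMiddle : ∀ x y → 0 ℕ.< x → 0 ℕ.< y → x ℕ.+ y ≡ 1 → Null (top αs x * top βs y)
        noMiddle (suc zero)    (suc y) _ _ ()
        noMiddle (suc (suc x)) (suc y) _ _ ()
        ¬F : ¬ Null (weightFactor N (+ 1))
        ¬F h = ¬null-* ¬null-12 (¬null-* ¬null-N
            (subst (λ n → ¬ Null (+ n - + 1)) n≡ (¬null-pred 1 (2 ℕ.+ n₀) (s≤s z≤n) (ℕ.≤-reflexive n≡))))
          (null₁ (- (+ 1)) h (alg′ N))
          where
          alg′ : ∀ N → + 12 * (N * (N - + 1)) ≡ - (+ 1) *
            (+ 3 * N * N * (+ 1 * + 1 - + 3 * + 1 - + 2) + + 4 * N * (+ 1 * + 1 + + 2) - (+ 1 - + 1) * (+ 1 - + 2))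
          alg′ = solve-∀

      -- The value is `−12N(N − 2)`, invertible because `3 ≤ n`. Hence the first weight that does
      -- not vanish is at least three.
      ¬null-weightFactor₂ : ¬ Null (weightFactor N (+ 2))
      ¬null-weightFactor₂ h = ¬null-* ¬null-12 (¬null-* ¬null-N
          (subst (λ n → ¬ Null (+ n - + 2)) n≡ (¬null-pred 2 (1 ℕ.+ n₀) (s≤s z≤n) (ℕ.≤-reflexive n≡))))
        (null₁ (- (+ 1)) h (alg N))
        where
        alg : ∀ N → + 12 * (N * (N - + 2)) ≡ - (+ 1) *
          (+ 3 * N * N * (+ 2 * + 2 - + 3 * + 2 - + 2) + + 4 * N * (+ 2 * + 2 + + 2) - (+ 2 - + 1) * (+ 2 - + 2))
        alg = solve-∀

    -- Once `q₁, …, q_(j−1)` vanish, the antidiagonal `j` of both identities involves only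
    -- `x = q₀ g_j` and `y = q_j g₀`. The quadratic identity gives `x + y = 0` and the cubic one
    -- `y − x = 0`, so `q_j = 0`. The cubic identity starts at `j = 3`, so `q₁` and `q₂` have to be
    -- given. At `j = n` the leading coefficient `1` would vanish.
    bottom : Null (q 1) → Null (q 2) → ¬ Null (g 0) → ⊥
    bottom q₁ q₂ ¬g₀ = ¬null-1 (null-resp (trans (cong q (sym αs-length)) (taylor-fromRoots-lead (+ 0) αs))
      (q-null n 1≤n ℕ.≤-refl))
      where
      step : ∀ j → (∀ {i} → i ℕ.< j → 0 ℕ.< i → i ℕ.≤ n → Null (q i)) → 0 ℕ.< j → j ℕ.≤ n → Null (q j)
      step 1 rec _ _ = q₁
      step 2 rec _ _ = q₂
      step j@(suc (suc (suc j′))) rec _ j≤n = null-cancel (+ 2) ¬null-two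
        (null-cancel (g 0) ¬g₀ (null₂ (+ 1) (+ 1) sum difference (alg (q 0 * g j) (q j) (g 0))))
        where
        J = + j
        x = q 0 * g j
        y = q j * g 0
        alg : ∀ x u v → v * (+ 2 * u) ≡ + 1 * (x + u * v) + + 1 * (u * v - x)
        alg = solve-∀
        ¬null-J : ¬ Null J
        ¬null-J = ¬null-≤n j (s≤s z≤n) j≤n
        ¬null-J-1 : ¬ Null (J - + 1)
        ¬null-J-1 = ¬null-pred 1 (suc (suc j′)) (s≤s z≤n) j≤n
        ¬null-J-2 : ¬ Null (J - + 2)
        ¬null-J-2 = ¬null-pred 2 (suc j′) (s≤s z≤n) j≤n
        extremes : ∀ K → Null (antidiag (λ a b → K a b * (q a * g b)) j) → Null (K 0 j * x + K j 0 * y)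
        extremes K h = null₂ (+ 1) (- (+ 1)) h
          (antidiag-pair (λ a b → K a b * (q a * g b)) j 0 j j 0 (s≤s z≤n) refl (ℕ.+-identityʳ j) other)
          (alg₁ (antidiag (λ a b → K a b * (q a * g b)) j) (K 0 j * x + K j 0 * y))
          where
          alg₁ : ∀ s z → z ≡ + 1 * s + - (+ 1) * (s - z)
          alg₁ = solve-∀
          other : ∀ i i′ → i ℕ.+ i′ ≡ j → i ≢ 0 → i ≢ j → Null (K i i′ * (q i * g i′))
          other i i′ eq i≢0 i≢j = null-*ˡ (K i i′) (null-*ʳ (rec i<j (ℕ.n≢0⇒n>0 i≢0) (ℕ.≤-trans (ℕ.<⇒≤ i<j) j≤n)) (g i′))
            where
            i<j : i ℕ.< j
            i<j = ℕ.≤∧≢⇒< (ℕ.≤-trans (ℕ.m≤m+n i i′) (ℕ.≤-reflexive eq)) i≢j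
        sum : Null (x + y)
        sum = null-cancel (N * (N + + 1) * (J * (J - + 1)))
          (¬null-* (¬null-* ¬null-N ¬null-N+1) (¬null-* ¬null-J ¬null-J-1))
          (null-resp (alg₂ N (+ d) J x y)
            (extremes (λ i j → quadraticKernel N N (+ d) (+ i) (+ j))
              (subst₂ (λ n m → Null (antidiag (λ i j → quadraticKernel (+ n) (+ m) (+ d) (+ i) (+ j) * (q i * g j)) j))
                αs-length βs-length (quadratic-relation cfg j (s≤s (s≤s z≤n))))))
          where
          alg₂ : ∀ N δ J x y →
            (N * (N + + 1) * (J * (J - + 1)) - + 2 * (δ - + 1) * (+ 0 * J) + N * (N + + 1) * (+ 0 * (+ 0 - + 1))) * x
            + (N * (N + + 1) * (+ 0 * (+ 0 - + 1)) - + 2 * (δ - + 1) * (J * + 0) + N * (N + + 1) * (J * (J - + 1))) * y ≡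
            N * (N + + 1) * (J * (J - + 1)) * (x + y)
          alg₂ = solve-∀
        difference : Null (y - x)
        difference = null-cancel (cubicA N * (J * (J - + 1) * (J - + 2)))
          (¬null-* (¬null-* ¬null-N ¬null-leading) (¬null-* (¬null-* ¬null-J ¬null-J-1) ¬null-J-2))
          (null-resp (alg₃ (cubicA N) (cubicB N) J x y)
            (extremes (λ i j → cubicKernel N (+ i) (+ j))
              (cubic-relation n cfg αs-length βs-length j (s≤s (s≤s (s≤s z≤n))))))
          where
          alg₃ : ∀ A B J x y →
            (A * (+ 0 * (+ 0 - + 1) * (+ 0 - + 2) - J * (J - + 1) * (J - + 2))
              + B * (+ 0 * (+ 0 - + 1) * J - + 0 * (J * (J - + 1)))) * x
            + (A * (J * (J - + 1) * (J - + 2) - + 0 * (+ 0 - + 1) * (+ 0 - + 2))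
              + B * (J * (J - + 1) * + 0 - J * (+ 0 * (+ 0 - + 1)))) * y ≡
            A * (J * (J - + 1) * (J - + 2)) * (y - x)
          alg₃ = solve-∀
      q-null : ∀ j → 0 ℕ.< j → j ℕ.≤ n → Null (q j)
      q-null = <-rec (λ j → 0 ℕ.< j → j ℕ.≤ n → Null (q j)) step

    firstNonVanishing : ∀ w → (∀ j → 0 ℕ.< j → j ℕ.≤ w → Vanishing j) ⊎
      ∃ λ k → 0 ℕ.< k × k ℕ.≤ w × (∀ j → 0 ℕ.< j → j ℕ.< k → Vanishing j) × ¬ Vanishing k
    firstNonVanishing zero    = inj₁ λ j 0<j j≤0 → ⊥-elim (ℕ.<⇒≱ 0<j j≤0)
    firstNonVanishing (suc w) with firstNonVanishing w
    ... | inj₂ (k , 0<k , k≤w , h) = inj₂ (k , 0<k , ℕ.m≤n⇒m≤1+n k≤w , h)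
    ... | inj₁ h with null? (top αs (suc w)) ×-dec null? (top βs (suc w))
    ...   | yes v = inj₁ λ j 0<j j≤sw → go j 0<j (ℕ.m≤n⇒m<n∨m≡n j≤sw)
      where
      go : ∀ j → 0 ℕ.< j → j ℕ.< suc w ⊎ j ≡ suc w → Vanishing j
      go j 0<j (inj₁ (s≤s j≤w)) = h j 0<j j≤w
      go j 0<j (inj₂ refl)      = v
    ...   | no ¬v = inj₂ (suc w , s≤s z≤n , ℕ.≤-refl , (λ j 0<j j<sw → h j 0<j (ℕ.≤-pred j<sw)) , ¬v)

    coeff-vanishing : ∀ i w → i ℕ.+ w ≡ n → Vanishing w → Null (q i) × Null (g i)
    coeff-vanishing i w eq (a , b) =
      null-resp (sym (coeff-top αs i w (trans eq (sym αs-length)))) a ,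
      null-resp (sym (coeff-top βs i w (trans eq (sym βs-length)))) b

    complement : ∀ {w} → w ℕ.≤ n → ∃ λ u → u ℕ.+ w ≡ n
    complement {w} w≤n with ℕ.m≤n⇒∃[o]m+o≡n w≤n
    ... | u , w+u = u , trans (ℕ.+-comm u w) w+u

    module Sparse (centred : Null (top αs 1)) (k : ℕ) (0<k : 0 ℕ.< k) (k≤n : k ℕ.≤ n)
      (below : ∀ j → 0 ℕ.< j → j ℕ.< k → Vanishing j) (¬vanishing : ¬ Vanishing k) where

      1<k : 1 ℕ.< k
      1<k with ℕ.m≤n⇒m<n∨m≡n 0<k
      ... | inj₁ lt   = lt
      ... | inj₂ refl = ⊥-elim (¬vanishing (vanishing₁ centred))

      weightFactor-null : Null (weightFactor N (+ k))
      weightFactor-null with null? (weightFactor N (+ k))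
      ... | yes h = h
      ... | no ¬h = ⊥-elim (¬vanishing
        (Weight.both-null k (proj₁ (complement k≤n)) 0<k (proj₂ (complement k≤n))
          (λ x y 0<x 0<y x+y → null-*ʳ (proj₁ (below x 0<x (subst (x ℕ.<_) x+y (ℕ.m<m+n x 0<y)))) (top βs y))
          1<k ¬h))

      2<k : 2 ℕ.< k
      2<k with ℕ.m≤n⇒m<n∨m≡n 1<k
      ... | inj₁ lt   = lt
      ... | inj₂ refl = ⊥-elim (¬null-weightFactor₂ centred weightFactor-null)

      -- The values at `w` and `k` differ by `w − k` times the expression of `¬null-rootSum`, so a
      -- second root `w` would make `w + k` the sum of the roots modulo `p`. That expression is
      -- `12N` at `w + k = 3` and grows with `w + k`, so for `3 ≤ w + k ≤ 2n` it is a positive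
      -- integer below `p`.
      ¬null-weightFactor : ∀ w → w ℕ.≤ n → w ≢ k → ¬ Null (weightFactor N (+ w))
      ¬null-weightFactor w w≤n w≢k h = ¬null-* ¬null-difference ¬null-sum
        (null₂ (+ 1) (- (+ 1)) h weightFactor-null (alg N (+ w) (+ k)))
        where
        alg : ∀ N W K → (W - K) * ((+ 3 * N * N + + 4 * N - + 1) * (W + K) - + 9 * N * N + + 3) ≡
          + 1 * (+ 3 * N * N * (W * W - + 3 * W - + 2) + + 4 * N * (W * W + + 2) - (W - + 1) * (W - + 2)) +
          - (+ 1) * (+ 3 * N * N * (K * K - + 3 * K - + 2) + + 4 * N * (K * K + + 2) - (K - + 1) * (K - + 2))
        alg = solve-∀
        n<p : n ℕ.< p
        n<p = ℕ.≤-<-trans (ℕ.≤-trans n≤14n (ℕ.*-monoʳ-≤ 14 n≤n³)) bound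
        ¬null-difference : ¬ Null (+ w - + k)
        ¬null-difference h′ with ℕ.≤-total k w
        ... | inj₁ k≤w = w≢k (sym (null-small⇒≡ k≤w (ℕ.≤-<-trans w≤n n<p) h′))
        ... | inj₂ w≤k = w≢k (null-small⇒≡ w≤k (ℕ.≤-<-trans k≤n n<p) (null₁ (- (+ 1)) h′ (alg′ (+ w) (+ k))))
          where
          alg′ : ∀ w k → k - w ≡ - (+ 1) * (w - k)
          alg′ = solve-∀
        ¬null-sum : ¬ Null ((+ 3 * N * N + + 4 * N - + 1) * (+ w + + k) - + 9 * N * N + + 3)
        ¬null-sum with ℕ.m≤n⇒∃[o]m+o≡n (ℕ.≤-trans 2<k (ℕ.m≤n+m k w))
        ... | r , 3+r = subst (λ z → ¬ Null ((+ 3 * N * N + + 4 * N - + 1) * z - + 9 * N * N + + 3)) (cong +_ 3+r)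
          (¬null-rootSum r (ℕ.≤-trans (ℕ.≤-reflexive 3+r) (ℕ.+-mono-≤ w≤n k≤n)))

      -- If `k` does not divide `w = x + y`, it fails to divide `x` or `y`, so by induction every
      -- middle product has a vanishing factor and the two linear relations at weight `w` apply.
      sparse : ∀ w → 0 ℕ.< w → w ℕ.≤ n → ¬ (k ℕ.∣ w) → Vanishing w
      sparse = <-rec (λ w → 0 ℕ.< w → w ℕ.≤ n → ¬ (k ℕ.∣ w) → Vanishing w) step
        where
        step : ∀ w → (∀ {j} → j ℕ.< w → 0 ℕ.< j → j ℕ.≤ n → ¬ (k ℕ.∣ j) → Vanishing j) →
          0 ℕ.< w → w ℕ.≤ n → ¬ (k ℕ.∣ w) → Vanishing w
        step w rec 0<w w≤n k∤w with ℕ.m≤n⇒m<n∨m≡n 0<w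
        ... | inj₂ refl = vanishing₁ centred
        ... | inj₁ 1<w  = Weight.both-null w (proj₁ (complement w≤n)) 0<w (proj₂ (complement w≤n)) middle 1<w
          (¬null-weightFactor w w≤n λ { refl → k∤w ℕ.∣-refl })
          where
          middle : ∀ x y → 0 ℕ.< x → 0 ℕ.< y → x ℕ.+ y ≡ w → Null (top αs x * top βs y)
          middle x y 0<x 0<y x+y with k ℕ.∣? x | k ℕ.∣? y
          ... | no k∤x  | _       = null-*ʳ (proj₁ (rec x<w 0<x (ℕ.≤-trans (ℕ.<⇒≤ x<w) w≤n) k∤x)) (top βs y)
            where
            x<w : x ℕ.< w
            x<w = subst (x ℕ.<_) x+y (ℕ.m<m+n x 0<y)
          ... | yes _   | no k∤y  = null-*ˡ (top αs x) (proj₂ (rec y<w 0<y (ℕ.≤-trans (ℕ.<⇒≤ y<w) w≤n) k∤y))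
            where
            y<w : y ℕ.< w
            y<w = subst (y ℕ.<_) x+y (ℕ.m<n+m y 0<x)
          ... | yes k∣x | yes k∣y = ⊥-elim (k∤w (subst (k ℕ.∣_) x+y (ℕ.∣m∣n⇒∣m+n k∣x k∣y)))

      -- Index `i` has weight `n − i`. As `k` divides `n`, it divides this weight only if it divides
      -- `i`, which `0 < i < 3 ≤ k` excludes.
      low-coeff : k ℕ.∣ n → ∀ i → 0 ℕ.< i → i ℕ.< 3 → Null (q i) × Null (g i)
      low-coeff k∣n i 0<i i<3 with ℕ.m≤n⇒∃[o]m+o≡n (ℕ.≤-trans i<3 3≤n)
      ... | o , si+o = coeff-vanishing i (suc o) i+so (sparse (suc o) (s≤s z≤n)
          (ℕ.≤-trans (ℕ.m≤n+m (suc o) i) (ℕ.≤-reflexive i+so))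
          λ k∣so → ℕ.<⇒≱ (ℕ.<-≤-trans i<3 2<k) (ℕ.∣⇒≤ {{ℕ.>-nonZero 0<i}}
            (ℕ.∣m+n∣m⇒∣n (subst (k ℕ.∣_) (trans (sym i+so) (ℕ.+-comm i (suc o))) k∣n) k∣so)))
        where
        i+so : i ℕ.+ suc o ≡ n
        i+so = trans (ℕ.+-suc i o) si+o

  -- Reduction to a centred configuration

  square-cancel-< : ∀ {x y} → x ℕ.* x ℕ.< y ℕ.* y → x ℕ.< y
  square-cancel-< {x} {y} lt with x ℕ.<? y
  ... | yes x<y = x<y
  ... | no  x≮y = ⊥-elim (ℕ.<⇒≱ lt (ℕ.*-mono-≤ (ℕ.≮⇒≥ x≮y) (ℕ.≮⇒≥ x≮y)))

  equal⇒⊥ : ∀ {d αs βs} → Config d αs βs → ∀ n → length αs ≡ n → length βs ≡ n → 3 ℕ.≤ n →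
    14 ℕ.* (n ℕ.* n ℕ.* n) ℕ.< p → Null (top αs 1) → ⊥
  equal⇒⊥ {d} {αs} {βs} cfg n eqα eqβ 3≤n bound centred = [ none , some ]′ (firstNonVanishing n)
    where
    open Equal cfg n eqα eqβ 3≤n bound
    q = coeff (fromRoots αs)
    g = coeff (fromRoots βs)
    none : (∀ j → 0 ℕ.< j → j ℕ.≤ n → Vanishing j) → ⊥
    none h = tops-vanish⇒⊥ αs (Config.distinctˡ cfg) (Config.sizeˡ cfg)
      λ w 0<w w≤ → proj₁ (h w 0<w (subst (w ℕ.≤_) eqα w≤))
    some : (∃ λ k → 0 ℕ.< k × k ℕ.≤ n × (∀ j → 0 ℕ.< j → j ℕ.< k → Vanishing j) × ¬ Vanishing k) → ⊥
    some (k , 0<k , k≤n , below , ¬v) = go (k ℕ.∣? n) (null? (g 0)) (null? (q 0))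
      where
      open Sparse centred k 0<k k≤n below ¬v
      go : Dec (k ℕ.∣ n) → Dec (Null (g 0)) → Dec (Null (q 0)) → ⊥
      -- The constant terms have weight `n`, here not a multiple of `k`, so both polynomials vanish
      -- at zero.
      go (no k∤n)  _         _        = commonRoot cfg (proj₁ h) (proj₂ h)
        where
        h : Null (q 0) × Null (g 0)
        h = coeff-vanishing 0 n refl (sparse n (ℕ.≤-trans (s≤s z≤n) 3≤n) ℕ.≤-refl k∤n)
      go (yes k∣n) (yes g₀)  (yes q₀) = commonRoot cfg q₀ g₀
      go (yes k∣n) (no ¬g₀)  _        =
        bottom (proj₁ (low-coeff k∣n 1 (s≤s z≤n) (s≤s (s≤s z≤n)))) (proj₁ (low-coeff k∣n 2 (s≤s z≤n) ℕ.≤-refl)) ¬g₀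
      go (yes k∣n) (yes g₀)  (no ¬q₀) = Equal.bottom (swap cfg) n eqβ eqα 3≤n bound
        (proj₂ (low-coeff k∣n 1 (s≤s z≤n) (s≤s (s≤s z≤n)))) (proj₂ (low-coeff k∣n 2 (s≤s z≤n) ℕ.≤-refl)) ¬q₀

  sumOver-map : ∀ αs (f φ : ℤ → ℤ) → sumOver (map f αs) φ ≡ sumOver αs (φ ∘ f)
  sumOver-map []       f φ = refl
  sumOver-map (α ∷ αs) f φ = +-congʳ (φ (f α)) (sumOver-map αs f φ)

  module _ (t : ℤ) where

    translate : List ℤ → List ℤ
    translate = map (_+ t)

    translate-diff : ∀ x y → x + t - (y + t) ≡ x - y
    translate-diff x y = alg x y t
      where
      alg : ∀ x y t → x + t - (y + t) ≡ x - y
      alg = solve-∀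

    translate-distinct : ∀ {αs} → Distinct αs → Distinct (translate αs)
    translate-distinct dis = AllPairs.map⁺ (AllPairs.map (λ {x} {y} n h → n (null-resp (translate-diff x y) h)) dis)

    translate-config : ∀ {d αs βs} → Config d αs βs → Config d (translate αs) (translate βs)
    translate-config {d} {αs} {βs} cfg = record
      { distinctˡ = translate-distinct distinctˡ
      ; distinctʳ = translate-distinct distinctʳ
      ; ε         = ε
      ; ε≉0       = ε≉0
      ; powers    = All.map⁺ (All.map (λ {β} h → All.map⁺ (All.map (λ {α} →
                      null-resp (cong (λ z → z ^ d - ε) (sym (translate-diff β α)))) h)) powers)
      ; sizeˡ     = subst (2 ℕ.≤_) (sym (length-map (_+ t) αs)) sizeˡ
      ; sizeʳ     = subst (2 ℕ.≤_) (sym (length-map (_+ t) βs)) sizeʳ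
      ; full      = trans (cong₂ ℕ._*_ (length-map (_+ t) βs) (length-map (_+ t) αs)) full
      ; small     = small
      }
      where
      open Config cfg

    translate-powerSums : ∀ {d αs βs} → PowerSumsVanish d αs βs → PowerSumsVanish d (translate αs) (translate βs)
    translate-powerSums {d} {αs} {βs} h w 0<w w<d = null-resp (sym (trans
      (sumOver-map αs (_+ t) (λ α → sumOver (translate βs) (λ β → (β - α) ^ w)))
      (sumOver-cong αs λ α → trans (sumOver-map βs (_+ t) (λ β → (β - (α + t)) ^ w))
        (sumOver-cong βs λ β → cong (_^ w) (translate-diff β α))))) (h w 0<w w<d)

  -- Translation by minus the mean of `αs`, for which the number of points must be invertible.
  -- Newton's identity at weight one turns the vanishing sum into a vanishing coefficient.
  centre : ∀ αs → ¬ Null (+ length αs) → ∃ λ t → Null (top (translate t αs) 1)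
  centre αs ¬n with inverse (+ length αs) ¬n
  ... | v , hv = t , null₂ (+ 1) P (newton-lowest (translate t αs) 1 (s≤s z≤n) λ { (suc j) _ (s≤s ()) }) hv
        (trans (alg (top (translate t αs) 1) P (+ length αs) v)
          (cong (λ z → + 1 * (+ 1 * top (translate t αs) 1 + z) + P * (+ length αs * v - + 1)) (sym sumEq)))
    where
    P = powerSum αs 1
    t = - (P * v)
    sumEq : powerSum (translate t αs) 1 ≡ + 1 * P + + length αs * t
    sumEq = trans (sumOver-map αs (_+ t) (_^ 1)) (trans (sumOver-cong αs λ α → alg₁ α t)
      (trans (sumOver-linear αs (+ 1) (_^ 1) (λ _ → t)) (+-congʳ (+ 1 * P) (sumOver-const αs t))))
      where
      alg₁ : ∀ a t → (a + t) * + 1 ≡ + 1 * (a * + 1) + t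
      alg₁ = solve-∀
    alg : ∀ x P n v → x ≡ + 1 * (+ 1 * x + (+ 1 * P + n * - (P * v))) + P * (n * v - + 1)
    alg = solve-∀

  config⇒⊥ : ∀ {d αs βs} → Config d αs βs → length αs ℕ.≤ length βs → PowerSumsVanish d αs βs →
    9 ℕ.≤ d → d ℕ.* d ℕ.* d ℕ.* 196 ℕ.< p ℕ.* p → ⊥
  config⇒⊥ {d} {αs} {βs} cfg n≤m psums 9≤d bound =
    [ unequal , equal ]′ (ℕ.m≤n⇒m<n∨m≡n n≤m)
    where
    open Config cfg
    n = length αs
    n≤d : n ℕ.≤ d
    n≤d = subst (n ℕ.≤_) full (ℕ.m≤n*m n (length βs) {{ℕ.>-nonZero (ℕ.<-trans (s≤s z≤n) sizeʳ)}})
    ¬null-n : ¬ Null (+ n)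
    ¬null-n = ¬null-small n (ℕ.<-trans (s≤s z≤n) sizeˡ) (ℕ.≤-<-trans n≤d (ℕ.≤-<-trans (ℕ.m≤m+n d d) small))
    t : ℤ
    t = proj₁ (centre αs ¬null-n)
    centred : Null (top (translate t αs) 1)
    centred = proj₂ (centre αs ¬null-n)
    unequal : n ℕ.< length βs → ⊥
    unequal n<m = Unequal.contradiction (translate-config t cfg)
      (subst₂ ℕ._<_ (sym (length-map (_+ t) αs)) (sym (length-map (_+ t) βs)) n<m)
      (translate-powerSums t {d} {αs} {βs} psums) centred
    equal : n ≡ length βs → ⊥
    equal n≡m = equal⇒⊥ (translate-config t cfg) n (length-map (_+ t) αs)
      (trans (length-map (_+ t) βs) (sym n≡m)) 3≤n
      (subst (ℕ._< p) (ℕ.*-comm (n ℕ.* n ℕ.* n) 14) (square-cancel-< (ℕ.≤-<-trans (ℕ.≤-reflexive squareEq) bound))) centred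
      where
      d≡ : n ℕ.* n ≡ d
      d≡ = trans (cong (ℕ._* n) n≡m) full
      3≤n : 3 ℕ.≤ n
      3≤n = ℕ.≰⇒> λ n≤2 → ℕ.<⇒≱ (ℕ.≤-trans (ℕ.m≤m+n 5 4) 9≤d)
        (ℕ.≤-trans (ℕ.≤-reflexive (sym d≡)) (ℕ.*-mono-≤ n≤2 n≤2))
      -- With `d = n²` and `196 = 14²`, the number `196 d³` is the square of `14 n³`.
      squareEq : n ℕ.* n ℕ.* n ℕ.* 14 ℕ.* (n ℕ.* n ℕ.* n ℕ.* 14) ≡ d ℕ.* d ℕ.* d ℕ.* 196
      squareEq = trans (alg 14 n) (cong (λ d → d ℕ.* d ℕ.* d ℕ.* 196) d≡)
        where
        alg : ∀ c n → n ℕ.* n ℕ.* n ℕ.* c ℕ.* (n ℕ.* n ℕ.* n ℕ.* c) ≡ (n ℕ.* n) ℕ.* (n ℕ.* n) ℕ.* (n ℕ.* n) ℕ.* (c ℕ.* c)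
        alg = ℕ-Solver.solve-∀

  -- From a sumset decomposition of a subgroup to a configuration

  monic-agree : ∀ αs h rs → length rs ≡ length αs → Distinct rs →
    coeff h (length αs) ≡ + 1 → (∀ l → length αs ℕ.< l → coeff h l ≡ + 0) →
    All (λ r → Null (taylor r (fromRoots αs) 0)) rs → All (λ r → Null (taylor r h 0)) rs →
    ∀ y l → Null (taylor y (fromRoots αs) l - taylor y h l)
  monic-agree αs h rs len dis lead beyond hα hh y l = null-resp (taylor-f y l)
    (manyRoots⇒nullPoly 1 rs f dis
      (All.zipWith (λ { {r} (a , b) → λ
        { zero _ → null-resp (sym (taylor-f r 0))
            (null₂ (+ 1) (- (+ 1)) a b (alg (taylor r (fromRoots αs) 0) (taylor r h 0)))
        ; (suc l) (s≤s ()) } }) (hα , hh))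
      (λ l le → null-resp (sym (taylor-f (+ 0) l)) (high l (ℕ.≤-trans (ℕ.≤-reflexive (trans (sym len) (sym (ℕ.*-identityʳ _)))) le)))
      y l)
    where
    f : Poly
    f = add (fromRoots αs) (scale (- (+ 1)) h)
    alg : ∀ a b → a - b ≡ + 1 * a + - (+ 1) * b
    alg = solve-∀
    taylor-f : ∀ y l → taylor y f l ≡ taylor y (fromRoots αs) l - taylor y h l
    taylor-f y l = trans (taylor-add y (fromRoots αs) (scale (- (+ 1)) h) l)
      (trans (+-congʳ (taylor y (fromRoots αs) l) (taylor-scale y (- (+ 1)) h l)) (alg′ (taylor y (fromRoots αs) l) (taylor y h l)))
      where
      alg′ : ∀ a b → a + - (+ 1) * b ≡ a - b
      alg′ = solve-∀
    high : ∀ l → length αs ℕ.≤ l → Null (coeff (fromRoots αs) l - coeff h l)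
    high l le with ℕ.m≤n⇒m<n∨m≡n le
    ... | inj₁ lt   = null-≡0 (cong₂ _-_ (taylor-fromRoots-beyond (+ 0) αs l lt) (beyond l lt))
    ... | inj₂ refl = null-≡0 (cong₂ _-_ (taylor-fromRoots-lead (+ 0) αs) lead)

  unityPoly : ℕ → Poly
  unityPoly d = add (linPow (+ 0) d) (- (+ 1) ∷ [])

  taylor-unity-zero : ∀ y d → taylor y (unityPoly d) 0 ≡ y ^ d - + 1
  taylor-unity-zero y d = trans (taylor-add y (linPow (+ 0) d) (- (+ 1) ∷ []) 0)
    (cong₂ _+_ (trans (taylor-linPow y (+ 0) d 0) (trans (ℤ.*-identityˡ _) (cong (_^ d) (ℤ.+-identityʳ y)))) (alg y))
    where
    alg : ∀ y → - (+ 1) + y * + 0 ≡ - (+ 1)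
    alg = solve-∀

  coeff-unity : ∀ d l → coeff (unityPoly d) (suc l) ≡ coeff (linPow (+ 0) d) (suc l)
  coeff-unity d l = trans (taylor-add (+ 0) (linPow (+ 0) d) (- (+ 1) ∷ []) (suc l)) (ℤ.+-identityʳ _)

  coeff-unity-lead : ∀ d → 0 ℕ.< d → coeff (unityPoly d) d ≡ + 1
  coeff-unity-lead (suc d) _ = trans (coeff-unity (suc d) d)
    (trans (cong (coeff (linPow (+ 0) (suc d))) (sym (length-replicate (suc d))))
      (taylor-fromRoots-lead (+ 0) (replicate (suc d) (+ 0))))

  coeff-unity-beyond : ∀ d l → d ℕ.< l → coeff (unityPoly d) l ≡ + 0
  coeff-unity-beyond d (suc l) lt = trans (coeff-unity d l)
    (taylor-fromRoots-beyond (+ 0) (replicate d (+ 0)) (suc l) (subst (ℕ._< suc l) (sym (length-replicate d)) lt))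

  coeff-unity-middle : ∀ d i j → suc i ℕ.+ suc j ≡ d → coeff (unityPoly d) (suc i) ≡ + 0
  coeff-unity-middle d i j eq = trans (coeff-unity d i)
    (trans (coeff-top (replicate d (+ 0)) (suc i) (suc j) (trans eq (sym (length-replicate d)))) (top-zeros d j))

  unity-roots : ∀ d → 0 ℕ.< d → ∀ rs → Distinct rs → All (λ r → Null (r ^ d - + 1)) rs → length rs ℕ.≤ d
  unity-roots d 0<d rs dis h with length rs ℕ.≤? d
  ... | yes le  = le
  ... | no  nle = ⊥-elim (¬null-1 (null-resp (coeff-unity-lead d 0<d)
    (manyRoots⇒nullPoly 1 rs (unityPoly d) dis
      (All.map (λ {r} h → λ { zero _ → null-resp (sym (taylor-unity-zero r d)) h ; (suc l) (s≤s ()) }) h)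
      (λ l le → null-≡0 (coeff-unity-beyond d l
        (ℕ.<-≤-trans (ℕ.≰⇒> nle) (ℕ.≤-trans (ℕ.≤-reflexive (sym (ℕ.*-identityʳ _))) le))))
      (+ 0) d)))

  differences : List ℤ → List ℤ → List ℤ
  differences []       βs = []
  differences (α ∷ αs) βs = map (_- α) βs ++ differences αs βs

  length-differences : ∀ αs βs → length (differences αs βs) ≡ length αs ℕ.* length βs
  length-differences []       βs = refl
  length-differences (α ∷ αs) βs = trans (length-++ (map (_- α) βs))
    (cong₂ ℕ._+_ (length-map (_- α) βs) (length-differences αs βs))

  sumOver-++ : ∀ xs ys φ → sumOver (xs ++ ys) φ ≡ sumOver xs φ + sumOver ys φ
  sumOver-++ []       ys φ = sym (ℤ.+-identityˡ _)
  sumOver-++ (x ∷ xs) ys φ = trans (+-congʳ (φ x) (sumOver-++ xs ys φ)) (sym (ℤ.+-assoc (φ x) (sumOver xs φ) (sumOver ys φ)))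

  sumOver-differences : ∀ αs βs φ →
    sumOver (differences αs βs) φ ≡ sumOver αs (λ α → sumOver βs (λ β → φ (β - α)))
  sumOver-differences []       βs φ = refl
  sumOver-differences (α ∷ αs) βs φ = trans (sumOver-++ (map (_- α) βs) (differences αs βs) φ)
    (cong₂ _+_ (sumOver-map βs (_- α) φ) (sumOver-differences αs βs φ))

  record Group (γs : List ℤ) : Set where
    field
      distinct  : Distinct γs
      nonzero   : All (λ γ → ¬ Null γ) γs
      divisible : All (λ η → All (λ γ → Any (λ δ → Null (γ - η * δ)) γs) γs) γs

  module _ {γs} (G : Group γs) where
    open Group G

    private
      d = length γs

    -- Multiplication by `η` permutes the group, so the products of `x − γ` and of `x − ηγ` agree
    -- modulo `p`. Their constant terms differ by the factor `η^d` and are invertible.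
    group-power : All (λ η → Null (η ^ d - + 1)) γs
    group-power = All.map (λ {η} → go η) divisible
      where
      constant : ∀ η γs → coeff (fromRoots (map (η *_) γs)) 0 ≡ η ^ length γs * coeff (fromRoots γs) 0
      constant η []       = refl
      constant η (γ ∷ γs)
        rewrite taylor-fromRoots-zero (+ 0) (η * γ) (map (η *_) γs) | taylor-fromRoots-zero (+ 0) γ γs | constant η γs =
        alg η γ (η ^ length γs) (coeff (fromRoots γs) 0)
        where
        alg : ∀ η γ z c → (+ 0 - η * γ) * (z * c) ≡ η * z * ((+ 0 - γ) * c)
        alg = solve-∀
      ¬null-constant : ¬ Null (coeff (fromRoots γs) 0)
      ¬null-constant h = All.lookupWith (λ ¬γ h → ¬γ (null₁ (- (+ 1)) h (alg _))) nonzero (fromRoots-root⁻ (+ 0) γs h)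
        where
        alg : ∀ γ → γ ≡ - (+ 1) * (+ 0 - γ)
        alg = solve-∀
      go : ∀ η → All (λ γ → Any (λ δ → Null (γ - η * δ)) γs) γs → Null (η ^ d - + 1)
      go η div = null-cancel (coeff (fromRoots γs) 0) ¬null-constant
        (null₁ (- (+ 1)) (monic-agree γs (fromRoots ηγs) γs refl distinct
            (trans (cong (coeff (fromRoots ηγs)) (sym (length-map (η *_) γs))) (taylor-fromRoots-lead (+ 0) ηγs))
            (λ l lt → taylor-fromRoots-beyond (+ 0) ηγs l (subst (ℕ._< l) (sym (length-map (η *_) γs)) lt))
            (fromRoots-allRoots γs)
            (All.map (λ {γ} h → fromRoots-root γ ηγs (Any.map⁺ h)) div)
            (+ 0) 0)
          (trans (alg (η ^ d) (coeff (fromRoots γs) 0))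
            (cong (λ z → - (+ 1) * (coeff (fromRoots γs) 0 - z)) (sym (constant η γs)))))
        where
        ηγs = map (η *_) γs
        alg : ∀ z c → c * (z - + 1) ≡ - (+ 1) * (c - z * c)
        alg = solve-∀

  null-neg-diff : ∀ x y → Null (x - y) → Null (y - x)
  null-neg-diff x y h = null₁ (- (+ 1)) h (alg x y)
    where
    alg : ∀ x y → y - x ≡ - (+ 1) * (x - y)
    alg = solve-∀

  module _ {γs} (G : Group γs) (αs βs : List ℤ) (distinctα : Distinct αs) (distinctβ : Distinct βs)
    (2≤n : 2 ℕ.≤ length αs) (2≤m : 2 ℕ.≤ length βs) (n≤m : length αs ℕ.≤ length βs)
    (inside : All (λ β → All (λ α → Any (λ γ → Null (β - α - γ)) γs) αs) βs)
    (covered : All (λ γ → Any (λ s → Null (γ - s)) (differences αs βs)) γs)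
    (9≤d : 9 ℕ.≤ length γs)
    (bound : length γs ℕ.* length γs ℕ.* length γs ℕ.* 196 ℕ.< p ℕ.* p)
    where

    open Group G

    private
      d = length γs
      n = length αs
      m = length βs
      S = differences αs βs

      0<d : 0 ℕ.< d
      0<d = ℕ.≤-trans (s≤s z≤n) 9≤d

      small : d ℕ.+ d ℕ.< p
      -- The square of `2d` is `4d²`, at most `4d² · 49d = 196 d³ < p²`.
      small = square-cancel-< (ℕ.≤-<-trans (ℕ.≤-trans (ℕ.≤-reflexive (alg d))
        (ℕ.≤-trans (ℕ.m≤m*n (d ℕ.* d ℕ.* 4) (d ℕ.* 49) {{ℕ.>-nonZero (ℕ.≤-trans 0<d (ℕ.m≤m*n d 49))}})
          (ℕ.≤-reflexive (alg′ d 4 49)))) bound)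
        where
        alg : ∀ d → (d ℕ.+ d) ℕ.* (d ℕ.+ d) ≡ d ℕ.* d ℕ.* 4
        alg = ℕ-Solver.solve-∀
        alg′ : ∀ d a b → d ℕ.* d ℕ.* a ℕ.* (d ℕ.* b) ≡ d ℕ.* d ℕ.* d ℕ.* (a ℕ.* b)
        alg′ = ℕ-Solver.solve-∀

    difference-powers : All (λ β → All (λ α → Null ((β - α) ^ d - + 1)) αs) βs
    difference-powers = All.map (λ {β} → All.map λ {α} i → All.lookupWith (λ {γ} hγ h →
        null₂ (+ 1) (+ 1) (null-pow-cong d h) hγ (alg ((β - α) ^ d) (γ ^ d))) (group-power G) i) inside
      where
      alg : ∀ x y → x - + 1 ≡ + 1 * (x - y) + + 1 * (y - + 1)
      alg = solve-∀

    -- For a fixed `β` the differences `β − α` are incongruent roots of `x^d − 1`. This first bound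
    -- ensures `d + n − 1 < p`, which the sharper bound `m*n≤d` presupposes.
    n≤d : n ℕ.≤ d
    n≤d = go βs 2≤m difference-powers
      where
      go : ∀ βs → 2 ℕ.≤ length βs → All (λ β → All (λ α → Null ((β - α) ^ d - + 1)) αs) βs → n ℕ.≤ d
      go (β ∷ βs) _ (h ∷ _) = subst (ℕ._≤ d) (length-map (λ α → β - α) αs)
        (unity-roots d 0<d (map (λ α → β - α) αs)
          (AllPairs.map⁺ (AllPairs.map (λ {x} {y} ¬h h → ¬h (null₁ (- (+ 1)) h (alg β x y))) distinctα))
          (All.map⁺ h))
        where
        alg : ∀ b x y → x - y ≡ - (+ 1) * (b - x - (b - y))
        alg = solve-∀

    m*n≤d : m ℕ.* n ℕ.≤ d
    m*n≤d = go αs refl 2≤n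
      where
      go : ∀ αs₀ → αs₀ ≡ αs → 2 ℕ.≤ length αs₀ → m ℕ.* n ℕ.≤ d
      go (α ∷ α′ ∷ αs′) refl _ = go′ d refl
        where
        dd = dividedDifference α (α′ ∷ αs′) distinctα
        ws = proj₁ dd
        go′ : ∀ d₀ → d₀ ≡ d → m ℕ.* n ℕ.≤ d
        go′ zero     eq = ⊥-elim (ℕ.<⇒≢ 0<d eq)
        go′ (suc d′) eq = subst (m ℕ.* n ℕ.≤_) eq
          (HansonPetridis.bound (length αs′) ws (proj₂ (proj₂ dd)) (+ 1) ¬null-1 d′
            (ℕ.≤-<-trans (ℕ.+-mono-≤ (ℕ.≤-reflexive eq) (ℕ.≤-trans (ℕ.n≤1+n _) n≤d)) small)
            βs distinctβ
            (subst₂ (λ e l → All (λ β → All (λ α → Null ((β - α) ^ e - + 1)) l) βs)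
              (sym eq) (sym (proj₁ (proj₂ dd))) difference-powers))
      go (α ∷ []) eq (s≤s ())

    -- A pigeonhole argument by counting roots: the product of `x − s` over all differences `s` is
    -- monic of degree `nm` and vanishes on the group.
    d≤n*m : d ℕ.≤ n ℕ.* m
    d≤n*m with d ℕ.≤? n ℕ.* m
    ... | yes le  = le
    ... | no  nle = ⊥-elim (¬null-1 (null-resp (taylor-fromRoots-lead (+ 0) S)
      (manyRoots⇒nullPoly 1 γs (fromRoots S) distinct
        (All.map (λ {γ} h → λ { zero _ → fromRoots-root γ S h ; (suc l) (s≤s ()) }) covered)
        (λ l le → null-≡0 (taylor-fromRoots-beyond (+ 0) S l
          (ℕ.≤-<-trans (ℕ.≤-reflexive (length-differences αs βs)) (ℕ.<-≤-trans (ℕ.≰⇒> nle)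
            (ℕ.≤-trans (ℕ.≤-reflexive (sym (ℕ.*-identityʳ d))) le)))))
        (+ 0) (length S))))

    full : m ℕ.* n ≡ d
    full = ℕ.≤-antisym m*n≤d (ℕ.≤-trans d≤n*m (ℕ.≤-reflexive (ℕ.*-comm n m)))

    length-S : length S ≡ d
    length-S = trans (length-differences αs βs) (trans (ℕ.*-comm n m) full)

    -- There are exactly `d` differences, so their product polynomial and `x^d − 1` are both monic
    -- of degree `d` and share the `d` roots in the group. Hence they agree, and the middle
    -- coefficients vanish.
    differences-top : ∀ j → 0 ℕ.< j → j ℕ.< d → Null (top S j)
    differences-top (suc j) _ j<d with ℕ.m≤n⇒∃[o]m+o≡n j<d
    ... | o , ssj+o = null₂ (+ 1) (+ 1)
      (monic-agree S (unityPoly d) γs (sym length-S) distinct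
        (trans (cong (coeff (unityPoly d)) length-S) (coeff-unity-lead d 0<d))
        (λ l lt → coeff-unity-beyond d l (subst (ℕ._< l) length-S lt))
        (All.map (λ {γ} → fromRoots-root γ S) covered)
        (All.map (λ {γ} h → null-resp (sym (taylor-unity-zero γ d)) h) (group-power G))
        (+ 0) (suc o))
      null-0
      (trans (sym (coeff-top S (suc o) (suc j) (trans eq (sym length-S))))
        (trans (alg (coeff (fromRoots S) (suc o))) (cong (λ z → + 1 * (coeff (fromRoots S) (suc o) - z) + + 1 * + 0)
          (sym (coeff-unity-middle d o j eq)))))
      where
      eq : suc o ℕ.+ suc j ≡ d
      eq = trans (alg₁ o j) ssj+o
        where
        alg₁ : ∀ o j → suc o ℕ.+ suc j ≡ suc (suc j) ℕ.+ o
        alg₁ = ℕ-Solver.solve-∀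
      alg : ∀ x → x ≡ + 1 * (x - + 0) + + 1 * + 0
      alg = solve-∀

    sumset⇒⊥ : ⊥
    sumset⇒⊥ = config⇒⊥ config n≤m
      (λ w 0<w w<d → null-resp (sumOver-differences αs βs (_^ w)) (powerSums-vanish S d differences-top w 0<w w<d))
      9≤d bound
      where
      config : Config d αs βs
      config = record
        { distinctˡ = distinctα
        ; distinctʳ = distinctβ
        ; ε         = + 1
        ; ε≉0       = ¬null-1
        ; powers    = difference-powers
        ; sizeˡ     = 2≤n
        ; sizeʳ     = 2≤m
        ; full      = full
        ; small     = small
        }

open import Defs
open import Data.Bool using (true; false)
open import Data.Empty using (⊥; ⊥-elim)
open import Data.Fin as Fin using (Fin; toℕ; fromℕ<)
import Data.Fin.Properties as Fin
open import Data.Fin.Subset using (Subset; ∣_∣; _∈_)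
open import Data.Fin.Subset.Properties using (∣p∣≤n)
open import Data.Integer as ℤ using (ℤ; +_; -_)
import Data.Integer.Properties as ℤ
open import Data.Integer.Tactic.RingSolver using (solve-∀)
open import Data.List using (List; []; _∷_; map; length)
open import Data.List.Properties using (length-map)
open import Data.List.Relation.Unary.All as All using (All; []; _∷_)
import Data.List.Relation.Unary.All.Properties as All
open import Data.List.Relation.Unary.AllPairs as AllPairs using (AllPairs; []; _∷_)
import Data.List.Relation.Unary.AllPairs.Properties as AllPairs
open import Data.List.Relation.Unary.Any as Any using (Any; here; there)
import Data.List.Relation.Unary.Any.Properties as Any
open import Data.Nat as ℕ using (zero; suc; _+_; _*_; _<_; _≤_; _^_; z≤n; s≤s)
open import Data.Nat.DivMod using (_/_; m≡m%n+[m/n]*n; m%n<n)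
open import Data.Nat.Primality using (prime⇒nonZero; prime⇒nonTrivial)
import Data.Nat.Properties as ℕ
import Data.Nat.Tactic.RingSolver as ℕ-Solver
open import Data.Product using (∃; _,_; proj₁; proj₂)
open import Data.Sum using (inj₁; inj₂; [_,_]′)
open import Data.Vec using ([]; _∷_; here; there)
open import Function using (_∘_)
open import Relation.Binary.PropositionalEquality
open import Relation.Nullary using (¬_; yes; no)

-- Subsets of the residues as lists of integers

elements : ∀ {k} → Subset k → List (Fin k)
elements []          = []
elements (false ∷ s) = map Fin.suc (elements s)
elements (true ∷ s)  = Fin.zero ∷ map Fin.suc (elements s)

length-elements : ∀ {k} (s : Subset k) → length (elements s) ≡ ∣ s ∣
length-elements []          = refl
length-elements (false ∷ s) = trans (length-map Fin.suc (elements s)) (length-elements s)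
length-elements (true ∷ s)  = cong suc (trans (length-map Fin.suc (elements s)) (length-elements s))

elements-∈ : ∀ {k} (s : Subset k) → All (_∈ s) (elements s)
elements-∈ []          = []
elements-∈ (false ∷ s) = All.map⁺ (All.map there (elements-∈ s))
elements-∈ (true ∷ s)  = here ∷ All.map⁺ (All.map there (elements-∈ s))

∈-elements : ∀ {k} (s : Subset k) {x} → x ∈ s → Any (x ≡_) (elements s)
∈-elements (true ∷ s)  here       = here refl
∈-elements (false ∷ s) (there x∈) = Any.map⁺ (Any.map (cong Fin.suc) (∈-elements s x∈))
∈-elements (true ∷ s)  (there x∈) = there (Any.map⁺ (Any.map (cong Fin.suc) (∈-elements s x∈)))

elements-distinct : ∀ {k} (s : Subset k) → AllPairs _≢_ (elements s)
elements-distinct []          = []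
elements-distinct (false ∷ s) =
  AllPairs.map⁺ (AllPairs.map (λ x≢y → x≢y ∘ Fin.suc-injective) (elements-distinct s))
elements-distinct (true ∷ s)  =
  All.map⁺ (All.universal (λ _ ()) (elements s)) ∷
  AllPairs.map⁺ (AllPairs.map (λ x≢y → x≢y ∘ Fin.suc-injective) (elements-distinct s))

module _ (p : ℕ) (p-prime : Prime p) (Γ A B : Subset p) (subgroup : IsMulSubgroup p Γ)
  (sumset : EqualsSumset Γ A B) (1<A : 1 < ∣ A ∣) (1<B : 1 < ∣ B ∣) (A≤B : ∣ A ∣ ≤ ∣ B ∣)
  (9≤Γ : 9 ≤ ∣ Γ ∣) (bound : ∣ Γ ∣ * ∣ Γ ∣ * ∣ Γ ∣ * 196 < p * p)
  where

  open ModuloPrime p p-prime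

  private
    instance
      p≢0 : ℕ.NonZero p
      p≢0 = prime⇒nonZero p-prime

    val : Fin p → ℤ
    val x = + toℕ x

    γs αs βs : List ℤ
    γs = map val (elements Γ)
    αs = map (-_ ∘ val) (elements A)
    βs = map val (elements B)

    reduce : ℕ → Fin p
    reduce k = fromℕ< (m%n<n k p)

    reduces : ∀ k → ReducesTo p k (toℕ (reduce k))
    reduces k = k / p , trans (m≡m%n+[m/n]*n k p) (cong (_+ k / p * p) (sym (Fin.toℕ-fromℕ< (m%n<n k p))))

    reduces⇒null : ∀ {k r} → ReducesTo p k r → Null (+ k ℤ.- + r)
    reduces⇒null {r = r} (q , refl) = null₁ (+ q) null-p
      (trans (cong (ℤ._- + r) (trans (ℤ.pos-+ r (q * p)) (cong (λ z → + r ℤ.+ z) (ℤ.pos-* q p)))) (alg (+ r) (+ q ℤ.* + p)))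
      where
      alg : ∀ r x → r ℤ.+ x ℤ.- r ≡ x
      alg = solve-∀

    val-injective : ∀ {x y} → x ≢ y → ¬ Null (val x ℤ.- val y)
    val-injective {x} {y} x≢y h with ℕ.≤-total (toℕ x) (toℕ y)
    ... | inj₁ x≤y = x≢y (Fin.toℕ-injective (null-small⇒≡ x≤y (Fin.toℕ<n y) (null-neg-diff (val x) (val y) h)))
    ... | inj₂ y≤x = x≢y (sym (Fin.toℕ-injective (null-small⇒≡ y≤x (Fin.toℕ<n x) h)))

    vals-distinct : ∀ s → Distinct (map val (elements s))
    vals-distinct s = AllPairs.map⁺ (AllPairs.map val-injective (elements-distinct s))

    negs-distinct : Distinct αs
    negs-distinct = AllPairs.map⁺ (AllPairs.map
      (λ {x} {y} x≢y h → val-injective x≢y (null₁ (- (+ 1)) h (alg (val x) (val y)))) (elements-distinct A))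
      where
      alg : ∀ x y → x ℤ.- y ≡ - (+ 1) ℤ.* (- x ℤ.- - y)
      alg = solve-∀

    any-val : ∀ s {x} {P : ℤ → Set} → x ∈ s → P (val x) → Any P (map val (elements s))
    any-val s x∈ h = Any.map⁺ (Any.map (λ { refl → h }) (∈-elements s x∈))

    group : Group γs
    group = record
      { distinct  = vals-distinct Γ
      ; nonzero   = All.map⁺ (All.map (λ {x} x∈ → ¬null-small (toℕ x) (ℕ.n≢0⇒n>0 (proj₁ subgroup x x∈)) (Fin.toℕ<n x)) (elements-∈ Γ))
      ; divisible = All.map⁺ (All.map (λ {x} x∈ → All.map⁺ (All.map (λ {y} → divide x y x∈) (elements-∈ Γ))) (elements-∈ Γ))
      }
      where
      divide : ∀ x y → x ∈ Γ → y ∈ Γ → Any (λ δ → Null (val y ℤ.- val x ℤ.* δ)) γs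
      divide x y x∈ y∈ with proj₂ (proj₂ (proj₂ subgroup)) x x∈
      ... | x⁻¹ , x⁻¹∈ , xx⁻¹ = any-val Γ (proj₁ (proj₂ (proj₂ subgroup)) x⁻¹ y z x⁻¹∈ y∈ (reduces (toℕ x⁻¹ * toℕ y)))
        (null₂ (val x) (- val y)
          (reduces⇒null (reduces (toℕ x⁻¹ * toℕ y))) (reduces⇒null xx⁻¹)
          (trans (alg (val x) (val y) (val z) (val x⁻¹))
            (cong₂ (λ u v → val x ℤ.* (u ℤ.- val z) ℤ.+ - val y ℤ.* (v ℤ.- + 1))
              (sym (ℤ.pos-* (toℕ x⁻¹) (toℕ y))) (sym (ℤ.pos-* (toℕ x) (toℕ x⁻¹))))))
        where
        z = reduce (toℕ x⁻¹ * toℕ y)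
        alg : ∀ x y z x⁻¹ → y ℤ.- x ℤ.* z ≡ x ℤ.* (x⁻¹ ℤ.* y ℤ.- z) ℤ.+ - y ℤ.* (x ℤ.* x⁻¹ ℤ.- + 1)
        alg = solve-∀

    sum-val : ∀ a b → + (toℕ a + toℕ b) ≡ val b ℤ.- - val a
    sum-val a b = trans (ℤ.pos-+ (toℕ a) (toℕ b)) (alg (val a) (val b))
      where
      alg : ∀ a b → a ℤ.+ b ≡ b ℤ.- - a
      alg = solve-∀

    inside : All (λ β → All (λ α → Any (λ γ → Null (β ℤ.- α ℤ.- γ)) γs) αs) βs
    inside = All.map⁺ (All.map (λ {b} b∈ → All.map⁺ (All.map (λ {a} a∈ →
        any-val Γ (proj₂ (sumset (reduce (toℕ a + toℕ b))) (a , b , a∈ , b∈ , reduces (toℕ a + toℕ b)))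
          (null-resp (cong (ℤ._- val (reduce (toℕ a + toℕ b))) (sum-val a b)) (reduces⇒null (reduces (toℕ a + toℕ b)))))
      (elements-∈ A))) (elements-∈ B))

    any-difference : ∀ {P : ℤ → Set} αs {α} → Any (α ≡_) αs → ∀ {β} → Any (β ≡_) βs → P (β ℤ.- α) →
      Any P (differences αs βs)
    any-difference (α ∷ αs) (here refl) β∈ h = Any.++⁺ˡ (Any.map⁺ (Any.map (λ { refl → h }) β∈))
    any-difference (α ∷ αs) (there α∈)  β∈ h = Any.++⁺ʳ (map (ℤ._- α) βs) (any-difference αs α∈ β∈ h)

    covered : All (λ γ → Any (λ s → Null (γ ℤ.- s)) (differences αs βs)) γs
    covered = All.map⁺ (All.map (λ {x} x∈ → cover x (proj₁ (sumset x) x∈)) (elements-∈ Γ))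
      where
      cover : ∀ x → InSumset A B x → Any (λ s → Null (val x ℤ.- s)) (differences αs βs)
      cover x (a , b , a∈ , b∈ , red) = any-difference αs
        (Any.map⁺ (Any.map (cong (-_ ∘ val)) (∈-elements A a∈)))
        (Any.map⁺ (Any.map (cong val) (∈-elements B b∈)))
        (null-resp (cong (λ z → val x ℤ.- z) (sum-val a b))
          (null-neg-diff (+ (toℕ a + toℕ b)) (val x) (reduces⇒null red)))

    size : ∀ (f : Fin p → ℤ) s → length (map f (elements s)) ≡ ∣ s ∣
    size f s = trans (length-map f (elements s)) (length-elements s)

  ordered-sumset⇒⊥ : ⊥
  ordered-sumset⇒⊥ = sumset⇒⊥ group αs βs negs-distinct (vals-distinct B)
    (subst (2 ≤_) (sym (size (-_ ∘ val) A)) 1<A) (subst (2 ≤_) (sym (size val B)) 1<B)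
    (subst₂ _≤_ (sym (size (-_ ∘ val) A)) (sym (size val B)) A≤B)
    inside covered
    (subst (9 ≤_) (sym (size val Γ)) 9≤Γ)
    (subst (λ d → d * d * d * 196 < p * p) (sym (size val Γ)) bound)

-- Symmetry, size estimate and conclusion

sumset-comm : ∀ {p} {Γ A B : Subset p} → EqualsSumset Γ A B → EqualsSumset Γ B A
sumset-comm h x = (λ x∈ → flip (proj₁ (h x) x∈)) , (λ s → proj₂ (h x) (flip s))
  where
  flip : ∀ {p} {A B : Subset p} {x} → InSumset A B x → InSumset B A x
  flip (a , b , a∈ , b∈ , k , eq) = b , a , b∈ , a∈ , k , trans (ℕ.+-comm (toℕ b) (toℕ a)) eq

^-distribʳ-* : ∀ x y k → (x * y) ^ k ≡ x ^ k * y ^ k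
^-distribʳ-* x y zero    = refl
^-distribʳ-* x y (suc k) = trans (cong ((x * y) *_) (^-distribʳ-* x y k)) (alg x y (x ^ k) (y ^ k))
  where
  alg : ∀ x y u v → x * y * (u * v) ≡ x * u * (y * v)
  alg = ℕ-Solver.solve-∀

-- With `ε = a / b`, the hypothesis is `d ≤ p^(2/3 − ε)` raised to the power `3b`. If `p² ≤ 196 d³`,
-- then `p^(2b) ≤ d^(3b) · 196^b`, while `196^b ≤ d ≤ p < p^(3a)` makes the right side smaller than
-- `d^(3b) p^(3a)`.
size-bound : ∀ a b d p → 0 < a → 0 < b → 196 ^ b ≤ d → d ≤ p → 1 < p →
  d ^ (3 * b) * p ^ (3 * a) ≤ p ^ (2 * b) → d * d * d * 196 < p * p
size-bound a b d p 0<a 0<b C≤d d≤p 1<p hyp with d * d * d * 196 ℕ.<? p * p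
... | yes lt  = lt
... | no  nlt = ⊥-elim (ℕ.<⇒≱ strict (ℕ.≤-trans hyp powers))
  where
  instance
    p≢0 : ℕ.NonZero p
    p≢0 = ℕ.>-nonZero (ℕ.<-trans (s≤s z≤n) 1<p)
    d≢0 : ℕ.NonZero d
    d≢0 = ℕ.>-nonZero (ℕ.<-≤-trans (ℕ.m^n>0 196 b) C≤d)
    d^≢0 : ℕ.NonZero (d ^ (3 * b))
    d^≢0 = ℕ.m^n≢0 d (3 * b)
  196^b<p^3a : 196 ^ b < p ^ (3 * a)
  196^b<p^3a = ℕ.≤-<-trans (ℕ.≤-trans C≤d d≤p)
    (ℕ.<-≤-trans (ℕ.<-≤-trans (ℕ.m<m*n p p 1<p) (ℕ.≤-reflexive (cong (p *_) (sym (ℕ.*-identityʳ p)))))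
      (ℕ.^-monoʳ-≤ p (ℕ.≤-trans (ℕ.n≤1+n 2) (ℕ.*-monoʳ-≤ 3 0<a))))
  strict : d ^ (3 * b) * 196 ^ b < d ^ (3 * b) * p ^ (3 * a)
  strict = ℕ.*-monoʳ-< (d ^ (3 * b)) 196^b<p^3a
  powers : p ^ (2 * b) ≤ d ^ (3 * b) * 196 ^ b
  powers = ℕ.≤-trans (ℕ.≤-reflexive (trans (sym (ℕ.^-*-assoc p 2 b)) (cong (λ x → (p * x) ^ b) (ℕ.*-identityʳ p))))
    (ℕ.≤-trans (ℕ.^-monoˡ-≤ b (ℕ.≮⇒≥ nlt))
      (ℕ.≤-reflexive (trans (^-distribʳ-* (d * d * d) 196 b)
        (cong (_* 196 ^ b) (trans (cong (_^ b) (alg d)) (ℕ.^-*-assoc d 3 b))))))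
    where
    alg : ∀ d → d * d * d ≡ d * (d * (d * 1))
    alg = ℕ-Solver.solve-∀

theorem2 : (a b : ℕ) → 0 < a → 0 < b →
    ∃ λ (C : ℕ) → (p : ℕ) → Prime p → (Γ : Subset p) → IsMulSubgroup p Γ →
    C ≤ ∣ Γ ∣ → ∣ Γ ∣ ^ (3 * b) * p ^ (3 * a) ≤ p ^ (2 * b) →
    (A B : Subset p) → 1 < ∣ A ∣ → 1 < ∣ B ∣ → ¬ EqualsSumset Γ A B
-- The constant serves twice: it makes the group have at least nine elements, hence `n ≥ 3` when the
-- summands have equal size, and it absorbs the factor `196` in `size-bound`.
theorem2 a b 0<a 0<b = 196 ^ b , λ p p-prime Γ subgroup C≤Γ hyp A B 1<A 1<B sumset →
  let 9≤Γ = ℕ.≤-trans (ℕ.≤-trans (ℕ.m≤m+n 9 187) (ℕ.≤-trans (ℕ.≤-reflexive (sym (ℕ.^-identityʳ 196))) (ℕ.^-monoʳ-≤ 196 0<b))) C≤Γ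
      bound = size-bound a b ∣ Γ ∣ p 0<a 0<b C≤Γ (∣p∣≤n Γ) (ℕ.nonTrivial⇒n>1 p {{prime⇒nonTrivial p-prime}}) hyp
  in [ (λ A≤B → ordered-sumset⇒⊥ p p-prime Γ A B subgroup sumset 1<A 1<B A≤B 9≤Γ bound)
     , (λ B≤A → ordered-sumset⇒⊥ p p-prime Γ B A subgroup (sumset-comm {A = A} {B} sumset) 1<B 1<A B≤A 9≤Γ bound)
     ]′ (ℕ.≤-total ∣ A ∣ ∣ B ∣)
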